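{- (1) For every set partition $\pi$, $\omega(\mathbf q_\pi)=\mathbf q_\pi$. (2) The set $\{\mathbf q_\pi:\pi\text{ a set partition all of whose blocks have odd size}\}$ is a linear basis of $\mathrm{NC}\Omega$. (3) As an algebra, $\mathrm{NC}\Omega$ is freely generated by $\{\mathbf p_\pi:\pi\text{ a connected set partition with all blocks of odd size}\}$, and also freely generated by $\{\mathbf q_\pi:\pi\text{ a connected set partition with all blocks of odd size}\}$.
   Context: Let $\mathbf x_1,\mathbf x_2,\dots$ be noncommuting variables over $\mathbb Q$, $[m]=\{1,\dots,m\}$. For a set partition $\pi$ of $[n]$ with blocks $\pi_1,\dots,\pi_{\ell(\pi)}$: $\mathbf m_\pi=\sum\mathbf x_{i_1}\cdots\mathbf x_{i_n}$ over tuples of positive integers with $i_j=i_k$ iff $j,k$ lie in the same block; $\mathbf p_\pi$ the same sum over tuples with $i_j=i_k$ whenever $j,k$ lie in the same block; $\mathbf e_\pi$ over tuples with $i_j\ne i_k$ whenever $j\ne k$ lie in the same block; $\mathbf h_\pi=\sum c\,\mathbf x_{i_1}\cdots\mathbf x_{i_n}$ with $c=\prod_{b,v}(\#\{j\in\pi_b:i_j=v\})!$. $\mathrm{NCSym}=\mathrm{span}\{\mathbf m_\pi\}$, and $\omega$ is the linear involution of $\mathrm{NCSym}$ with $\omega(\mathbf h_\pi)=\mathbf e_\pi$. For a set composition $\phi$ of $[n]$, $\mathbf M_\phi=\sum\mathbf x_{i_1}\cdots\mathbf x_{i_n}$ over tuples with $i_j=i_k$ iff $j,k$ are in the same block of $\phi$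 and $i_j<i_k$ iff the block of $j$ is left of that of $k$; $\mathrm{NCQSym}=\mathrm{span}\{\mathbf M_\phi\}\supseteq\mathrm{NCSym}$. For $A\subseteq[n-1]$, $\sigma\in\mathfrak S_n$, $\mathbf F_{(A,\sigma)}=\sum_f\mathbf x_{f(\sigma^{ -1}(1))}\cdots\mathbf x_{f(\sigma^{ -1}(n))}$ over weakly increasing $f:[n]\to\{1,2,\dots\}$ with $f(i)<f(i+1)$ for $i\in A$; those with $\{i:\sigma(i)>\sigma(i+1)\}\subseteq A$ form a basis of $\mathrm{NCQSym}$. Order nonzero integers by $-1\prec1\prec-2\prec2\prec\cdots$; for $\gamma,\sigma\in\mathfrak S_n$, $\mathbf K_{(\gamma,\sigma)}=\sum_f\mathbf x_{|f(\sigma^{ -1}(1))|}\cdots\mathbf x_{|f(\sigma^{ -1}(n))|}$ over $f:[n]\to\mathbb Z\setminus\{0\}$, $f(1)\preceq\cdots\preceq f(n)$, with $f(i)=f(i+1)>0\Rightarrow\gamma(i)<\gamma(i+1)$ and $f(i)=f(i+1)<0\Rightarrow\gamma(i)>\gamma(i+1)$; it depends only on $\{i:\gamma(i-1)<\gamma(i)>\gamma(i+1)\}$ and $\sigma$, giving $\mathbf K_{(B,\sigma)}$ for peak sets $B$. $\Theta_{\mathrm{NCQSym}}$ is the linear map with $\mathbf F_{(A,\sigma)}\mapsto\mathbf K_{(A\setminus((A+1)\cup\{1\}),\sigma)}$ for $\{i:\sigma(i)>\sigma(i+1)\}\subseteq A$. $\mathrm{NC}\Omega=\Theta_{\mathrm{NCQSym}}(\mathrm{NCSym})$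 and $\mathbf q_\pi=\Theta_{\mathrm{NCQSym}}(\mathbf h_\pi)$. A set partition $\pi$ of $[n]$ ($n\ge1$) is connected if there is no $0<m<n$ such that every block of $\pi$ is contained in $[m]$ or in $[n]\setminus[m]$. -}

module Defs where

open import Data.Nat using (ℕ; zero; suc; _∸_; _⊔_; _≡ᵇ_; _<ᵇ_; _≤ᵇ_; _*_; _!)
open import Data.Integer using (+_)
open import Data.Rational using (ℚ; 0ℚ; 1ℚ; _/_) renaming (_+_ to _+q_; _*_ to _*q_)
open import Data.Bool using (Bool; true; false; _∧_; _∨_; not; _xor_; if_then_else_; T)
open import Data.List using (List; []; _∷_; length; map; upTo; foldr; take; drop; concatMap)
open import Data.List.Relation.Unary.All using (All)
open import Data.List.Relation.Unary.Unique.Propositional using (Unique)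
open import Data.Product using (Σ; _×_; _,_; proj₁; proj₂)
open import Relation.Binary.PropositionalEquality using (_≡_)

-- Generic finite helpers (positions are 1-based as in the paper)

all : {A : Set} → (A → Bool) → List A → Bool
all p []       = true
all p (x ∷ xs) = p x ∧ all p xs

any : {A : Set} → (A → Bool) → List A → Bool
any p []       = false
any p (x ∷ xs) = p x ∨ any p xs

lookupD : List ℕ → ℕ → ℕ
lookupD []       _       = 0
lookupD (x ∷ xs) zero    = x
lookupD (x ∷ xs) (suc i) = lookupD xs i

at : List ℕ → ℕ → ℕ
at xs j = lookupD xs (j ∸ 1)

lookupB : List Bool → ℕ → Bool
lookupB []       _       = false
lookupB (x ∷ xs) zero    = x
lookupB (x ∷ xs) (suc i) = lookupB xs i

atB : List Bool → ℕ → Bool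
atB xs j = lookupB xs (j ∸ 1)

range1 : ℕ → List ℕ
range1 n = map suc (upTo n)

_⇔ᵇ_ : Bool → Bool → Bool
a ⇔ᵇ b = not (a xor b)

_⇒ᵇ_ : Bool → Bool → Bool
a ⇒ᵇ b = not a ∨ b

countB : {A : Set} → (A → Bool) → List A → ℕ
countB p []       = 0
countB p (x ∷ xs) = if p x then suc (countB p xs) else countB p xs

maxL : List ℕ → ℕ
maxL = foldr _⊔_ 0

ℕtoℚ : ℕ → ℚ
ℕtoℚ n = (+ n) / 1

prodQ : List ℚ → ℚ
prodQ = foldr _*q_ 1ℚ

-- Set partitions of [n], encoded canonically as restricted growth
-- strings: the list of block labels (a₁,…,aₙ); j,k are in the same block
-- iff aⱼ = aₖ; labels are assigned in order of first appearance, so each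
-- set partition has exactly one encoding.

rgsFrom : ℕ → List ℕ → Bool
rgsFrom m []       = true
rgsFrom m (a ∷ as) = (a ≤ᵇ m) ∧ rgsFrom (m ⊔ suc a) as

isRGS : List ℕ → Bool
isRGS = rgsFrom 0

SetPartition : Set
SetPartition = Σ (List ℕ) (λ l → T (isRGS l))

size : SetPartition → ℕ
size π = length (proj₁ π)

-- number of blocks ℓ(π); the blocks carry labels 0,…,ℓ(π)-1
nblocks : SetPartition → ℕ
nblocks π = foldr (λ a m → suc a ⊔ m) 0 (proj₁ π)

sameBlock : SetPartition → ℕ → ℕ → Bool
sameBlock π j k = at (proj₁ π) j ≡ᵇ at (proj₁ π) k

blockSize : SetPartition → ℕ → ℕ
blockSize π b = countB (λ j → at (proj₁ π) j ≡ᵇ b) (range1 (size π))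

isOddB : ℕ → Bool
isOddB zero          = false
isOddB (suc zero)    = true
isOddB (suc (suc n)) = isOddB n

allOddB : SetPartition → Bool
allOddB π = all (λ b → isOddB (blockSize π b)) (upTo (nblocks π))

-- connected: n ≥ 1 and there is no 0<m<n such that every block is
-- contained in [m] or in [n]∖[m]
connectedB : SetPartition → Bool
connectedB π =
  (1 ≤ᵇ size π) ∧
  all (λ m → not (all (λ j → all (λ k → not (sameBlock π j k))
                                     (map (λ i → m + i) (range1 (size π ∸ m))))
                      (range1 m)))
      (range1 (size π ∸ 1))
  where open Data.Nat using (_+_)

-- Noncommutative formal power series over ℚ in x₁,x₂,…
-- A monomial x_{i₁}⋯x_{iₙ} is the word (i₁-1,…,iₙ-1) : List ℕ
-- (letter a : ℕ stands for the variable x_{a+1}; this shift preserves order).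
-- A series is its coefficient function.

Series : Set
Series = List ℕ → ℚ

_≈_ : Series → Series → Set
f ≈ g = ∀ w → f w ≡ g w
infix 4 _≈_

0S : Series
0S _ = 0ℚ

_+S_ : Series → Series → Series
(f +S g) w = f w +q g w

_·S_ : ℚ → Series → Series
(c ·S f) w = c *q f w

_*S_ : Series → Series → Series
(f *S g) w = foldr _+q_ 0ℚ (map (λ k → f (take k w) *q g (drop k w)) (upTo (suc (length w))))

1S : Series
1S []      = 1ℚ
1S (_ ∷ _) = 0ℚ

lincomb : {I : Set} → (I → Series) → List (I × ℚ) → Series
lincomb v []             = 0S
lincomb v ((i , c) ∷ L)  = (c ·S v i) +S lincomb v L

monomial : {I : Set} → (I → Series) → List I → Series
monomial v []       = 1S
monomial v (i ∷ is) = v i *S monomial v is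

private
  indicator : Bool → ℚ
  indicator b = if b then 1ℚ else 0ℚ

allPairs : ℕ → (ℕ → ℕ → Bool) → Bool
allPairs n P = all (λ j → all (λ k → P j k) (range1 n)) (range1 n)

mS : SetPartition → Series
mS π w = indicator ((length w ≡ᵇ size π) ∧
  allPairs (size π) (λ j k → (at w j ≡ᵇ at w k) ⇔ᵇ sameBlock π j k))

pS : SetPartition → Series
pS π w = indicator ((length w ≡ᵇ size π) ∧
  allPairs (size π) (λ j k → sameBlock π j k ⇒ᵇ (at w j ≡ᵇ at w k)))

eS : SetPartition → Series
eS π w = indicator ((length w ≡ᵇ size π) ∧
  allPairs (size π) (λ j k → (not (j ≡ᵇ k) ∧ sameBlock π j k) ⇒ᵇ not (at w j ≡ᵇ at w k)))

-- coefficient ∏_{b,v} (#{j ∈ π_b : i_j = v})!   (factors with v > max letter are 0! = 1)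
hS : SetPartition → Series
hS π w = if length w ≡ᵇ size π
  then prodQ (concatMap (λ b → map (λ v →
          ℕtoℚ ((countB (λ j → (at (proj₁ π) j ≡ᵇ b) ∧ (at w j ≡ᵇ v)) (range1 (size π))) !))
          (upTo (suc (maxL w)))) (upTo (nblocks π)))
  else 0ℚ

-- Fundamental basis F and peak basis K of NCQSym
-- Permutations of [n] are functions ℕ → ℕ restricting to a bijection of [n];
-- subsets of [n-1] are lists of elements of [n-1].

isPermB : ℕ → (ℕ → ℕ) → Bool
isPermB n σ = all (λ i → (1 ≤ᵇ σ i) ∧ (σ i ≤ᵇ n)) (range1 n) ∧
              allPairs n (λ i j → (σ i ≡ᵇ σ j) ⇒ᵇ (i ≡ᵇ j))

memB : ℕ → List ℕ → Bool
memB i A = any (λ a → a ≡ᵇ i) A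

subsetB : ℕ → List ℕ → Bool
subsetB n A = all (λ a → (1 ≤ᵇ a) ∧ (a ≤ᵇ n ∸ 1)) A

FS : ℕ → List ℕ → (ℕ → ℕ) → Series
FS n A σ w = indicator ((length w ≡ᵇ n) ∧
  all (λ i → (at w (σ i) ≤ᵇ at w (σ (suc i))) ∧ (memB i A ⇒ᵇ (at w (σ i) <ᵇ at w (σ (suc i)))))
      (range1 (n ∸ 1)))

allSigns : ℕ → List (List Bool)
allSigns zero    = [] ∷ []
allSigns (suc n) = concatMap (λ s → (true ∷ s) ∷ (false ∷ s) ∷ []) (allSigns n)

-- K_(γ,σ): count the f : [n] → ℤ∖{0} with |f(i)| = (letter w_{σ(i)}) ;
-- a sign vector s (true = positive) determines f.  The order
-- -1 ≺ 1 ≺ -2 ≺ 2 ≺ ⋯ is encoded by key(-(a+1)) = 2a, key(a+1) = 2a+1.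
KS : ℕ → (ℕ → ℕ) → (ℕ → ℕ) → Series
KS n γ σ w = if length w ≡ᵇ n then ℕtoℚ (countB ok (allSigns n)) else 0ℚ
  where
  key : List Bool → ℕ → ℕ
  key s i = 2 * at w (σ i) + (if atB s i then 1 else 0)
    where open Data.Nat using (_+_)
  ok : List Bool → Bool
  ok s = all (λ i → (key s i ≤ᵇ key s (suc i)) ∧
                    ((key s i ≡ᵇ key s (suc i)) ⇒ᵇ
                       (if atB s i then γ i <ᵇ γ (suc i) else γ (suc i) <ᵇ γ i)))
             (range1 (n ∸ 1))

isPeakB : ℕ → (ℕ → ℕ) → ℕ → Bool
isPeakB n γ i = (2 ≤ᵇ i) ∧ (i ≤ᵇ n ∸ 1) ∧ (γ (i ∸ 1) <ᵇ γ i) ∧ (γ (suc i) <ᵇ γ i)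

thetaSetB : List ℕ → ℕ → Bool
thetaSetB A i = memB i A ∧ not (memB (i ∸ 1) A ∧ (1 ≤ᵇ i ∸ 1)) ∧ not (i ≡ᵇ 1)

-- one term c·F_(A,σ) ↦ c·K_(B,σ), B = A∖((A+1)∪{1}), where K_(B,σ) = K_(γ,σ)
-- for a permutation γ with peak set B
record ThetaTerm : Set where
  constructor thetaTerm
  field
    n     : ℕ
    A     : List ℕ
    σ     : ℕ → ℕ
    γ     : ℕ → ℕ
    coeff : ℚ

validTermB : ThetaTerm → Bool
validTermB t = subsetB n A ∧ isPermB n σ ∧ isPermB n γ ∧
  all (λ i → (σ (suc i) <ᵇ σ i) ⇒ᵇ memB i A) (range1 (n ∸ 1)) ∧
  all (λ i → isPeakB n γ i ⇔ᵇ thetaSetB A i) (range1 n)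
  where open ThetaTerm t

sumF : List ThetaTerm → Series
sumF []      = 0S
sumF (t ∷ L) = (ThetaTerm.coeff t ·S FS (ThetaTerm.n t) (ThetaTerm.A t) (ThetaTerm.σ t)) +S sumF L

sumK : List ThetaTerm → Series
sumK []      = 0S
sumK (t ∷ L) = (ThetaTerm.coeff t ·S KS (ThetaTerm.n t) (ThetaTerm.γ t) (ThetaTerm.σ t)) +S sumK L

-- Θ_NCQSym(f) = g  (Θ is the linear extension of F_(A,σ) ↦ K_(B,σ))
ThetaRel : Series → Series → Set
ThetaRel f g = Σ (List ThetaTerm) λ L →
  All (λ t → T (validTermB t)) L × (f ≈ sumF L) × (g ≈ sumK L)

InNCSym : Series → Set
InNCSym f = Σ (List (SetPartition × ℚ)) λ L → f ≈ lincomb mS L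

-- f ∈ NCSym and ω(f) = g   (ω linear with ω(h_π) = e_π)
OmegaRel : Series → Series → Set
OmegaRel f g = Σ (List (SetPartition × ℚ)) λ L → (f ≈ lincomb hS L) × (g ≈ lincomb eS L)

InNCΩ : Series → Set
InNCΩ g = Σ Series λ f → InNCSym f × ThetaRel f g

LinIndep : {I : Set} → (I → Set) → (I → Series) → Set
LinIndep {I} P v = (L : List I) → Unique L → All P L → (c : I → ℚ) →
  lincomb v (map (λ i → i , c i) L) ≈ 0S → All (λ i → c i ≡ 0ℚ) L

SpansNCΩ : {I : Set} → (I → Set) → (I → Series) → Set
SpansNCΩ {I} P v = ∀ g → InNCΩ g →
  Σ (List (I × ℚ)) λ L → All (λ x → P (proj₁ x)) L × (g ≈ lincomb v L)

IsBasisNCΩ : {I : Set} → (I → Set) → (I → Series) → Set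
IsBasisNCΩ P v = (∀ i → P i → InNCΩ (v i)) × LinIndep P v × SpansNCΩ P v

FreelyGeneratesNCΩ : {I : Set} → (I → Set) → (I → Series) → Set
FreelyGeneratesNCΩ P v = (∀ i → P i → InNCΩ (v i)) ×
  LinIndep (All P) (monomial v) × SpansNCΩ (All P) (monomial v)

AllOdd : SetPartition → Set
AllOdd π = T (allOddB π)

ConnectedOdd : SetPartition → Set
ConnectedOdd π = T (connectedB π ∧ allOddB π)

{-# OPTIONS --safe #-}
-- Θ is induced by a linear operator on all series with F_(A,σ) ↦ K_(A,σ): each letter of a word gets a sign,
-- and the positions carrying a negative letter are integrated, one after the other, against the Euler
-- characteristic of an open interval.  An F is a product of order relations along a chain of positions, and
-- integrating one position out of a chain yields a multiple of a shorter chain; the resulting sum over signs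
-- depends only on the peaks.  A power sum is a product of equalities, so the operator scales p_ρ by the
-- product over the blocks B of 1 + (-1)^(|B| - 1), that is, by 2^ℓ(ρ) if all blocks are odd and by 0 otherwise.
--
-- Expanding h_π = Σ p_ρ and e_π = Σ ±p_ρ over the cycle partitions ρ of the permutations preserving the blocks
-- of π, one gets q_π = Σ 2^ℓ(ρ) p_ρ over the ρ with odd blocks only, where the sign in e_π is +.  As ρ = π or
-- ρ is strictly finer, these expansions are triangular: hence ω fixes q_π, and the q_π with odd blocks have
-- the same span as the linearly independent p_π with odd blocks.  Both families are multiplicative for
-- concatenation of set partitions, which factor uniquely into connected ones.
--
-- Words and label strings are processed from their last position, so most functions act on reversed lists.

module Submission where

open import Defs
open import Data.Bool.Base using (Bool; true; false; _∧_; _∨_; _xor_; not; if_then_else_; T)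
open import Data.Empty using (⊥; ⊥-elim)
open import Data.List.Base using (List; []; _∷_; _∷ʳ_; [_]; _++_; length; map; concatMap; foldr; reverse; upTo; take; drop; deduplicate)
open import Data.List.Properties using (++-identityʳ; length-++; length-map; length-reverse; map-++; map-∘; map-cong; unfold-reverse; reverse-++; reverse-involutive; reverse-map; upTo-∷ʳ; map-upTo; map-applyUpTo; ≡-dec; ∷-injective)
open import Data.List.Membership.Propositional using (_∈_; _∉_)
open import Data.List.Membership.Propositional.Properties using (∈-map⁺; ∈-map⁻; ∈-++⁺ˡ; ∈-++⁺ʳ; ∈-++⁻; ∈-∃++; ∈-deduplicate⁺; ∈-deduplicate⁻)
open import Data.List.Relation.Unary.All using (All; []; _∷_)
open import Data.List.Relation.Unary.AllPairs using ([]; _∷_)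
open import Data.List.Relation.Unary.Any using (here; there)
open import Data.List.Relation.Unary.Unique.Propositional using (Unique)
open import Data.List.Relation.Binary.Permutation.Propositional using (_↭_; ↭-sym; ↭-trans; ↭-prep; ↭-refl)
open import Data.List.Relation.Binary.Permutation.Propositional.Properties using (shift; drop-∷; ∈-resp-↭; All-resp-↭; ↭-length; ↭-reverse)
open import Data.Nat.Base using (ℕ; zero; suc; _+_; _*_; _∸_; _^_; _≤_; _<_; _⊔_; _≡ᵇ_; _<ᵇ_; _≤ᵇ_; z≤n; s≤s; _!)
open import Data.Product.Base using (Σ; _×_; _,_; proj₁; proj₂)
open import Data.Rational.Base using (ℚ; 0ℚ; 1ℚ) renaming (_+_ to _+q_; _*_ to _*q_; -_ to -q_; 1/_ to 1/q_)
open import Data.Sum.Base using (_⊎_; inj₁; inj₂)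
open import Data.Unit.Base using (⊤; tt)
open import Function.Base using (_∘_; id; case_of_)
open import Relation.Nullary using (¬_; Dec; yes; no)
open import Relation.Binary.Definitions using (tri<; tri≈; tri>)
open import Relation.Binary.PropositionalEquality using (_≡_; _≢_; refl; sym; trans; cong; cong₂; subst; subst₂; module ≡-Reasoning; _≗_)

import Data.Integer.Base as ℤ
open ℤ using (+_)
import Data.Integer.Properties as ℤP
import Data.List.Relation.Unary.All.Properties as AllP
import Data.List.Relation.Unary.Unique.DecPropositional.Properties as DecUniqueP
import Data.List.Relation.Unary.Unique.Propositional.Properties as UniqueP
import Data.Nat.Properties as ℕP
import Data.Rational.Properties as ℚP
open import Data.Rational.Unnormalised.Base as ℚᵘ using (mkℚᵘ; *≡*)
import Data.Rational.Unnormalised.Properties as ℚᵘP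
import Data.Rational.Solver as ℚSolver
import Data.Rational.Base as ℚ
import Data.List.Relation.Binary.Permutation.Propositional as Perm
open ≡-Reasoning
open ℚSolver.+-*-Solver using (solve; _:=_; _:+_; _:*_; :-_; con)

-- `ThetaRel f g` only says that some expansion of `f` into functions F exists, and no expansion of
-- a power sum into them is available. An operator defined on every series answers both
-- difficulties: it has the prescribed value on each F, so `g` is determined by `f`, and it can be
-- evaluated on p_ρ itself, an equality being a weak inequality minus a strict one.
--
-- The measure is dictated by K: between equal letters, a negative sign exchanges the roles of weak
-- and strict steps. An open interval, with mass +1 on each open piece and -1 on each interior grid
-- point, does just this: for a point inside it, a weak inequality with the moving variable
-- integrates to 0 and a strict one to 1, the reverse of what happens at a point.
--
-- Variables are integrated in the order of positions, but the chain of an F follows σ. So a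
-- position is removed while its neighbours in the chain may lie in either order, and the identity
-- used must hold in all cases, for points and for signed letters alike.
--
-- Membership in NCΩ still requires an honest expansion into F; the hypothesis on `q` supplies it
-- for each h_π, and linear combinations of these suffice.

private variable
  A B I I′ : Set

-- Booleans, indicators and comparisons of natural numbers

ind : Bool → ℚ
ind b = if b then 1ℚ else 0ℚ

-1ℚ : ℚ
-1ℚ = -q 1ℚ

ind-∧ : ∀ a b → ind (a ∧ b) ≡ ind a *q ind b
ind-∧ true  b = sym (ℚP.*-identityˡ (ind b))
ind-∧ false b = sym (ℚP.*-zeroˡ (ind b))

1≢0ℚ : 1ℚ ≢ 0ℚ
1≢0ℚ ()

ind≢0 : ∀ {b} → ind b ≢ 0ℚ → b ≡ true
ind≢0 {true}  _ = refl
ind≢0 {false} h = ⊥-elim (h refl)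

T⇒≡ : ∀ {b} → T b → b ≡ true
T⇒≡ {true} _ = refl

≡⇒T : ∀ {b} → b ≡ true → T b
≡⇒T refl = tt

T-irr : ∀ {b} (s t : T b) → s ≡ t
T-irr {true} tt tt = refl

∧-split : ∀ {a b} → a ∧ b ≡ true → (a ≡ true) × (b ≡ true)
∧-split {true} {true} _ = refl , refl

∧-comm : ∀ a b → a ∧ b ≡ b ∧ a
∧-comm true  true  = refl
∧-comm true  false = refl
∧-comm false true  = refl
∧-comm false false = refl

≡⇔ : ∀ {a b} → (a ≡ true → b ≡ true) → (b ≡ true → a ≡ true) → a ≡ b
≡⇔ {true}  {b}     f g = sym (f refl)
≡⇔ {false} {true}  f g = g refl
≡⇔ {false} {false} f g = refl

≡ᵇ-yes : ∀ m n → m ≡ n → (m ≡ᵇ n) ≡ true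
≡ᵇ-yes m n e = T⇒≡ (ℕP.≡⇒≡ᵇ m n e)

≡ᵇ-true : ∀ m n → (m ≡ᵇ n) ≡ true → m ≡ n
≡ᵇ-true m n e = ℕP.≡ᵇ⇒≡ m n (≡⇒T e)

≡ᵇ-no : ∀ m n → m ≢ n → (m ≡ᵇ n) ≡ false
≡ᵇ-no m n ne with m ≡ᵇ n in eq
... | false = refl
... | true  = ⊥-elim (ne (≡ᵇ-true m n eq))

≡ᵇ-refl : ∀ m → (m ≡ᵇ m) ≡ true
≡ᵇ-refl m = ≡ᵇ-yes m m refl

≡ᵇ-false : ∀ m n → (m ≡ᵇ n) ≡ false → m ≢ n
≡ᵇ-false m n e refl with () ← trans (sym e) (≡ᵇ-refl m)

≡ᵇ-sym : ∀ m n → (m ≡ᵇ n) ≡ (n ≡ᵇ m)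
≡ᵇ-sym m n = ≡⇔ (λ e → ≡ᵇ-yes n m (sym (≡ᵇ-true m n e))) (λ e → ≡ᵇ-yes m n (sym (≡ᵇ-true n m e)))

<ᵇ-yes : ∀ m n → m < n → (m <ᵇ n) ≡ true
<ᵇ-yes m n m<n = T⇒≡ (ℕP.<⇒<ᵇ m<n)

<ᵇ-true : ∀ m n → (m <ᵇ n) ≡ true → m < n
<ᵇ-true m n e = ℕP.<ᵇ⇒< m n (≡⇒T e)

<ᵇ-no : ∀ m n → n ≤ m → (m <ᵇ n) ≡ false
<ᵇ-no m n n≤m with m <ᵇ n in eq
... | false = refl
... | true  = ⊥-elim (ℕP.<⇒≱ (<ᵇ-true m n eq) n≤m)

≤ᵇ-yes : ∀ m n → m ≤ n → (m ≤ᵇ n) ≡ true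
≤ᵇ-yes m n m≤n = T⇒≡ (ℕP.≤⇒≤ᵇ m≤n)

≤ᵇ-true : ∀ m n → (m ≤ᵇ n) ≡ true → m ≤ n
≤ᵇ-true m n e = ℕP.≤ᵇ⇒≤ m n (≡⇒T e)

≤ᵇ-no : ∀ m n → n < m → (m ≤ᵇ n) ≡ false
≤ᵇ-no m n n<m with m ≤ᵇ n in eq
... | false = refl
... | true  = ⊥-elim (ℕP.<⇒≱ n<m (≤ᵇ-true m n eq))

-- Rational arithmetic and finite sums

ℕtoℚ-+ : ∀ m n → ℕtoℚ (m + n) ≡ ℕtoℚ m +q ℕtoℚ n
ℕtoℚ-+ m n = ℚP.toℚᵘ-injective (ℚᵘP.≃-trans (ℚP.toℚᵘ-fromℚᵘ (mkℚᵘ (+ (m + n)) 0))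
  (ℚᵘP.≃-trans (*≡* (cong (ℤ._* + 1) (sym (cong₂ ℤ._+_ (ℤP.*-identityʳ (+ m)) (ℤP.*-identityʳ (+ n))))))
  (ℚᵘP.≃-sym (ℚᵘP.≃-trans (ℚP.toℚᵘ-homo-+ (ℕtoℚ m) (ℕtoℚ n))
    (ℚᵘP.+-cong (ℚP.toℚᵘ-fromℚᵘ (mkℚᵘ (+ m) 0)) (ℚP.toℚᵘ-fromℚᵘ (mkℚᵘ (+ n) 0)))))))

ℕtoℚ-* : ∀ m n → ℕtoℚ (m * n) ≡ ℕtoℚ m *q ℕtoℚ n
ℕtoℚ-* zero    n = sym (ℚP.*-zeroˡ (ℕtoℚ n))
ℕtoℚ-* (suc m) n = begin
  ℕtoℚ (n + m * n)                ≡⟨ ℕtoℚ-+ n (m * n) ⟩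
  ℕtoℚ n +q ℕtoℚ (m * n)          ≡⟨ cong (ℕtoℚ n +q_) (ℕtoℚ-* m n) ⟩
  ℕtoℚ n +q ℕtoℚ m *q ℕtoℚ n      ≡⟨ solve 2 (λ x y → x :+ y :* x := (con 1ℚ :+ y) :* x) refl (ℕtoℚ n) (ℕtoℚ m) ⟩
  (1ℚ +q ℕtoℚ m) *q ℕtoℚ n        ≡⟨ cong (_*q ℕtoℚ n) (sym (ℕtoℚ-+ 1 m)) ⟩
  ℕtoℚ (suc m) *q ℕtoℚ n          ∎

ℕtoℚ-injective : ∀ {m n} → ℕtoℚ m ≡ ℕtoℚ n → m ≡ n
ℕtoℚ-injective {m} {n} e with ℚP.fromℚᵘ-injective {mkℚᵘ (+ m) 0} {mkℚᵘ (+ n) 0} e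
... | *≡* h = ℤP.+-injective (ℤP.*-cancelʳ-≡ (+ m) (+ n) (+ 1) h)

*-integral : ∀ {x y : ℚ} → x ≢ 0ℚ → x *q y ≡ 0ℚ → y ≡ 0ℚ
*-integral {x} {y} x≢0 e = begin
  y                 ≡⟨ sym (ℚP.*-identityˡ y) ⟩
  1ℚ *q y           ≡⟨ cong (_*q y) (sym (ℚP.*-inverseˡ x)) ⟩
  1/q x *q x *q y   ≡⟨ ℚP.*-assoc (1/q x) x y ⟩
  1/q x *q (x *q y) ≡⟨ cong (1/q x *q_) e ⟩
  1/q x *q 0ℚ       ≡⟨ ℚP.*-zeroʳ (1/q x) ⟩
  0ℚ                ∎
  where instance _ = ℚ.≢-nonZero x≢0

inverse : ∀ x → x ≢ 0ℚ → Σ ℚ λ y → y *q x ≡ 1ℚ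
inverse x x≢0 = 1/q x , ℚP.*-inverseˡ x
  where instance _ = ℚ.≢-nonZero x≢0

*≢0 : ∀ {x y : ℚ} → x ≢ 0ℚ → y ≢ 0ℚ → x *q y ≢ 0ℚ
*≢0 x≢0 y≢0 e = y≢0 (*-integral x≢0 e)

+-interchange : ∀ a b c d → (a +q b) +q (c +q d) ≡ (a +q c) +q (b +q d)
+-interchange = solve 4 (λ a b c d → (a :+ b) :+ (c :+ d) := (a :+ c) :+ (b :+ d)) refl

neg≡-1* : ∀ x → -q x ≡ -1ℚ *q x
neg≡-1* = solve 1 (λ x → :- x := con -1ℚ :* x) refl

∑ : List A → (A → ℚ) → ℚ
∑ []       f = 0ℚ
∑ (x ∷ xs) f = f x +q ∑ xs f

∑-cong : ∀ (xs : List A) {f g} → (∀ x → f x ≡ g x) → ∑ xs f ≡ ∑ xs g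
∑-cong []       h = refl
∑-cong (x ∷ xs) h = cong₂ _+q_ (h x) (∑-cong xs h)

∑-cong-All : ∀ {P : A → Set} {xs : List A} {f g} → All P xs → (∀ x → P x → f x ≡ g x) → ∑ xs f ≡ ∑ xs g
∑-cong-All []       h = refl
∑-cong-All (p ∷ ps) h = cong₂ _+q_ (h _ p) (∑-cong-All ps h)

∑-0 : ∀ (xs : List A) → ∑ xs (λ _ → 0ℚ) ≡ 0ℚ
∑-0 []       = refl
∑-0 (x ∷ xs) = trans (ℚP.+-identityˡ _) (∑-0 xs)

∑-zero : ∀ (xs : List A) {f} → (∀ x → f x ≡ 0ℚ) → ∑ xs f ≡ 0ℚ
∑-zero xs h = trans (∑-cong xs h) (∑-0 xs)

∑-++ : ∀ (xs ys : List A) f → ∑ (xs ++ ys) f ≡ ∑ xs f +q ∑ ys f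
∑-++ []       ys f = sym (ℚP.+-identityˡ _)
∑-++ (x ∷ xs) ys f = trans (cong (f x +q_) (∑-++ xs ys f)) (sym (ℚP.+-assoc (f x) (∑ xs f) (∑ ys f)))

∑-map : ∀ (g : A → B) xs f → ∑ (map g xs) f ≡ ∑ xs (f ∘ g)
∑-map g []       f = refl
∑-map g (x ∷ xs) f = cong (f (g x) +q_) (∑-map g xs f)

∑-concatMap : ∀ (g : A → List B) xs f → ∑ (concatMap g xs) f ≡ ∑ xs (λ x → ∑ (g x) f)
∑-concatMap g []       f = refl
∑-concatMap g (x ∷ xs) f = trans (∑-++ (g x) (concatMap g xs) f) (cong (∑ (g x) f +q_) (∑-concatMap g xs f))

∑-+ : ∀ (xs : List A) f g → ∑ xs (λ x → f x +q g x) ≡ ∑ xs f +q ∑ xs g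
∑-+ []       f g = refl
∑-+ (x ∷ xs) f g = trans (cong ((f x +q g x) +q_) (∑-+ xs f g))
  (+-interchange (f x) (g x) (∑ xs f) (∑ xs g))

∑-*ˡ : ∀ (xs : List A) c f → ∑ xs (λ x → c *q f x) ≡ c *q ∑ xs f
∑-*ˡ []       c f = sym (ℚP.*-zeroʳ c)
∑-*ˡ (x ∷ xs) c f = trans (cong (c *q f x +q_) (∑-*ˡ xs c f)) (sym (ℚP.*-distribˡ-+ c (f x) (∑ xs f)))

∑-*ʳ : ∀ (xs : List A) c f → ∑ xs (λ x → f x *q c) ≡ ∑ xs f *q c
∑-*ʳ xs c f = trans (∑-cong xs (λ x → ℚP.*-comm (f x) c)) (trans (∑-*ˡ xs c f) (ℚP.*-comm c (∑ xs f)))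

∑-swap : ∀ (xs : List A) (ys : List B) (f : A → B → ℚ) → ∑ xs (λ x → ∑ ys (f x)) ≡ ∑ ys (λ y → ∑ xs (λ x → f x y))
∑-swap []       ys f = sym (∑-0 ys)
∑-swap (x ∷ xs) ys f = trans (cong (∑ ys (f x) +q_) (∑-swap xs ys f)) (sym (∑-+ ys (f x) (λ y → ∑ xs (λ x → f x y))))

lincomb-∑ : ∀ {I : Set} (v : I → Series) L w → lincomb v L w ≡ ∑ L (λ x → proj₂ x *q v (proj₁ x) w)
lincomb-∑ v []            w = refl
lincomb-∑ v ((i , c) ∷ L) w = cong (c *q v i w +q_) (lincomb-∑ v L w)

bothSigns : List Bool
bothSigns = true ∷ false ∷ []

∑-allSigns : ∀ n f → ∑ (allSigns (suc n)) f ≡ ∑ (allSigns n) (λ s → f (true ∷ s) +q f (false ∷ s))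
∑-allSigns n f = trans (∑-concatMap (λ s → (true ∷ s) ∷ (false ∷ s) ∷ []) (allSigns n) f)
  (∑-cong (allSigns n) (λ s → cong (f (true ∷ s) +q_) (ℚP.+-identityʳ (f (false ∷ s)))))

allSigns-length : ∀ n → All (λ s → length s ≡ n) (allSigns n)
allSigns-length zero    = refl ∷ []
allSigns-length (suc n) = go (allSigns-length n)
  where
  go : ∀ {L} → All (λ s → length s ≡ n) L → All (λ s → length s ≡ suc n) (concatMap (λ s → (true ∷ s) ∷ (false ∷ s) ∷ []) L)
  go []       = []
  go (p ∷ ps) = cong suc p ∷ cong suc p ∷ go ps

ind-count : ∀ (p : A → Bool) L → ℕtoℚ (countB p L) ≡ ∑ L (ind ∘ p)
ind-count p []      = refl
ind-count p (x ∷ L) with p x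
... | true  = trans (ℕtoℚ-+ 1 (countB p L)) (cong (1ℚ +q_) (ind-count p L))
... | false = trans (ind-count p L) (sym (ℚP.+-identityˡ _))

-- Conjunctions over 1, …, n

range1-∷ʳ : ∀ n → range1 (suc n) ≡ range1 n ∷ʳ suc n
range1-∷ʳ n = trans (cong (map suc) (sym (upTo-∷ʳ n))) (map-++ suc (upTo n) [ n ])

range1-suc : ∀ n → range1 (suc n) ≡ 1 ∷ map suc (range1 n)
range1-suc n = cong (1 ∷_) (trans (map-applyUpTo suc suc n)
  (sym (trans (cong (map suc) (map-upTo suc n)) (map-applyUpTo suc suc n))))

all-∷ʳ : ∀ (p : A → Bool) xs x → all p (xs ∷ʳ x) ≡ all p xs ∧ p x
all-∷ʳ p []       x = ∧-comm (p x) true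
all-∷ʳ p (y ∷ xs) x with p y
... | true  = all-∷ʳ p xs x
... | false = refl

all-∧ : ∀ (p q : A → Bool) xs → all (λ x → p x ∧ q x) xs ≡ all p xs ∧ all q xs
all-∧ p q []       = refl
all-∧ p q (x ∷ xs) with p x | q x
... | true  | true  = all-∧ p q xs
... | true  | false = ∧-comm false (all p xs)
... | false | _     = refl

all-map : ∀ (g : A → B) p xs → all p (map g xs) ≡ all (p ∘ g) xs
all-map g p []       = refl
all-map g p (x ∷ xs) = cong (p (g x) ∧_) (all-map g p xs)

all-range-suc : ∀ p n → all p (range1 (suc n)) ≡ all p (range1 n) ∧ p (suc n)
all-range-suc p n = trans (cong (all p) (range1-∷ʳ n)) (all-∷ʳ p (range1 n) (suc n))

all-range-cong : ∀ n {p q : ℕ → Bool} → (∀ j → 1 ≤ j → j ≤ n → p j ≡ q j) → all p (range1 n) ≡ all q (range1 n)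
all-range-cong zero    h = refl
all-range-cong (suc n) {p} {q} h = trans (all-range-suc p n) (trans
  (cong₂ _∧_ (all-range-cong n (λ j 1≤j j≤n → h j 1≤j (ℕP.m≤n⇒m≤1+n j≤n))) (h (suc n) (s≤s z≤n) ℕP.≤-refl))
  (sym (all-range-suc q n)))

all-true : ∀ {p : A → Bool} {xs} → all p xs ≡ true → ∀ {x} → x ∈ xs → p x ≡ true
all-true e (here refl)        = proj₁ (∧-split e)
all-true {p = p} {y ∷ xs} e (there h) = all-true (proj₂ (∧-split {p y} e)) h

all-intro : ∀ {p : A → Bool} xs → (∀ {x} → x ∈ xs → p x ≡ true) → all p xs ≡ true
all-intro []       h = refl
all-intro (x ∷ xs) h = cong₂ _∧_ (h (here refl)) (all-intro xs (λ i → h (there i)))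

∈-range1 : ∀ {j n} → 1 ≤ j → j ≤ n → j ∈ range1 n
∈-range1 {n = zero}  1≤j j≤0 = ⊥-elim (ℕP.<⇒≱ 1≤j j≤0)
∈-range1 {j} {suc n} 1≤j j≤n with ℕP.m≤n⇒m<n∨m≡n j≤n
... | inj₁ j<n  = subst (j ∈_) (sym (range1-∷ʳ n)) (∈-++⁺ˡ (∈-range1 1≤j (ℕP.≤-pred j<n)))
... | inj₂ refl = subst (j ∈_) (sym (range1-∷ʳ n)) (∈-++⁺ʳ (range1 n) (here refl))

range1-∈ : ∀ {j n} → j ∈ range1 n → (1 ≤ j) × (j ≤ n)
range1-∈ {n = suc n} h with ∈-++⁻ (range1 n) (subst (_ ∈_) (range1-∷ʳ n) h)
... | inj₁ i           = proj₁ (range1-∈ i) , ℕP.m≤n⇒m≤1+n (proj₂ (range1-∈ i))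
... | inj₂ (here refl) = s≤s z≤n , ℕP.≤-refl

-- Doubling and cells

dbl : ℕ → ℕ
dbl n = n + n

dbl-suc : ∀ n → dbl (suc n) ≡ suc (suc (dbl n))
dbl-suc n = cong suc (ℕP.+-suc n n)

dbl-< : ∀ {m n} → m < n → suc (dbl m) < dbl n
dbl-< {m} {n} m<n = subst (_≤ dbl n) (dbl-suc m) (ℕP.+-mono-≤ m<n m<n)

dbl-≤ : ∀ {m n} → m ≤ n → dbl m ≤ dbl n
dbl-≤ m≤n = ℕP.+-mono-≤ m≤n m≤n

dbl-<⁻ : ∀ {m n} → dbl m < dbl n → m < n
dbl-<⁻ h = ℕP.≰⇒> (λ n≤m → ℕP.<⇒≱ h (dbl-≤ n≤m))

dbl-≤⁻ : ∀ {m n} → dbl m ≤ dbl n → m ≤ n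
dbl-≤⁻ h = ℕP.≮⇒≥ (λ n<m → ℕP.<⇒≱ (ℕP.<-trans (ℕP.n<1+n _) (dbl-< n<m)) h)

2^suc* : ∀ k a → 2 ^ suc k * a ≡ dbl (2 ^ k * a)
2^suc* k a = trans (ℕP.*-assoc 2 (2 ^ k) a) (cong (λ x → 2 ^ k * a + x) (ℕP.+-identityʳ (2 ^ k * a)))

-- On the line, a positive letter a is the point a + 1 and a negative one the open interval (a , a + 1);
-- the grid is scaled by 2^k, where k is the number of variables already placed.
InCell : ℕ → Bool → ℕ → ℕ → Set
InCell k true  a x = x ≡ 2 ^ k * suc a
InCell k false a x = (2 ^ k * a < x) × (x < 2 ^ k * suc a)

data Cells (k : ℕ) : List Bool → List ℕ → List ℕ → Set where
  []  : Cells k [] [] []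
  _∷_ : ∀ {s a x ss w u} → InCell k s a x → Cells k ss w u → Cells k (s ∷ ss) (a ∷ w) (x ∷ u)

2^k*a< : ∀ k a → 2 ^ k * a < 2 ^ k * suc a
2^k*a< k a = ℕP.*-monoʳ-< (2 ^ k) {{ℕP.m^n≢0 2 k}} (ℕP.n<1+n a)

cell-lower : ∀ k s a {x} → InCell k s a x → 2 ^ k * a < x
cell-lower k true  a refl  = 2^k*a< k a
cell-lower k false a (l , _) = l

cell-upper : ∀ k s a {x} → InCell k s a x → x ≤ 2 ^ k * suc a
cell-upper k true  a refl  = ℕP.≤-refl
cell-upper k false a (_ , h) = ℕP.<⇒≤ h

-- Every new variable refines the grid by a factor 2: the points already placed become even, so that
-- the new one can coincide with one of them or fall strictly between two.
cell-dbl : ∀ k s a {x} → InCell k s a x → InCell (suc k) s a (dbl x)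
cell-dbl k true  a refl = sym (2^suc* k (suc a))
cell-dbl k false a {x} (l , h) = subst (_< dbl x) (sym (2^suc* k a)) (ℕP.<-trans (ℕP.n<1+n _) (dbl-< l))
                          , subst (dbl x <_) (sym (2^suc* k (suc a))) (ℕP.<-trans (ℕP.n<1+n _) (dbl-< h))

cells-dbl : ∀ {k ss w u} → Cells k ss w u → Cells (suc k) ss w (map dbl u)
cells-dbl []      = []
cells-dbl {k} (_∷_ {s} {a} c cs) = cell-dbl k s a c ∷ cells-dbl cs

-- The integral of g over a cell against the Euler characteristic, normalised so that points and open
-- intervals have mass 1: g is constant between consecutive points of the coarse grid, and on
-- an interval the grid points inside it count negatively.
∫ : ℕ → Bool → ℕ → (ℕ → ℚ) → ℚ
∫ k true  a g = g (dbl (2 ^ k * suc a))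
∫ k false a g = g (suc (dbl (2 ^ k * a))) +q
  ∑ (upTo (2 ^ k ∸ 1)) (λ t → g (suc (dbl (suc (2 ^ k * a + t)))) +q -q g (dbl (suc (2 ^ k * a + t))))

∫-cong : ∀ k s a {g h} → (∀ z → InCell (suc k) s a z → g z ≡ h z) → ∫ k s a g ≡ ∫ k s a h
∫-cong k true  a e = e _ (sym (2^suc* k (suc a)))
∫-cong k false a {g} {h} e = cong₂ _+q_
  (e _ (subst (_< suc (dbl c)) (sym (2^suc* k a)) (ℕP.n<1+n _) , subst (suc (dbl c) <_) (sym (2^suc* k (suc a))) (dbl-< (2^k*a< k a))))
  (∑-cong-All (AllP.all-upTo (2 ^ k ∸ 1)) step)
  where
  c = 2 ^ k * a
  -- The open cell contains exactly `2 ^ k ∸ 1` points of the coarse grid, from `c + 1` to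
  -- `c + 2 ^ k - 1`; `t` counts them from the left.
  inside : ∀ t → t < 2 ^ k ∸ 1 → InCell k false a (suc (c + t))
  inside t t< = s≤s (ℕP.m≤m+n c t) ,
    subst₂ _<_ (ℕP.+-suc c t) (trans (ℕP.+-comm c (2 ^ k)) (sym (ℕP.*-suc (2 ^ k) a)))
      (ℕP.+-monoʳ-< c (subst (suc t <_) (ℕP.m+[n∸m]≡n (ℕP.m^n>0 2 k)) (s≤s t<)))
  odd : ∀ x → InCell k false a x → InCell (suc k) false a (suc (dbl x))
  odd x (l , u) = subst (_< suc (dbl x)) (sym (2^suc* k a)) (ℕP.m≤n⇒m≤1+n (ℕP.<-trans (ℕP.n<1+n _) (dbl-< l)))
                , subst (suc (dbl x) <_) (sym (2^suc* k (suc a))) (dbl-< u)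
  step : ∀ t → t < 2 ^ k ∸ 1 → g (suc (dbl (suc (c + t)))) +q -q g (dbl (suc (c + t))) ≡ h (suc (dbl (suc (c + t)))) +q -q h (dbl (suc (c + t)))
  step t t< = cong₂ (λ x y → x +q -q y) (e _ (odd _ (inside t t<))) (e _ (cell-dbl k false a (inside t t<)))

∫-+ : ∀ k s a g h → ∫ k s a (λ z → g z +q h z) ≡ ∫ k s a g +q ∫ k s a h
∫-+ k true  a g h = refl
∫-+ k false a g h = trans
  (cong (g (suc (dbl c)) +q h (suc (dbl c)) +q_)
    (trans (∑-cong (upTo (2 ^ k ∸ 1)) split) (∑-+ (upTo (2 ^ k ∸ 1)) (jump g) (jump h))))
  (+-interchange (g (suc (dbl c))) (h (suc (dbl c))) (∑ (upTo (2 ^ k ∸ 1)) (jump g)) (∑ (upTo (2 ^ k ∸ 1)) (jump h)))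
  where
  c = 2 ^ k * a
  jump : (ℕ → ℚ) → ℕ → ℚ
  jump f t = f (suc (dbl (suc (c + t)))) +q -q f (dbl (suc (c + t)))
  split : ∀ t → jump (λ z → g z +q h z) t ≡ jump g t +q jump h t
  split t = solve 4 (λ x y x' y' → (x :+ y) :+ :- (x' :+ y') := (x :+ :- x') :+ (y :+ :- y')) refl
    (g (suc (dbl (suc (c + t))))) (h (suc (dbl (suc (c + t))))) (g (dbl (suc (c + t)))) (h (dbl (suc (c + t))))

∫-* : ∀ k s a c g → ∫ k s a (λ z → c *q g z) ≡ c *q ∫ k s a g
∫-* k true  a c g = refl
∫-* k false a c g = trans
  (cong (c *q g (suc (dbl b)) +q_)
    (trans (∑-cong (upTo (2 ^ k ∸ 1)) factor) (∑-*ˡ (upTo (2 ^ k ∸ 1)) c jump)))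
  (sym (ℚP.*-distribˡ-+ c (g (suc (dbl b))) (∑ (upTo (2 ^ k ∸ 1)) jump)))
  where
  b = 2 ^ k * a
  jump : ℕ → ℚ
  jump t = g (suc (dbl (suc (b + t)))) +q -q g (dbl (suc (b + t)))
  factor : ∀ t → c *q g (suc (dbl (suc (b + t)))) +q -q (c *q g (dbl (suc (b + t)))) ≡ c *q jump t
  factor t = solve 3 (λ x y z → x :* y :+ :- (x :* z) := x :* (y :+ :- z)) refl
    c (g (suc (dbl (suc (b + t))))) (g (dbl (suc (b + t))))

∫-1 : ∀ k s a → ∫ k s a (λ _ → 1ℚ) ≡ 1ℚ
∫-1 k true  a = refl
∫-1 k false a = cong (1ℚ +q_) (∑-0 (upTo (2 ^ k ∸ 1)))

∫-- : ∀ k s a g h → ∫ k s a (λ z → g z +q -q h z) ≡ ∫ k s a g +q -q ∫ k s a h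
∫-- k s a g h = trans (∫-cong k s a (λ z _ → cong (g z +q_) (neg≡-1* (h z)))) (trans (∫-+ k s a g (λ z → -1ℚ *q h z))
  (cong (∫ k s a g +q_) (trans (∫-* k s a -1ℚ h) (sym (neg≡-1* (∫ k s a h))))))

∫-0 : ∀ k s a → ∫ k s a (λ _ → 0ℚ) ≡ 0ℚ
∫-0 k true  a = refl
∫-0 k false a = cong (0ℚ +q_) (∑-0 (upTo (2 ^ k ∸ 1)))

∫-∑ : ∀ k s a (L : List A) (g : A → ℕ → ℚ) → ∫ k s a (λ z → ∑ L (λ i → g i z)) ≡ ∑ L (λ i → ∫ k s a (g i))
∫-∑ k s a []      g = ∫-0 k s a
∫-∑ k s a (i ∷ L) g = trans (∫-+ k s a (g i) (λ z → ∑ L (λ i → g i z))) (cong (∫ k s a (g i) +q_) (∫-∑ k s a L g))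

-- Words are reversed, so the last position is the innermost variable.
euler : Series → List Bool → List ℕ → ℚ
euler f (s ∷ ss) (a ∷ w) = euler (λ u → ∫ (length w) s a (λ z → f (z ∷ map dbl u))) ss w
euler f _        _       = f []

euler-cong : ∀ ss w {f g} → length ss ≡ length w → (∀ u → Cells (length w) ss w u → f u ≡ g u) → euler f ss w ≡ euler g ss w
euler-cong []       []      _ e = e [] []
euler-cong (s ∷ ss) (a ∷ w) l e = euler-cong ss w (ℕP.suc-injective l)
  (λ u cs → ∫-cong (length w) s a (λ z c → e (z ∷ map dbl u) (c ∷ cells-dbl cs)))

euler-* : ∀ ss w c f → length ss ≡ length w → euler (λ u → c *q f u) ss w ≡ c *q euler f ss w
euler-* []       []      c f _ = refl
euler-* (s ∷ ss) (a ∷ w) c f l = trans (euler-cong ss w (ℕP.suc-injective l) (λ u _ → ∫-* (length w) s a c (λ z → f (z ∷ map dbl u))))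
  (euler-* ss w c _ (ℕP.suc-injective l))

euler-∑ : ∀ ss w (L : List A) (f : A → Series) → length ss ≡ length w → euler (λ u → ∑ L (λ i → f i u)) ss w ≡ ∑ L (λ i → euler (f i) ss w)
euler-∑ []       []      L f _ = refl
euler-∑ (s ∷ ss) (a ∷ w) L f l = trans (euler-cong ss w (ℕP.suc-injective l) (λ u _ → ∫-∑ (length w) s a L (λ i z → f i (z ∷ map dbl u))))
  (euler-∑ ss w L (λ i u → ∫ (length w) s a (λ z → f i (z ∷ map dbl u))) (ℕP.suc-injective l))

-- Order relations

rel : Bool → ℕ → ℕ → Bool
rel r x y = if r then x <ᵇ y else x ≤ᵇ y

Rel : Bool → ℕ → ℕ → Set
Rel true  x y = x < y
Rel false x y = x ≤ y

rel-true : ∀ r x y → rel r x y ≡ true → Rel r x y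
rel-true true  x y = <ᵇ-true x y
rel-true false x y = ≤ᵇ-true x y

rel-intro : ∀ r x y → Rel r x y → rel r x y ≡ true
rel-intro true  x y = <ᵇ-yes x y
rel-intro false x y = ≤ᵇ-yes x y

<ᵇ-not : ∀ x y → (x <ᵇ y) ≡ not (y ≤ᵇ x)
<ᵇ-not x y with x ℕP.<? y
... | yes x<y = trans (<ᵇ-yes x y x<y) (cong not (sym (≤ᵇ-no y x x<y)))
... | no  x≮y = trans (<ᵇ-no x y (ℕP.≮⇒≥ x≮y)) (cong not (sym (≤ᵇ-yes y x (ℕP.≮⇒≥ x≮y))))

not-not : ∀ b → not (not b) ≡ b
not-not true  = refl
not-not false = refl

rel-not : ∀ r x y → rel r x y ≡ not (rel (not r) y x)
rel-not true  x y = <ᵇ-not x y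
rel-not false x y = trans (sym (not-not (x ≤ᵇ y))) (cong not (sym (<ᵇ-not y x)))

ind-not : ∀ b → ind (not b) ≡ 1ℚ +q -q ind b
ind-not true  = refl
ind-not false = refl

rel-dbl : ∀ r x y → rel r (dbl x) (dbl y) ≡ rel r x y
rel-dbl true  x y = ≡⇔ (λ e → <ᵇ-yes x y (dbl-<⁻ (<ᵇ-true (dbl x) (dbl y) e)))
  (λ e → <ᵇ-yes (dbl x) (dbl y) (ℕP.<-trans (ℕP.n<1+n _) (dbl-< (<ᵇ-true x y e))))
rel-dbl false x y = ≡⇔ (λ e → ≤ᵇ-yes x y (dbl-≤⁻ (≤ᵇ-true (dbl x) (dbl y) e)))
  (λ e → ≤ᵇ-yes (dbl x) (dbl y) (dbl-≤ (≤ᵇ-true x y e)))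

rel-dbl-suc : ∀ r x y → rel r (dbl x) (suc (dbl y)) ≡ (x ≤ᵇ y)
rel-dbl-suc true  x y = ≡⇔ (λ e → ≤ᵇ-yes x y (dbl-≤⁻ (ℕP.≤-pred (<ᵇ-true (dbl x) (suc (dbl y)) e))))
  (λ e → <ᵇ-yes (dbl x) (suc (dbl y)) (s≤s (dbl-≤ (≤ᵇ-true x y e))))
rel-dbl-suc false x y = ≡⇔ (λ e → ≤ᵇ-yes x y (ℕP.≮⇒≥ (λ y<x → ℕP.<⇒≱ (dbl-< y<x) (≤ᵇ-true (dbl x) (suc (dbl y)) e))))
  (λ e → ≤ᵇ-yes (dbl x) (suc (dbl y)) (ℕP.m≤n⇒m≤1+n (dbl-≤ (≤ᵇ-true x y e))))

<ᵇ-suc : ∀ x y → (x <ᵇ suc y) ≡ (x ≤ᵇ y)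
<ᵇ-suc x y = ≡⇔ (λ e → ≤ᵇ-yes x y (ℕP.≤-pred (<ᵇ-true x (suc y) e))) (λ e → <ᵇ-yes x (suc y) (s≤s (≤ᵇ-true x y e)))

∑-telescope : ∀ m (h : ℕ → ℚ) → ∑ (upTo m) (λ t → h (suc t) +q -q h t) ≡ h m +q -q h 0
∑-telescope zero    h = sym (ℚP.+-inverseʳ (h 0))
∑-telescope (suc m) h = trans (cong (λ l → ∑ l (λ t → h (suc t) +q -q h t)) (sym (upTo-∷ʳ m)))
  (trans (∑-++ (upTo m) [ m ] (λ t → h (suc t) +q -q h t)) (trans (cong (_+q (h (suc m) +q -q h m +q 0ℚ)) (∑-telescope m h))
    (solve 3 (λ a b c → (b :+ :- c) :+ ((a :+ :- b) :+ con 0ℚ) := a :+ :- c) refl (h (suc m)) (h m) (h 0))))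

threshold : Bool → Bool → ℕ → ℕ → ℕ → Bool
threshold true  r     x c e = rel r x e
threshold false true  x c e = x <ᵇ e
threshold false false x c e = x ≤ᵇ c

-- On an interval, a weak inequality has the same value at an interior grid point and on the piece
-- to its right, so these cancel and the leftmost piece remains. A strict one has at a grid point
-- the value of the piece to its left, so the sum telescopes to the rightmost piece. Hence the
-- comparison is with the left end `c` in the weak case and with the right end in the strict case.
∫-rel : ∀ k s a r x → ∫ k s a (λ z → ind (rel r (dbl x) z)) ≡ ind (threshold s r x (2 ^ k * a) (2 ^ k * suc a))
∫-rel k true  a r x = cong ind (rel-dbl r x (2 ^ k * suc a))
∫-rel k false a false x = trans (cong₂ _+q_ (cong ind (rel-dbl-suc false x c))
  (∑-zero (upTo (2 ^ k ∸ 1)) (λ t → trans (cong₂ (λ p q → ind p +q -q ind q) (rel-dbl-suc false x (suc (c + t))) (rel-dbl false x (suc (c + t))))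
     (ℚP.+-inverseʳ (ind (x ≤ᵇ suc (c + t))))))) (ℚP.+-identityʳ _)
  where c = 2 ^ k * a
∫-rel k false a true x = begin
  ind (rel true (dbl x) (suc (dbl c))) +q ∑ (upTo (2 ^ k ∸ 1)) (λ t → ind (rel true (dbl x) (suc (dbl (suc (c + t))))) +q -q ind (rel true (dbl x) (dbl (suc (c + t)))))
    ≡⟨ cong₂ _+q_ (cong ind (rel-dbl-suc true x c)) (∑-cong (upTo (2 ^ k ∸ 1)) (λ t → cong₂ (λ p q → ind p +q -q ind q)
         (trans (rel-dbl-suc true x (suc (c + t))) (cong (x ≤ᵇ_) (sym (ℕP.+-suc c t))))
         (trans (rel-dbl true x (suc (c + t))) (<ᵇ-suc x (c + t))))) ⟩
  ind (x ≤ᵇ c) +q ∑ (upTo (2 ^ k ∸ 1)) (λ t → ind (x ≤ᵇ c + suc t) +q -q ind (x ≤ᵇ c + t))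
    ≡⟨ cong (ind (x ≤ᵇ c) +q_) (∑-telescope (2 ^ k ∸ 1) (λ t → ind (x ≤ᵇ c + t))) ⟩
  ind (x ≤ᵇ c) +q (ind (x ≤ᵇ c + (2 ^ k ∸ 1)) +q -q ind (x ≤ᵇ c + 0))
    ≡⟨ cong (λ d → ind (x ≤ᵇ c) +q (ind (x ≤ᵇ c + (2 ^ k ∸ 1)) +q -q ind (x ≤ᵇ d))) (ℕP.+-identityʳ c) ⟩
  ind (x ≤ᵇ c) +q (ind (x ≤ᵇ c + (2 ^ k ∸ 1)) +q -q ind (x ≤ᵇ c))
    ≡⟨ solve 2 (λ p q → p :+ (q :+ :- p) := q) refl (ind (x ≤ᵇ c)) (ind (x ≤ᵇ c + (2 ^ k ∸ 1))) ⟩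
  ind (x ≤ᵇ c + (2 ^ k ∸ 1))
    ≡⟨ cong ind (sym (<ᵇ-suc x (c + (2 ^ k ∸ 1)))) ⟩
  ind (x <ᵇ suc (c + (2 ^ k ∸ 1)))
    ≡⟨ cong (λ d → ind (x <ᵇ d)) (trans (sym (ℕP.+-suc c (2 ^ k ∸ 1))) (trans (cong (λ d → c + d) (ℕP.m+[n∸m]≡n (ℕP.m^n>0 2 k)))
         (trans (ℕP.+-comm c (2 ^ k)) (sym (ℕP.*-suc (2 ^ k) a))))) ⟩
  ind (x <ᵇ 2 ^ k * suc a) ∎
  where c = 2 ^ k * a

-- Signed letters

key : Bool → ℕ → ℕ
key s a = 2 * a + (if s then 1 else 0)

bit≤1 : ∀ s → (if s then 1 else 0) ≤ 1
bit≤1 true  = ℕP.≤-refl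
bit≤1 false = z≤n

key-< : ∀ s s' {a a'} → a < a' → key s a < key s' a'
key-< s s' {a} {a'} a<a' = ℕP.≤-trans (s≤s (ℕP.+-monoʳ-≤ (2 * a) (bit≤1 s)))
  (ℕP.≤-trans (ℕP.≤-reflexive (trans (cong suc (ℕP.+-comm (2 * a) 1)) (sym (ℕP.*-suc 2 a))))
    (ℕP.≤-trans (ℕP.*-monoʳ-≤ 2 a<a') (ℕP.m≤m+n (2 * a') _)))

key-injective : ∀ s s' {a a'} → key s a ≡ key s' a' → (s ≡ s') × (a ≡ a')
key-injective s s' {a} {a'} e with ℕP.<-cmp a a'
... | tri< a<a' _ _ = ⊥-elim (ℕP.<⇒≢ (key-< s s' a<a') e)
... | tri> _ _ a'<a = ⊥-elim (ℕP.<⇒≢ (key-< s' s a'<a) (sym e))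
... | tri≈ _ refl _ = bits s s' (ℕP.+-cancelˡ-≡ (2 * a) _ _ e) , refl
  where
  bits : ∀ s s' → (if s then 1 else 0) ≡ (if s' then 1 else 0) → s ≡ s'
  bits true  true  _ = refl
  bits false false _ = refl

-- repeats s r: whether equal letters of sign s may be consecutive across a strict (r) or weak (not r) step.
repeats : Bool → Bool → Bool
repeats true  r = not r
repeats false r = r

-- The condition that K puts on two consecutive signed letters, a strict step standing for a descent
-- of γ. Unlike an inequality, it admits repeated negative letters exactly at strict steps.
precedes : Bool → ℕ → Bool → Bool → ℕ → Bool
precedes s a r s' a' = (key s a <ᵇ key s' a') ∨ ((key s a ≡ᵇ key s' a') ∧ repeats s r)

data PrecedesView (s : Bool) (a : ℕ) (r : Bool) (s' : Bool) (a' : ℕ) : Set where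
  less    : key s a < key s' a' → precedes s a r s' a' ≡ true → PrecedesView s a r s' a'
  greater : key s' a' < key s a → precedes s a r s' a' ≡ false → PrecedesView s a r s' a'
  equal   : s ≡ s' → a ≡ a' → precedes s a r s' a' ≡ repeats s r → PrecedesView s a r s' a'

precedes-< : ∀ s a r s' a' → key s a < key s' a' → precedes s a r s' a' ≡ true
precedes-< s a r s' a' lt = cong (_∨ ((key s a ≡ᵇ key s' a') ∧ repeats s r)) (<ᵇ-yes (key s a) (key s' a') lt)

precedes-> : ∀ s a r s' a' → key s' a' < key s a → precedes s a r s' a' ≡ false
precedes-> s a r s' a' gt = cong₂ (λ p q → p ∨ (q ∧ repeats s r)) (<ᵇ-no (key s a) (key s' a') (ℕP.<⇒≤ gt))
  (≡ᵇ-no (key s a) (key s' a') (ℕP.<⇒≢ gt ∘ sym))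

precedes-≡ : ∀ s a r → precedes s a r s a ≡ repeats s r
precedes-≡ s a r = cong₂ (λ p q → p ∨ (q ∧ repeats s r)) (<ᵇ-no (key s a) (key s a) ℕP.≤-refl) (≡ᵇ-refl (key s a))

precedesView : ∀ s a r s' a' → PrecedesView s a r s' a'
precedesView s a r s' a' with ℕP.<-cmp (key s a) (key s' a')
... | tri< lt _ _ = less lt (precedes-< s a r s' a' lt)
... | tri> _ _ gt = greater gt (precedes-> s a r s' a' gt)
... | tri≈ _ eq _ with refl , refl ← key-injective s s' {a} {a'} eq = equal refl refl (precedes-≡ s a r)

repeats-not : ∀ s r → repeats s (not r) ≡ not (repeats s r)
repeats-not true  r = refl
repeats-not false r = refl

-- The analogue of `rel-not`: exchanging the two letters and the strictness gives the complement. It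
-- reduces integrals of inequalities whose left side is the moving variable to those treated in
-- `∫-before`.
precedes-not : ∀ s a r s' a' → precedes s' a' (not r) s a ≡ not (precedes s a r s' a')
precedes-not s a r s' a' with precedesView s a r s' a'
... | less lt e        = trans (precedes-> s' a' (not r) s a lt) (cong not (sym e))
... | greater gt e     = trans (precedes-< s' a' (not r) s a gt) (cong not (sym e))
... | equal refl refl e = trans (precedes-≡ s a (not r)) (trans (repeats-not s r) (cong not (sym e)))

-- Inclusion–exclusion for a middle element, as an identity that stays valid when the outer two are out of order.
merge-rel : ∀ p₁ p₂ p₃ → (p₁ ≡ true → p₂ ≡ true → p₃ ≡ true) → (p₁ ≡ false → p₂ ≡ false → p₃ ≡ false) →
  ind p₁ *q ind p₂ ≡ (ind p₁ +q -q (1ℚ +q -q ind p₂)) *q ind p₃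
merge-rel true  true  p₃ h _ with refl ← h refl refl = refl
merge-rel true  false true  _ _ = refl
merge-rel true  false false _ _ = refl
merge-rel false true  true  _ _ = refl
merge-rel false true  false _ _ = refl
merge-rel false false p₃ _ h with refl ← h refl refl = refl

repeats-∧-true : ∀ s r r' → repeats s r ≡ true → repeats s r' ≡ true → repeats s (r ∧ r') ≡ true
repeats-∧-true true  false r' _ _ = refl
repeats-∧-true false true  r' _ e = e

repeats-∧-false : ∀ s r r' → repeats s r ≡ false → repeats s r' ≡ false → repeats s (r ∧ r') ≡ false
repeats-∧-false true  true  r' _ e = e
repeats-∧-false false false r' _ _ = refl

-- The counterpart of `∫-between`, with the same factor in front. This agreement lets chains of
-- points and chains of signed letters obey one recursion. The strictness `r ∧ r'` is read off from
-- three equal signed letters: two strict steps must merge to a strict one and two weak steps to a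
-- weak one, while for a mixed pair the factor vanishes there.
precedes-merge : ∀ s₁ a₁ r s₂ a₂ r' s₃ a₃ →
  ind (precedes s₁ a₁ r s₂ a₂) *q ind (precedes s₂ a₂ r' s₃ a₃) ≡
  (ind (precedes s₁ a₁ r s₂ a₂) +q -q (1ℚ +q -q ind (precedes s₂ a₂ r' s₃ a₃))) *q ind (precedes s₁ a₁ (r ∧ r') s₃ a₃)
precedes-merge s₁ a₁ r s₂ a₂ r' s₃ a₃ = merge-rel (precedes s₁ a₁ r s₂ a₂) (precedes s₂ a₂ r' s₃ a₃) (precedes s₁ a₁ (r ∧ r') s₃ a₃) both neither
  where
  absurd : ∀ {X : Set} {b} → b ≡ true → b ≡ false → X
  absurd refl ()
  both : precedes s₁ a₁ r s₂ a₂ ≡ true → precedes s₂ a₂ r' s₃ a₃ ≡ true → precedes s₁ a₁ (r ∧ r') s₃ a₃ ≡ true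
  both h h' with precedesView s₁ a₁ r s₂ a₂ | precedesView s₂ a₂ r' s₃ a₃
  ... | greater _ e        | _                   = absurd h e
  ... | _                  | greater _ e'        = absurd h' e'
  ... | less lt _          | less lt' _          = precedes-< s₁ a₁ (r ∧ r') s₃ a₃ (ℕP.<-trans lt lt')
  ... | less lt _          | equal refl refl _   = precedes-< s₁ a₁ (r ∧ r') s₃ a₃ lt
  ... | equal refl refl _  | less lt' _          = precedes-< s₁ a₁ (r ∧ r') s₃ a₃ lt'
  ... | equal refl refl e  | equal refl refl e'  = trans (precedes-≡ s₁ a₁ (r ∧ r'))
    (repeats-∧-true s₁ r r' (trans (sym e) h) (trans (sym e') h'))
  neither : precedes s₁ a₁ r s₂ a₂ ≡ false → precedes s₂ a₂ r' s₃ a₃ ≡ false → precedes s₁ a₁ (r ∧ r') s₃ a₃ ≡ false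
  neither h h' with precedesView s₁ a₁ r s₂ a₂ | precedesView s₂ a₂ r' s₃ a₃
  ... | less _ e           | _                   = absurd e h
  ... | _                  | less _ e'           = absurd e' h'
  ... | greater gt _       | greater gt' _       = precedes-> s₁ a₁ (r ∧ r') s₃ a₃ (ℕP.<-trans gt' gt)
  ... | greater gt _       | equal refl refl _   = precedes-> s₁ a₁ (r ∧ r') s₃ a₃ gt
  ... | equal refl refl _  | greater gt' _       = precedes-> s₁ a₁ (r ∧ r') s₃ a₃ gt'
  ... | equal refl refl e  | equal refl refl e'  = trans (precedes-≡ s₁ a₁ (r ∧ r'))
    (repeats-∧-false s₁ r r' (trans (sym e) h) (trans (sym e') h'))

-- Distinct letters have disjoint cells, which decides the comparison. For one letter, the negative
-- cell lies just to the left of the point `suc a`, in accordance with `key false a < key true a`;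
-- and a point inside the interval of integration passes the strict test against the right end but
-- fails the weak test against the left end.
threshold-precedes : ∀ k s a s' a' r x → InCell k s' a' x →
  threshold s r x (2 ^ k * a) (2 ^ k * suc a) ≡ precedes s' a' r s a
threshold-precedes k s a s' a' r x cell with ℕP.<-cmp a' a
... | tri< a'<a _ _ = trans (below s r) (sym (precedes-< s' a' r s a (key-< s' s a'<a)))
  where
  x≤c : x ≤ 2 ^ k * a
  x≤c = ℕP.≤-trans (cell-upper k s' a' cell) (ℕP.*-monoʳ-≤ (2 ^ k) a'<a)
  x<e : x < 2 ^ k * suc a
  x<e = ℕP.≤-<-trans x≤c (2^k*a< k a)
  below : ∀ s r → threshold s r x (2 ^ k * a) (2 ^ k * suc a) ≡ true
  below true  true  = <ᵇ-yes x _ x<e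
  below true  false = ≤ᵇ-yes x _ (ℕP.<⇒≤ x<e)
  below false true  = <ᵇ-yes x _ x<e
  below false false = ≤ᵇ-yes x _ x≤c
... | tri> _ _ a<a' = trans (above s r) (sym (precedes-> s' a' r s a (key-< s s' a<a')))
  where
  e<x : 2 ^ k * suc a < x
  e<x = ℕP.≤-<-trans (ℕP.*-monoʳ-≤ (2 ^ k) a<a') (cell-lower k s' a' cell)
  above : ∀ s r → threshold s r x (2 ^ k * a) (2 ^ k * suc a) ≡ false
  above true  true  = <ᵇ-no x _ (ℕP.<⇒≤ e<x)
  above true  false = ≤ᵇ-no x _ e<x
  above false true  = <ᵇ-no x _ (ℕP.<⇒≤ e<x)
  above false false = ≤ᵇ-no x _ (ℕP.<-trans (2^k*a< k a) e<x)
... | tri≈ _ refl _ = same s s' r cell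
  where
  c<e : 2 ^ k * a < 2 ^ k * suc a
  c<e = 2^k*a< k a
  key-false<true : key false a < key true a
  key-false<true = ℕP.+-monoʳ-< (2 * a) (s≤s z≤n)
  same : ∀ s s' r → InCell k s' a x → threshold s r x (2 ^ k * a) (2 ^ k * suc a) ≡ precedes s' a r s a
  same true  true  true  refl = trans (<ᵇ-no x x ℕP.≤-refl) (sym (precedes-≡ true a true))
  same true  true  false refl = trans (≤ᵇ-yes x x ℕP.≤-refl) (sym (precedes-≡ true a false))
  same false true  true  refl = trans (<ᵇ-no x x ℕP.≤-refl) (sym (precedes-> true a true false a key-false<true))
  same false true  false refl = trans (≤ᵇ-no x _ c<e) (sym (precedes-> true a false false a key-false<true))
  same true  false true  (_ , u) = trans (<ᵇ-yes x _ u) (sym (precedes-< false a true true a key-false<true))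
  same true  false false (_ , u) = trans (≤ᵇ-yes x _ (ℕP.<⇒≤ u)) (sym (precedes-< false a false true a key-false<true))
  same false false true  (_ , u) = trans (<ᵇ-yes x _ u) (sym (precedes-≡ false a true))
  same false false false (l , _) = trans (≤ᵇ-no x _ l) (sym (precedes-≡ false a false))

∫-before : ∀ k s a s' a' r x → InCell k s' a' x → ∫ k s a (λ z → ind (rel r (dbl x) z)) ≡ ind (precedes s' a' r s a)
∫-before k s a s' a' r x cell = trans (∫-rel k s a r x) (cong ind (threshold-precedes k s a s' a' r x cell))

∫-after : ∀ k s a s' a' r x → InCell k s' a' x → ∫ k s a (λ z → ind (rel r z (dbl x))) ≡ ind (precedes s a r s' a')
∫-after k s a s' a' r x cell = begin
  ∫ k s a (λ z → ind (rel r z (dbl x)))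
    ≡⟨ ∫-cong k s a (λ z _ → trans (cong ind (rel-not r z (dbl x))) (ind-not (rel (not r) (dbl x) z))) ⟩
  ∫ k s a (λ z → 1ℚ +q -q ind (rel (not r) (dbl x) z))
    ≡⟨ ∫-- k s a (λ _ → 1ℚ) (λ z → ind (rel (not r) (dbl x) z)) ⟩
  ∫ k s a (λ _ → 1ℚ) +q -q ∫ k s a (λ z → ind (rel (not r) (dbl x) z))
    ≡⟨ cong₂ (λ p q → p +q -q q) (∫-1 k s a) (∫-before k s a s' a' (not r) x cell) ⟩
  1ℚ +q -q ind (precedes s' a' (not r) s a)
    ≡⟨ cong (λ b → 1ℚ +q -q ind b) (precedes-not s a r s' a') ⟩
  1ℚ +q -q ind (not (precedes s a r s' a'))
    ≡⟨ sym (ind-not (not (precedes s a r s' a'))) ⟩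
  ind (not (not (precedes s a r s' a')))
    ≡⟨ cong ind (not-not _) ⟩
  ind (precedes s a r s' a') ∎

-- The product of two conditions on `z` becomes a difference of indicators, each an inequality with
-- a single fixed end, so that `∫` can be applied to them one at a time; the remaining factor does
-- not involve `z`.
between : ∀ r r' x y z → ind (rel r (dbl x) z) *q ind (rel r' z (dbl y)) ≡
  (ind (rel r (dbl x) z) +q -q ind (rel (not r') (dbl y) z)) *q ind (rel (r ∧ r') x y)
between r r' x y z = trans
  (merge-rel (rel r (dbl x) z) (rel r' z (dbl y)) (rel (r ∧ r') x y)
    (λ p q → rel-intro (r ∧ r') x y (up r r' (rel-true r _ _ p) (rel-true r' _ _ q)))
    (λ p q → not-rel (r ∧ r') (λ t → down r r' t p q)))
  (cong (λ c → (ind (rel r (dbl x) z) +q -q c) *q ind (rel (r ∧ r') x y))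
    (trans (sym (ind-not (rel r' z (dbl y)))) (cong ind (trans (cong not (rel-not r' z (dbl y))) (not-not _)))))
  where
  up : ∀ r r' → Rel r (dbl x) z → Rel r' z (dbl y) → Rel (r ∧ r') x y
  up true  true  p q = dbl-<⁻ (ℕP.<-trans p q)
  up true  false p q = dbl-≤⁻ (ℕP.≤-trans (ℕP.<⇒≤ p) q)
  up false true  p q = dbl-≤⁻ (ℕP.≤-trans p (ℕP.<⇒≤ q))
  up false false p q = dbl-≤⁻ (ℕP.≤-trans p q)
  not-rel : ∀ ρ → (Rel ρ x y → ⊥) → rel ρ x y ≡ false
  not-rel ρ h with rel ρ x y in eq
  ... | false = refl
  ... | true  = ⊥-elim (h (rel-true ρ x y eq))
  falsify : ∀ {b} → b ≡ false → b ≡ true → ⊥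
  falsify refl ()
  from-false : ∀ ρ m n → rel ρ m n ≡ false → Rel (not ρ) n m
  from-false ρ m n e = rel-true (not ρ) n m (trans (sym (not-not _)) (cong not (trans (sym (rel-not ρ m n)) e)))
  down : ∀ r r' → Rel (r ∧ r') x y → rel r (dbl x) z ≡ false → rel r' z (dbl y) ≡ false → ⊥
  down r r' t p q = clash r r' t (from-false r _ _ p) (from-false r' _ _ q)
    where
    clash : ∀ r r' → Rel (r ∧ r') x y → Rel (not r) z (dbl x) → Rel (not r') (dbl y) z → ⊥
    clash true  true  t p q = ℕP.<⇒≱ t (dbl-≤⁻ (ℕP.≤-trans q p))
    clash true  false t p q = ℕP.<⇒≱ (dbl-<⁻ (ℕP.<-≤-trans q p)) t
    clash false true  t p q = ℕP.<⇒≱ (dbl-<⁻ (ℕP.≤-<-trans q p)) t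
    clash false false t p q = ℕP.<⇒≱ (dbl-<⁻ (ℕP.<-trans q p)) t

∫-between : ∀ k s a s₁ a₁ s₂ a₂ r r' x y → InCell k s₁ a₁ x → InCell k s₂ a₂ y →
  ∫ k s a (λ z → ind (rel r (dbl x) z) *q ind (rel r' z (dbl y))) ≡
  (ind (precedes s₁ a₁ r s a) +q -q (1ℚ +q -q ind (precedes s a r' s₂ a₂))) *q ind (rel (r ∧ r') x y)
∫-between k s a s₁ a₁ s₂ a₂ r r' x y cx cy = begin
  ∫ k s a (λ z → ind (rel r (dbl x) z) *q ind (rel r' z (dbl y)))
    ≡⟨ ∫-cong k s a (λ z _ → trans (between r r' x y z) (ℚP.*-comm _ i)) ⟩
  ∫ k s a (λ z → i *q (ind (rel r (dbl x) z) +q -q ind (rel (not r') (dbl y) z)))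
    ≡⟨ ∫-* k s a i _ ⟩
  i *q ∫ k s a (λ z → ind (rel r (dbl x) z) +q -q ind (rel (not r') (dbl y) z))
    ≡⟨ cong (i *q_) (∫-- k s a _ _) ⟩
  i *q (∫ k s a (λ z → ind (rel r (dbl x) z)) +q -q ∫ k s a (λ z → ind (rel (not r') (dbl y) z)))
    ≡⟨ cong (i *q_) (cong₂ (λ p q → p +q -q q) (∫-before k s a s₁ a₁ r x cx)
         (trans (∫-before k s a s₂ a₂ (not r') y cy) (trans (cong ind (precedes-not s a r' s₂ a₂)) (ind-not _)))) ⟩
  i *q (ind (precedes s₁ a₁ r s a) +q -q (1ℚ +q -q ind (precedes s a r' s₂ a₂)))
    ≡⟨ ℚP.*-comm i _ ⟩
  (ind (precedes s₁ a₁ r s a) +q -q (1ℚ +q -q ind (precedes s a r' s₂ a₂))) *q i ∎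
  where i = ind (rel (r ∧ r') x y)

∫-equal : ∀ k s a s' a' x → InCell k s' a' x →
  ∫ k s a (λ z → ind (dbl x ≡ᵇ z)) ≡ ind (precedes s' a' false s a) +q -q ind (precedes s' a' true s a)
∫-equal k s a s' a' x cell = begin
  ∫ k s a (λ z → ind (dbl x ≡ᵇ z))
    ≡⟨ ∫-cong k s a (λ z _ → split (dbl x) z) ⟩
  ∫ k s a (λ z → ind (rel false (dbl x) z) +q -q ind (rel true (dbl x) z))
    ≡⟨ ∫-- k s a _ _ ⟩
  ∫ k s a (λ z → ind (rel false (dbl x) z)) +q -q ∫ k s a (λ z → ind (rel true (dbl x) z))
    ≡⟨ cong₂ (λ p q → p +q -q q) (∫-before k s a s' a' false x cell) (∫-before k s a s' a' true x cell) ⟩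
  ind (precedes s' a' false s a) +q -q ind (precedes s' a' true s a) ∎
  where
  split : ∀ x z → ind (x ≡ᵇ z) ≡ ind (x ≤ᵇ z) +q -q ind (x <ᵇ z)
  split x z with ℕP.<-cmp x z
  ... | tri< lt ne _ rewrite ≡ᵇ-no x z ne | ≤ᵇ-yes x z (ℕP.<⇒≤ lt) | <ᵇ-yes x z lt = refl
  ... | tri> _ ne gt rewrite ≡ᵇ-no x z ne | ≤ᵇ-no x z gt | <ᵇ-no x z (ℕP.<⇒≤ gt) = refl
  ... | tri≈ _ refl _ rewrite ≡ᵇ-refl x | ≤ᵇ-yes x x ℕP.≤-refl | <ᵇ-no x x ℕP.≤-refl = refl

-- lk d u j is the entry at position j ≥ 1 of the word whose reversal is u.
lk : A → List A → ℕ → A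
lk d []      j = d
lk d (z ∷ u) j = if j ≡ᵇ suc (length u) then z else lk d u j

InRange : ℕ → ℕ → Set
InRange n j = (1 ≤ j) × (j ≤ n)

lk-top : ∀ (d : A) z u {n} → length u ≡ n → lk d (z ∷ u) (suc n) ≡ z
lk-top d z u refl = cong (λ b → if b then z else lk d u (suc (length u))) (≡ᵇ-refl (suc (length u)))

lk-below : ∀ (d : A) z u {n j} → length u ≡ n → j ≤ n → lk d (z ∷ u) j ≡ lk d u j
lk-below d z u {j = j} refl j≤n = cong (λ b → if b then z else lk d u j) (≡ᵇ-no j (suc (length u)) (ℕP.<⇒≢ (s≤s j≤n)))

lk-dbl : ∀ u j → lk 0 (map dbl u) j ≡ dbl (lk 0 u j)
lk-dbl []      j = refl
lk-dbl (z ∷ u) j rewrite length-map dbl u with j ≡ᵇ suc (length u)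
... | true  = refl
... | false = lk-dbl u j

cells-length : ∀ {k ss w u} → Cells k ss w u → length u ≡ length w
cells-length []       = refl
cells-length (_ ∷ cs) = cong suc (cells-length cs)

inCell-resp : ∀ {k s s' a a' x x'} → s ≡ s' → a ≡ a' → x ≡ x' → InCell k s a x → InCell k s' a' x'
inCell-resp refl refl refl c = c

cells-lk : ∀ {k ss w u j} → Cells k ss w u → length ss ≡ length w → InRange (length w) j →
  InCell k (lk false ss j) (lk 0 w j) (lk 0 u j)
cells-lk {j = zero}  [] _ (() , _)
cells-lk {j = suc j} [] _ (_ , ())
cells-lk {k} {s ∷ ss} {a ∷ w} {x ∷ u} {j} (c ∷ cs) l (1≤j , j≤) with ℕP.m≤n⇒m<n∨m≡n j≤
... | inj₂ refl = inCell-resp {k} (sym (lk-top false s ss (ℕP.suc-injective l))) (sym (lk-top 0 a w refl)) (sym (lk-top 0 x u (cells-length cs))) c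
... | inj₁ j< = inCell-resp {k} (sym (lk-below false s ss (ℕP.suc-injective l) (ℕP.≤-pred j<))) (sym (lk-below 0 a w refl (ℕP.≤-pred j<)))
    (sym (lk-below 0 x u (cells-length cs) (ℕP.≤-pred j<))) (cells-lk cs (ℕP.suc-injective l) (1≤j , ℕP.≤-pred j<))

-- Chains of order relations and the elimination of their last position

Links : Set
Links = List (Bool × ℕ)

chain : (ℕ → ℕ) → ℕ → Links → ℚ
chain f j []            = 1ℚ
chain f j ((r , k) ∷ c) = ind (rel r (f j) (f k)) *q chain f k c

signedChain : (ℕ → Bool) → (ℕ → ℕ) → ℕ → Links → ℚ
signedChain S X j []            = 1ℚ
signedChain S X j ((r , k) ∷ c) = ind (precedes (S j) (X j) r (S k) (X k)) *q signedChain S X k c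

chain-dbl : ∀ {f g} j c → f j ≡ dbl (g j) → All (λ l → f (proj₂ l) ≡ dbl (g (proj₂ l))) c → chain f j c ≡ chain g j c
chain-dbl j []            e []       = refl
chain-dbl {f} {g} j ((r , k) ∷ c) e (e' ∷ es) = cong₂ _*q_
  (cong ind (trans (cong₂ (rel r) e e') (rel-dbl r (g j) (g k)))) (chain-dbl k c e' es)

signedChain-cong : ∀ {S S' X X'} j c → (S j ≡ S' j) × (X j ≡ X' j) →
  All (λ l → (S (proj₂ l) ≡ S' (proj₂ l)) × (X (proj₂ l) ≡ X' (proj₂ l))) c → signedChain S X j c ≡ signedChain S' X' j c
signedChain-cong j []            e []       = refl
signedChain-cong {S} {S'} {X} {X'} j ((r , k) ∷ c) (eS , eX) ((eS' , eX') ∷ es) = cong₂ _*q_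
  (cong₂ (λ f g → ind (f g)) (cong₂ (λ s x → λ g → precedes s x r (proj₁ g) (proj₂ g)) eS eX) (cong₂ _,_ eS' eX'))
  (signedChain-cong k c (eS' , eX') es)

Positioned : ℕ → Links → Set
Positioned n = All (λ l → InRange n (proj₂ l))

module Eliminate (n : ℕ) (s : Bool) (a : ℕ) (ss : List Bool) (w : List ℕ)
                 (ls : length ss ≡ n) (lw : length w ≡ n) where

  S = lk false ss
  X = lk 0 w
  S⁺ = lk false (s ∷ ss)
  X⁺ = lk 0 (a ∷ w)

  -- The placement of all `suc n` positions: the integration variable `z` at the new one, the
  -- earlier points moved to the refined grid.
  F : List ℕ → ℕ → ℕ → ℕ
  F u z = lk 0 (z ∷ map dbl u)

  len : ∀ {u} → Cells n ss w u → length (map dbl u) ≡ n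
  len {u} cs = trans (length-map dbl u) (trans (cells-length cs) lw)

  F-below : ∀ {u} z {j} → Cells n ss w u → InRange n j → F u z j ≡ dbl (lk 0 u j)
  F-below {u} z {j} cs (_ , j≤n) = trans (lk-below 0 z (map dbl u) (len cs) j≤n) (lk-dbl u j)

  F-top : ∀ {u} z → Cells n ss w u → F u z (suc n) ≡ z
  F-top {u} z cs = lk-top 0 z (map dbl u) (len cs)

  SX-below : ∀ {j} → InRange n j → (S⁺ j ≡ S j) × (X⁺ j ≡ X j)
  SX-below (_ , j≤n) = lk-below false s ss ls j≤n , lk-below 0 a w lw j≤n

  cell : ∀ {u j} → Cells n ss w u → InRange n j → InCell n (S j) (X j) (lk 0 u j)
  cell cs (1≤j , j≤n) = cells-lk cs (trans ls (sym lw)) (1≤j , subst (_ ≤_) (sym lw) j≤n)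

  chain-below : ∀ {u} z {j c} → Cells n ss w u → InRange n j → Positioned n c → chain (F u z) j c ≡ chain (lk 0 u) j c
  chain-below {u} z {j} {c} cs rj rc = chain-dbl {F u z} {lk 0 u} j c (F-below z cs rj) (mapAll rc)
    where
    mapAll : ∀ {c} → Positioned n c → All (λ l → F u z (proj₂ l) ≡ dbl (lk 0 u (proj₂ l))) c
    mapAll []       = []
    mapAll (p ∷ ps) = F-below z cs p ∷ mapAll ps

  signed-below : ∀ {j c} → InRange n j → Positioned n c → signedChain S⁺ X⁺ j c ≡ signedChain S X j c
  signed-below {j} {c} rj rc = signedChain-cong j c (SX-below rj) (mapAll rc)
    where
    mapAll : ∀ {c} → Positioned n c → All (λ l → (S⁺ (proj₂ l) ≡ S (proj₂ l)) × (X⁺ (proj₂ l) ≡ X (proj₂ l))) c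
    mapAll []       = []
    mapAll (p ∷ ps) = SX-below p ∷ mapAll ps

  prec-below : ∀ {j k} r → InRange n j → InRange n k → precedes (S⁺ j) (X⁺ j) r (S⁺ k) (X⁺ k) ≡ precedes (S j) (X j) r (S k) (X k)
  prec-below r rj rk with SX-below rj | SX-below rk
  ... | eS , eX | eS' , eX' rewrite eS | eX | eS' | eX' = refl

  prec-to-top : ∀ {j} r → InRange n j → precedes (S⁺ j) (X⁺ j) r (S⁺ (suc n)) (X⁺ (suc n)) ≡ precedes (S j) (X j) r s a
  prec-to-top r rj with SX-below rj | lk-top false s ss ls | lk-top 0 a w lw
  ... | eS , eX | eS' | eX' rewrite eS | eX | eS' | eX' = refl

  prec-from-top : ∀ {j} r → InRange n j → precedes (S⁺ (suc n)) (X⁺ (suc n)) r (S⁺ j) (X⁺ j) ≡ precedes s a r (S j) (X j)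
  prec-from-top r rj with SX-below rj | lk-top false s ss ls | lk-top 0 a w lw
  ... | eS , eX | eS' | eX' rewrite eS | eX | eS' | eX' = refl

  -- One factor serves twice: for integrating position `suc n` out of the chain and for deleting it
  -- from the signed chain. The sign and letter of that position enter only there, and the factor is
  -- the same for all placements `u`.
  record Eliminated (j : ℕ) (c : Links) (j' : ℕ) (ps : List ℕ) : Set where
    field
      links  : Links
      factor : ℚ
      places : map proj₂ links ≡ ps
      integral : ∀ u → Cells n ss w u → ∫ n s a (λ z → chain (F u z) j c) ≡ factor *q chain (lk 0 u) j' links
      value  : signedChain S⁺ X⁺ j c ≡ factor *q signedChain S X j' links

  -- Position `suc n` can stand anywhere in the chain, whose order is that of σ. At the end, one
  -- inequality is integrated; in the middle, two are merged into one; links in front of it are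
  -- constant in `z` and are passed over.
  inner : ∀ {j} α r β → InRange n j → Positioned n α → Positioned n β →
    Eliminated j (α ++ (r , suc n) ∷ β) j (map proj₂ α ++ map proj₂ β)
  inner {j} [] r [] rj _ _ = record
    { links    = []
    ; factor   = κ
    ; places   = refl
    ; integral = λ u cs → trans (∫-cong n s a (λ z _ → trans (ℚP.*-identityʳ _) (cong₂ (λ x y → ind (rel r x y)) (F-below z cs rj) (F-top z cs))))
        (trans (∫-before n s a (S j) (X j) r (lk 0 u j) (cell cs rj)) (sym (ℚP.*-identityʳ κ)))
    ; value    = cong (λ b → ind b *q 1ℚ) (prec-to-top r rj)
    }
    where κ = ind (precedes (S j) (X j) r s a)
  inner {j} [] r ((r' , q) ∷ β) rj _ (rq ∷ rβ) = record
    { links    = (r ∧ r' , q) ∷ β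
    ; factor   = κ
    ; places   = refl
    ; integral = λ u cs → begin
        ∫ n s a (λ z → ind (rel r (F u z j) (F u z (suc n))) *q (ind (rel r' (F u z (suc n)) (F u z q)) *q chain (F u z) q β))
          ≡⟨ ∫-cong n s a (λ z _ → trans
               (cong₂ _*q_ (cong₂ (λ x y → ind (rel r x y)) (F-below z cs rj) (F-top z cs))
                 (cong₂ _*q_ (cong₂ (λ x y → ind (rel r' x y)) (F-top z cs) (F-below z cs rq)) (chain-below z cs rq rβ)))
               (solve 3 (λ x y t → x :* (y :* t) := t :* (x :* y)) refl
                 (ind (rel r (dbl (lk 0 u j)) z)) (ind (rel r' z (dbl (lk 0 u q)))) (chain (lk 0 u) q β))) ⟩
        ∫ n s a (λ z → chain (lk 0 u) q β *q (ind (rel r (dbl (lk 0 u j)) z) *q ind (rel r' z (dbl (lk 0 u q)))))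
          ≡⟨ ∫-* n s a (chain (lk 0 u) q β) _ ⟩
        chain (lk 0 u) q β *q ∫ n s a (λ z → ind (rel r (dbl (lk 0 u j)) z) *q ind (rel r' z (dbl (lk 0 u q))))
          ≡⟨ cong (chain (lk 0 u) q β *q_) (∫-between n s a (S j) (X j) (S q) (X q) r r' (lk 0 u j) (lk 0 u q) (cell cs rj) (cell cs rq)) ⟩
        chain (lk 0 u) q β *q (κ *q ind (rel (r ∧ r') (lk 0 u j) (lk 0 u q)))
          ≡⟨ solve 3 (λ x y t → t :* (x :* y) := x :* (y :* t)) refl κ (ind (rel (r ∧ r') (lk 0 u j) (lk 0 u q))) (chain (lk 0 u) q β) ⟩
        κ *q (ind (rel (r ∧ r') (lk 0 u j) (lk 0 u q)) *q chain (lk 0 u) q β) ∎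
    ; value    = begin
        ind (precedes (S⁺ j) (X⁺ j) r (S⁺ (suc n)) (X⁺ (suc n))) *q (ind (precedes (S⁺ (suc n)) (X⁺ (suc n)) r' (S⁺ q) (X⁺ q)) *q signedChain S⁺ X⁺ q β)
          ≡⟨ cong₂ _*q_ (cong ind (prec-to-top r rj)) (cong₂ _*q_ (cong ind (prec-from-top r' rq)) (signed-below rq rβ)) ⟩
        ind (precedes (S j) (X j) r s a) *q (ind (precedes s a r' (S q) (X q)) *q signedChain S X q β)
          ≡⟨ sym (ℚP.*-assoc (ind (precedes (S j) (X j) r s a)) (ind (precedes s a r' (S q) (X q))) (signedChain S X q β)) ⟩
        ind (precedes (S j) (X j) r s a) *q ind (precedes s a r' (S q) (X q)) *q signedChain S X q β
          ≡⟨ cong (_*q signedChain S X q β) (precedes-merge (S j) (X j) r s a r' (S q) (X q)) ⟩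
        κ *q ind (precedes (S j) (X j) (r ∧ r') (S q) (X q)) *q signedChain S X q β
          ≡⟨ ℚP.*-assoc κ (ind (precedes (S j) (X j) (r ∧ r') (S q) (X q))) (signedChain S X q β) ⟩
        κ *q (ind (precedes (S j) (X j) (r ∧ r') (S q) (X q)) *q signedChain S X q β) ∎
    }
    where κ = ind (precedes (S j) (X j) r s a) +q -q (1ℚ +q -q ind (precedes s a r' (S q) (X q)))
  inner {j} ((r' , k) ∷ α) r β rj (rk ∷ rα) rβ = record
    { links    = (r' , k) ∷ E.links
    ; factor   = E.factor
    ; places   = cong (k ∷_) E.places
    ; integral = λ u cs → begin
        ∫ n s a (λ z → ind (rel r' (F u z j) (F u z k)) *q chain (F u z) k c)
          ≡⟨ ∫-cong n s a (λ z _ → cong (_*q chain (F u z) k c) (cong ind (trans (cong₂ (rel r') (F-below z cs rj) (F-below z cs rk)) (rel-dbl r' (lk 0 u j) (lk 0 u k))))) ⟩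
        ∫ n s a (λ z → ind (rel r' (lk 0 u j) (lk 0 u k)) *q chain (F u z) k c)
          ≡⟨ ∫-* n s a (ind (rel r' (lk 0 u j) (lk 0 u k))) (λ z → chain (F u z) k c) ⟩
        ind (rel r' (lk 0 u j) (lk 0 u k)) *q ∫ n s a (λ z → chain (F u z) k c)
          ≡⟨ cong (ind (rel r' (lk 0 u j) (lk 0 u k)) *q_) (E.integral u cs) ⟩
        ind (rel r' (lk 0 u j) (lk 0 u k)) *q (E.factor *q chain (lk 0 u) k E.links)
          ≡⟨ *-left-comm (ind (rel r' (lk 0 u j) (lk 0 u k))) E.factor (chain (lk 0 u) k E.links) ⟩
        E.factor *q (ind (rel r' (lk 0 u j) (lk 0 u k)) *q chain (lk 0 u) k E.links) ∎
    ; value    = trans (cong₂ _*q_ (cong ind (prec-below r' rj rk)) E.value) (*-left-comm (ind (precedes (S j) (X j) r' (S k) (X k))) E.factor (signedChain S X k E.links))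
    }
    where
    c = α ++ (r , suc n) ∷ β
    module E = Eliminated (inner α r β rk rα rβ)
    *-left-comm : ∀ x y z → x *q (y *q z) ≡ y *q (x *q z)
    *-left-comm = solve 3 (λ x y z → x :* (y :* z) := y :* (x :* z)) refl

  first : ∀ r q β → InRange n q → Positioned n β → Eliminated (suc n) ((r , q) ∷ β) q (map proj₂ β)
  first r q β rq rβ = record
    { links    = β
    ; factor   = κ
    ; places   = refl
    ; integral = λ u cs → begin
        ∫ n s a (λ z → ind (rel r (F u z (suc n)) (F u z q)) *q chain (F u z) q β)
          ≡⟨ ∫-cong n s a (λ z _ → trans (cong₂ _*q_ (cong₂ (λ x y → ind (rel r x y)) (F-top z cs) (F-below z cs rq)) (chain-below z cs rq rβ))
               (ℚP.*-comm (ind (rel r z (dbl (lk 0 u q)))) (chain (lk 0 u) q β))) ⟩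
        ∫ n s a (λ z → chain (lk 0 u) q β *q ind (rel r z (dbl (lk 0 u q))))
          ≡⟨ ∫-* n s a (chain (lk 0 u) q β) (λ z → ind (rel r z (dbl (lk 0 u q)))) ⟩
        chain (lk 0 u) q β *q ∫ n s a (λ z → ind (rel r z (dbl (lk 0 u q))))
          ≡⟨ cong (chain (lk 0 u) q β *q_) (∫-after n s a (S q) (X q) r (lk 0 u q) (cell cs rq)) ⟩
        chain (lk 0 u) q β *q κ
          ≡⟨ ℚP.*-comm (chain (lk 0 u) q β) κ ⟩
        κ *q chain (lk 0 u) q β ∎
    ; value    = cong₂ _*q_ (cong ind (prec-from-top r rq)) (signed-below rq rβ)
    }
    where κ = ind (precedes s a r (S q) (X q))

split-link : ∀ {m} (c : Links) → m ∈ map proj₂ c → Σ Links λ α → Σ Bool λ r → Σ Links λ β → c ≡ α ++ (r , m) ∷ β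
split-link ((r , k) ∷ c) (here refl) = [] , r , c , refl
split-link ((r , k) ∷ c) (there h) with split-link c h
... | α , r' , β , refl = (r , k) ∷ α , r' , β , refl

positioned : ∀ {n} c → (∀ {j} → j ∈ map proj₂ c → InRange n j) → Positioned n c
positioned []      h = []
positioned (l ∷ c) h = h (here refl) ∷ positioned c (λ i → h (there i))

range1-comm : ∀ n → range1 (suc n) ↭ suc n ∷ range1 n
range1-comm n = subst (_↭ suc n ∷ range1 n) (sym (range1-∷ʳ n))
  (↭-trans (shift (suc n) (range1 n) []) (subst (λ l → suc n ∷ l ↭ suc n ∷ range1 n) (sym (++-identityʳ (range1 n))) ↭-refl))

-- Induction on the number of positions: removing the last position, wherever it stands, leaves a
-- chain through `1` to `n`, to which the same claim applies. The condition that the chain visits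
-- every position exactly once is what keeps this going.
euler-chain : ∀ ss w j c → length ss ≡ length w → j ∷ map proj₂ c ↭ range1 (length w) →
  euler (λ u → chain (lk 0 u) j c) ss w ≡ signedChain (lk false ss) (lk 0 w) j c
euler-chain []       []      j c l perm with () ← ↭-length perm
euler-chain (s ∷ ss) (a ∷ w) j c l perm = go c perm′
  where
  n = length w
  ls = ℕP.suc-injective l
  open Eliminate n s a ss w ls refl
  perm′ : j ∷ map proj₂ c ↭ suc n ∷ range1 n
  perm′ = ↭-trans perm (range1-comm n)
  finish : ∀ {j c j' ps} → j' ∷ ps ↭ range1 n → Eliminated j c j' ps →
    euler (λ u → chain (lk 0 u) j c) (s ∷ ss) (a ∷ w) ≡ signedChain S⁺ X⁺ j c
  finish {j} {c} {j'} p E = begin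
    euler (λ u → ∫ n s a (λ z → chain (F u z) j c)) ss w       ≡⟨ euler-cong ss w ls integral ⟩
    euler (λ u → factor *q chain (lk 0 u) j' links) ss w       ≡⟨ euler-* ss w factor (λ u → chain (lk 0 u) j' links) ls ⟩
    factor *q euler (λ u → chain (lk 0 u) j' links) ss w       ≡⟨ cong (factor *q_) (euler-chain ss w j' links ls (subst (λ l → j' ∷ l ↭ range1 n) (sym places) p)) ⟩
    factor *q signedChain S X j' links                         ≡⟨ sym value ⟩
    signedChain S⁺ X⁺ j c ∎
    where open Eliminated E
  inR : ∀ {l} → l ↭ range1 n → ∀ {j} → j ∈ l → InRange n j
  inR p h = range1-∈ (∈-resp-↭ p h)
  constant : ∀ ss w → length ss ≡ length w → euler (λ _ → 1ℚ) ss w ≡ 1ℚ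
  constant []       []      _ = refl
  constant (s ∷ ss) (a ∷ w) l = trans (euler-cong ss w (ℕP.suc-injective l) (λ u _ → ∫-1 (length w) s a)) (constant ss w (ℕP.suc-injective l))
  go : ∀ c → j ∷ map proj₂ c ↭ suc n ∷ range1 n → euler (λ u → chain (lk 0 u) j c) (s ∷ ss) (a ∷ w) ≡ signedChain S⁺ X⁺ j c
  go c p with j ℕP.≟ suc n
  go [] p | yes refl = constant (s ∷ ss) (a ∷ w) l
  go ((r , q) ∷ β) p | yes refl = finish p′ (first r q β (inR p′ (here refl)) (positioned β (λ i → inR p′ (there i))))
    where
    p′ : q ∷ map proj₂ β ↭ range1 n
    p′ = drop-∷ p
  go c p | no j≢ with split-link c (top∈ (∈-resp-↭ (↭-sym p) (here refl)))
    where
    top∈ : suc n ∈ j ∷ map proj₂ c → suc n ∈ map proj₂ c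
    top∈ (here e)  = ⊥-elim (j≢ (sym e))
    top∈ (there h) = h
  ... | α , r , β , refl = finish p′ (inner α r β (inR p′ (here refl))
      (positioned α (λ i → inR p′ (there (∈-++⁺ˡ i)))) (positioned β (λ i → inR p′ (there (∈-++⁺ʳ (map proj₂ α) i)))))
    where
    p′ : j ∷ map proj₂ α ++ map proj₂ β ↭ range1 n
    p′ = drop-∷ (↭-trans (↭-sym (shift (suc n) (j ∷ map proj₂ α) (map proj₂ β)))
      (subst (λ l → j ∷ l ↭ suc n ∷ range1 n) (map-++ proj₂ α ((r , suc n) ∷ β)) p))

-- Sums over sign assignments

upd : ℕ → Bool → (ℕ → Bool) → ℕ → Bool
upd j x f k = if k ≡ᵇ j then x else f k

-- Signs are assigned along a list of positions rather than by a vector, so that the order of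
-- summation can be changed to that of the chain. There the summand is a product of transitions
-- between consecutive signs.
signSum : List ℕ → ((ℕ → Bool) → ℚ) → (ℕ → Bool) → ℚ
signSum []       G f = G f
signSum (j ∷ js) G f = signSum js G (upd j true f) +q signSum js G (upd j false f)

-- Updates at two positions commute only pointwise, so changing the order of summation needs a
-- summand that respects pointwise equality.
Extensional : ((ℕ → Bool) → ℚ) → Set
Extensional G = ∀ {f g} → f ≗ g → G f ≡ G g

upd-cong : ∀ j x {f g} → f ≗ g → upd j x f ≗ upd j x g
upd-cong j x e k with k ≡ᵇ j
... | true  = refl
... | false = e k

upd-here : ∀ j x f → upd j x f j ≡ x
upd-here j x f = cong (λ b → if b then x else f j) (≡ᵇ-refl j)

upd-there : ∀ {j k} x f → k ≢ j → upd j x f k ≡ f k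
upd-there {j} {k} x f ne = cong (λ b → if b then x else f k) (≡ᵇ-no k j ne)

upd-comm : ∀ {j k} x y f → j ≢ k → upd k y (upd j x f) ≗ upd j x (upd k y f)
upd-comm {j} {k} x y f ne i with i ℕP.≟ j | i ℕP.≟ k
... | yes refl | yes refl = ⊥-elim (ne refl)
... | yes refl | no i≢k   = trans (upd-there y (upd j x f) i≢k) (trans (upd-here j x f) (sym (upd-here j x (upd k y f))))
... | no i≢j   | yes refl = trans (upd-here k y (upd j x f)) (sym (trans (upd-there x (upd k y f) i≢j) (upd-here k y f)))
... | no i≢j   | no i≢k   = trans (upd-there y (upd j x f) i≢k) (trans (upd-there x f i≢j) (sym (trans (upd-there x (upd k y f) i≢j) (upd-there y f i≢k))))

signSum-cong : ∀ js {G} → Extensional G → Extensional (signSum js G)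
signSum-cong []       ext e = ext e
signSum-cong (j ∷ js) ext e = cong₂ _+q_ (signSum-cong js ext (upd-cong j true e)) (signSum-cong js ext (upd-cong j false e))

signSum-↭ : ∀ {js ks G} → Extensional G → js ↭ ks → ∀ f → signSum js G f ≡ signSum ks G f
signSum-↭ ext Perm.refl         f = refl
signSum-↭ ext (Perm.prep j p)   f = cong₂ _+q_ (signSum-↭ ext p _) (signSum-↭ ext p _)
signSum-↭ ext (Perm.trans p p') f = trans (signSum-↭ ext p f) (signSum-↭ ext p' f)
signSum-↭ {G = G} ext (Perm.swap {js} {ks} j k p) f with j ℕP.≟ k
... | yes refl = cong₂ _+q_ (cong₂ _+q_ (signSum-↭ ext p _) (signSum-↭ ext p _)) (cong₂ _+q_ (signSum-↭ ext p _) (signSum-↭ ext p _))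
... | no j≢k   = trans (cong₂ _+q_ (cong₂ _+q_ (h true true) (h true false)) (cong₂ _+q_ (h false true) (h false false)))
    (+-interchange (S true true) (S true false) (S false true) (S false false))
  where
  S : Bool → Bool → ℚ
  S x y = signSum ks G (upd j x (upd k y f))
  h : ∀ x y → signSum js G (upd k y (upd j x f)) ≡ S x y
  h x y = trans (signSum-↭ ext p _) (signSum-cong ks ext (upd-comm x y f j≢k))

signSum-∷ʳ : ∀ js j G f → signSum (js ∷ʳ j) G f ≡ signSum js (λ g → G (upd j true g) +q G (upd j false g)) f
signSum-∷ʳ []       j G f = refl
signSum-∷ʳ (i ∷ js) j G f = cong₂ _+q_ (signSum-∷ʳ js j G (upd i true f)) (signSum-∷ʳ js j G (upd i false f))

∑-signs : ∀ n G → ∑ (allSigns n) (λ s → G (lk false s)) ≡ signSum (range1 n) G (λ _ → false)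
∑-signs zero    G = ℚP.+-identityʳ _
∑-signs (suc n) G = begin
  ∑ (allSigns (suc n)) (λ s → G (lk false s))
    ≡⟨ ∑-allSigns n (λ s → G (lk false s)) ⟩
  ∑ (allSigns n) (λ s → G (lk false (true ∷ s)) +q G (lk false (false ∷ s)))
    ≡⟨ ∑-cong-All (allSigns-length n) (λ { s refl → refl }) ⟩
  ∑ (allSigns n) (λ s → G (upd (suc n) true (lk false s)) +q G (upd (suc n) false (lk false s)))
    ≡⟨ ∑-signs n (λ g → G (upd (suc n) true g) +q G (upd (suc n) false g)) ⟩
  signSum (range1 n) (λ g → G (upd (suc n) true g) +q G (upd (suc n) false g)) (λ _ → false)
    ≡⟨ sym (signSum-∷ʳ (range1 n) (suc n) G (λ _ → false)) ⟩
  signSum (range1 n ∷ʳ suc n) G (λ _ → false)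
    ≡⟨ cong (λ l → signSum l G (λ _ → false)) (sym (range1-∷ʳ n)) ⟩
  signSum (range1 (suc n)) G (λ _ → false) ∎

-- The transfer-matrix form of the sum over signs: only the sign at the preceding position is
-- remembered.
walk : (ℕ → ℕ) → Bool → ℕ → Links → ℚ
walk X x j []            = 1ℚ
walk X x j ((r , k) ∷ c) = ∑ bothSigns (λ x' → ind (precedes x (X j) r x' (X k)) *q walk X x' k c)

signSum-factor : ∀ (N : Bool → Bool → ℚ) B {j k} ks g → All (j ≢_) ks → All (k ≢_) ks →
  signSum ks (λ f → N (f j) (f k) *q B f) g ≡ N (g j) (g k) *q signSum ks B g
signSum-factor N B         []       g []         []         = refl
signSum-factor N B {j} {k} (i ∷ ks) g (nj ∷ njs) (nk ∷ nks) = trans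
  (cong₂ _+q_ (branch true) (branch false)) (sym (ℚP.*-distribˡ-+ (N (g j) (g k)) _ _))
  where
  branch : ∀ x → signSum ks (λ f → N (f j) (f k) *q B f) (upd i x g) ≡ N (g j) (g k) *q signSum ks B (upd i x g)
  branch x = trans (signSum-factor N B ks (upd i x g) njs nks)
    (cong₂ (λ p q → N p q *q signSum ks B (upd i x g)) (upd-there x g nj) (upd-there x g nk))

signSum-walk : ∀ X j c f → Unique (j ∷ map proj₂ c) →
  signSum (map proj₂ c) (λ g → signedChain g X j c) f ≡ walk X (f j) j c
signSum-walk X j []            f _ = refl
signSum-walk X j ((r , k) ∷ c) f ((j≢k ∷ nj) ∷ (nk ∷ u)) = cong₂ _+q_ (branch true) (trans (branch false) (sym (ℚP.+-identityʳ _)))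
  where
  N : Bool → Bool → ℚ
  N x x' = ind (precedes x (X j) r x' (X k))
  branch : ∀ x → signSum (map proj₂ c) (λ g → N (g j) (g k) *q signedChain g X k c) (upd k x f) ≡ N (f j) x *q walk X x k c
  branch x = trans (signSum-factor N (λ g → signedChain g X k c) (map proj₂ c) (upd k x f) nj nk)
    (cong₂ _*q_ (cong₂ N (upd-there x f j≢k) (upd-here k x f))
      (trans (signSum-walk X k c (upd k x f) (nk ∷ u)) (cong (λ y → walk X y k c) (upd-here k x f))))

signedChain-ext : ∀ X j c → Extensional (λ f → signedChain f X j c)
signedChain-ext X j c {f} {g} e = signedChain-cong j c (e j , refl) (go c)
  where
  go : ∀ c → All (λ l → (f (proj₂ l) ≡ g (proj₂ l)) × (X (proj₂ l) ≡ X (proj₂ l))) c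
  go []      = []
  go (l ∷ c) = (e (proj₂ l) , refl) ∷ go c

unique-map : ∀ {f : A → B} {xs} → (∀ {x y} → x ∈ xs → y ∈ xs → f x ≡ f y → x ≡ y) → Unique xs → Unique (map f xs)
unique-map inj []       = []
unique-map {f = f} {xs = x ∷ xs} inj (n ∷ u) = away xs n (λ i → i) ∷ unique-map (λ i j → inj (there i) (there j)) u
  where
  away : ∀ ys → All (x ≢_) ys → (∀ {y} → y ∈ ys → y ∈ xs) → All (f x ≢_) (map f ys)
  away []       []       sub = []
  away (y ∷ ys) (p ∷ ps) sub = (λ e → p (inj (here refl) (there (sub (here refl))) e)) ∷ away ys ps (λ i → sub (there i))

unique-range1 : ∀ n → Unique (range1 n)
unique-range1 n = UniqueP.map⁺ ℕP.suc-injective (UniqueP.upTo⁺ n)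

All≢-∉ : ∀ {x : A} {xs} → All (x ≢_) xs → x ∉ xs
All≢-∉ (p ∷ ps) (here e)  = p e
All≢-∉ (p ∷ ps) (there i) = All≢-∉ ps i

-- A pigeonhole argument. It turns `isPermB`, which asserts values in range and injectivity, into an
-- actual rearrangement of the positions.
↭-of-⊆ : ∀ {xs ys : List A} → Unique ys → (∀ {y} → y ∈ ys → y ∈ xs) → length ys ≡ length xs → ys ↭ xs
↭-of-⊆ {xs = []}     {[]}     _ _ _ = ↭-refl
↭-of-⊆ {xs = x ∷ xs} {[]}     _ _ ()
↭-of-⊆ {xs = xs}     {y ∷ ys} (n ∷ u) sub l with ∈-∃++ (sub (here refl))
... | as , bs , refl = ↭-trans (↭-prep y (↭-of-⊆ u sub′ l′)) (↭-sym (shift y as bs))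
  where
  sub′ : ∀ {z} → z ∈ ys → z ∈ as ++ bs
  sub′ i with ∈-++⁻ as (sub (there i))
  ... | inj₁ h         = ∈-++⁺ˡ h
  ... | inj₂ (here e)  = ⊥-elim (All≢-∉ n (subst (_∈ ys) e i))
  ... | inj₂ (there h) = ∈-++⁺ʳ as h
  l′ : length ys ≡ length (as ++ bs)
  l′ = ℕP.suc-injective (trans l (↭-length (shift y as bs)))

Unique-resp-↭ : ∀ {xs ys : List A} → xs ↭ ys → Unique xs → Unique ys
Unique-resp-↭ Perm.refl        u = u
Unique-resp-↭ (Perm.prep x p)  (n ∷ u) = All-resp-↭ p n ∷ Unique-resp-↭ p u
Unique-resp-↭ (Perm.swap x y p) ((x≢y ∷ n) ∷ (m ∷ u)) = ((x≢y ∘ sym) ∷ All-resp-↭ p m) ∷ (All-resp-↭ p n ∷ Unique-resp-↭ p u)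
Unique-resp-↭ (Perm.trans p q) u = Unique-resp-↭ q (Unique-resp-↭ p u)

∑-signedChain : ∀ n X j c → j ∷ map proj₂ c ↭ range1 n →
  ∑ (allSigns n) (λ s → signedChain (lk false s) X j c) ≡ ∑ bothSigns (λ x → walk X x j c)
∑-signedChain n X j c p = begin
  ∑ (allSigns n) (λ s → signedChain (lk false s) X j c)
    ≡⟨ ∑-signs n (λ f → signedChain f X j c) ⟩
  signSum (range1 n) (λ f → signedChain f X j c) (λ _ → false)
    ≡⟨ signSum-↭ (signedChain-ext X j c) (↭-sym p) (λ _ → false) ⟩
  signSum (j ∷ map proj₂ c) (λ f → signedChain f X j c) (λ _ → false)
    ≡⟨ cong₂ _+q_ (branch true) (trans (branch false) (sym (ℚP.+-identityʳ _))) ⟩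
  ∑ bothSigns (λ x → walk X x j c) ∎
  where
  branch : ∀ x → signSum (map proj₂ c) (λ f → signedChain f X j c) (upd j x (λ _ → false)) ≡ walk X x j c
  branch x = trans (signSum-walk X j c (upd j x (λ _ → false)) (Unique-resp-↭ (↭-sym p) (unique-range1 n)))
    (cong (λ y → walk X y j c) (upd-here j x (λ _ → false)))

-- Sign sequences along a permuted word depend only on the peaks

count : (ℕ → Bool) → (ℕ → ℕ) → Bool → ℕ → ℕ → ℚ
count D X x i zero    = 1ℚ
count D X x i (suc m) = ∑ bothSigns (λ x' → ind (precedes x (X i) (D i) x' (X (suc i))) *q count D X x' (suc i) m)

-- Invariant for two descent sets (first bits b, b') with the same peaks, processed from the right;
-- p, m (resp. p', m') count the completions after a positive and after a negative letter.
data SamePeaks (b b' : Bool) (p m p' m' : ℚ) : Set where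
  same  : p ≡ p' → m ≡ m' → ((b ≡ true) × (b' ≡ true)) ⊎ (p ≡ m) → SamePeaks b b' p m p' m'
  left  : b ≡ false → b' ≡ true → p ≡ m → p' ≡ 0ℚ → m' ≡ m +q m → SamePeaks b b' p m p' m'
  right : b ≡ true → b' ≡ false → p' ≡ m' → p ≡ 0ℚ → m ≡ m' +q m' → SamePeaks b b' p m p' m'

samePeaks-total : ∀ {b b' p m p' m'} → SamePeaks b b' p m p' m' → p +q m ≡ p' +q m'
samePeaks-total (same e e' _)              = cong₂ _+q_ e e'
samePeaks-total {m = m} (left _ _ refl refl refl)    = sym (ℚP.+-identityˡ (m +q m))
samePeaks-total {m' = m'} (right _ _ refl refl refl) = ℚP.+-identityˡ (m' +q m')

-- At a repeated letter, a strict step allows nothing after a positive sign and either sign after a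
-- negative one; a weak step forces the next sign to be positive.
onEqual : Bool → ℚ → ℚ → ℚ × ℚ
onEqual true  p m = 0ℚ , p +q m
onEqual false p m = p , p

-- A common strict step sees only the totals. A common weak step makes the next bits equal, which
-- leaves only `same`. If the current bits differ, the side with the weak step cannot continue with
-- a strict one, for that would be a peak missing on the other side; so its two counts agree, and
-- the strict side merely moves the whole total to the negative sign.
samePeaks-equal : ∀ b b' d d' {p m p' m'} → not b ∧ d ≡ not b' ∧ d' → SamePeaks d d' p m p' m' →
  SamePeaks b b' (proj₁ (onEqual b p m)) (proj₂ (onEqual b p m)) (proj₁ (onEqual b' p' m')) (proj₂ (onEqual b' p' m'))
samePeaks-equal true  true  d d' c S = same refl (samePeaks-total S) (inj₁ (refl , refl))
samePeaks-equal false false d d' c (same e e' _) = same e e (inj₂ refl)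
samePeaks-equal false false d d' () (left refl refl _ _ _)
samePeaks-equal false false d d' () (right refl refl _ _ _)
samePeaks-equal false true  d d' {p} {m} c (same refl refl (inj₂ refl)) = left refl refl refl refl refl
samePeaks-equal false true  d d' () (same refl refl (inj₁ (refl , refl)))
samePeaks-equal false true  d d' c (left refl refl refl refl refl) = left refl refl refl refl (ℚP.+-identityˡ _)
samePeaks-equal false true  d d' () (right refl refl _ _ _)
samePeaks-equal true  false d d' c (same refl refl (inj₂ refl)) = right refl refl refl refl refl
samePeaks-equal true  false d d' () (same refl refl (inj₁ (refl , refl)))
samePeaks-equal true  false d d' c (right refl refl refl refl refl) = right refl refl refl refl (ℚP.+-identityˡ _)
samePeaks-equal true  false d d' () (left refl refl _ _ _)

-- The default `false` after the last step creates no peak.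
firstBit : (ℕ → Bool) → ℕ → ℕ → Bool
firstBit D i zero    = false
firstBit D i (suc m) = D i

count-less : ∀ D X x i m → X i < X (suc i) → count D X x i (suc m) ≡ count D X true (suc i) m +q count D X false (suc i) m
count-less D X x i m lt
  rewrite precedes-< x (X i) (D i) true (X (suc i)) (key-< x true lt) | precedes-< x (X i) (D i) false (X (suc i)) (key-< x false lt) =
  solve 2 (λ p q → con 1ℚ :* p :+ (con 1ℚ :* q :+ con 0ℚ) := p :+ q) refl (count D X true (suc i) m) (count D X false (suc i) m)

count-greater : ∀ D X x i m → X (suc i) < X i → count D X x i (suc m) ≡ 0ℚ
count-greater D X x i m gt
  rewrite precedes-> x (X i) (D i) true (X (suc i)) (key-< true x gt) | precedes-> x (X i) (D i) false (X (suc i)) (key-< false x gt) =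
  solve 2 (λ p q → con 0ℚ :* p :+ (con 0ℚ :* q :+ con 0ℚ) := con 0ℚ) refl (count D X true (suc i) m) (count D X false (suc i) m)

key-false<true : ∀ a → key false a < key true a
key-false<true a = ℕP.+-monoʳ-< (2 * a) (s≤s z≤n)

count-equal : ∀ D X i m → X i ≡ X (suc i) →
  (count D X true i (suc m) , count D X false i (suc m)) ≡ onEqual (D i) (count D X true (suc i) m) (count D X false (suc i) m)
count-equal D X i m e rewrite e
  | precedes-≡ true (X (suc i)) (D i) | precedes-≡ false (X (suc i)) (D i)
  | precedes-< false (X (suc i)) (D i) true (X (suc i)) (key-false<true (X (suc i)))
  | precedes-> true (X (suc i)) (D i) false (X (suc i)) (key-false<true (X (suc i))) with D i
... | true  = cong₂ _,_ (solve 2 (λ p q → con 0ℚ :* p :+ (con 0ℚ :* q :+ con 0ℚ) := con 0ℚ) refl P M)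
                        (solve 2 (λ p q → con 1ℚ :* p :+ (con 1ℚ :* q :+ con 0ℚ) := p :+ q) refl P M)
  where
  P = count D X true (suc i) m
  M = count D X false (suc i) m
... | false = cong₂ _,_ (solve 2 (λ p q → con 1ℚ :* p :+ (con 0ℚ :* q :+ con 0ℚ) := p) refl P M)
                        (solve 2 (λ p q → con 1ℚ :* p :+ (con 0ℚ :* q :+ con 0ℚ) := p) refl P M)
  where
  P = count D X true (suc i) m
  M = count D X false (suc i) m

-- Strictness matters only between equal letters. An increase passes on the total of the two counts,
-- a decrease passes on 0, in both cases regardless of the current sign, so the new counts agree and
-- fall under `same`.
count-peaks : ∀ D D' X i m → (∀ t → suc t < m → not (D (i + t)) ∧ D (suc (i + t)) ≡ not (D' (i + t)) ∧ D' (suc (i + t))) →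
  SamePeaks (firstBit D i m) (firstBit D' i m) (count D X true i m) (count D X false i m) (count D' X true i m) (count D' X false i m)
count-peaks D D' X i zero    h = same refl refl (inj₂ refl)
count-peaks D D' X i (suc m) h with ℕP.<-cmp (X i) (X (suc i))
... | tri< lt _ _ = same (trans (count-less D X true i m lt) (trans total (sym (count-less D' X true i m lt))))
                         (trans (count-less D X false i m lt) (trans total (sym (count-less D' X false i m lt))))
                         (inj₂ (trans (count-less D X true i m lt) (sym (count-less D X false i m lt))))
  where
  total = samePeaks-total (count-peaks D D' X (suc i) m
    (λ t lt → subst (λ j → not (D j) ∧ D (suc j) ≡ not (D' j) ∧ D' (suc j)) (ℕP.+-suc i t) (h (suc t) (s≤s lt))))
... | tri> _ _ gt = same (trans (count-greater D X true i m gt) (sym (count-greater D' X true i m gt)))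
                         (trans (count-greater D X false i m gt) (sym (count-greater D' X false i m gt)))
                         (inj₂ (trans (count-greater D X true i m gt) (sym (count-greater D X false i m gt))))
... | tri≈ _ eq _ = subst₂ (λ c c' → SamePeaks (D i) (D' i) (proj₁ c) (proj₂ c) (proj₁ c') (proj₂ c'))
    (sym (count-equal D X i m eq)) (sym (count-equal D' X i m eq))
    (samePeaks-equal (D i) (D' i) (firstBit D (suc i) m) (firstBit D' (suc i) m) (peak m h)
      (count-peaks D D' X (suc i) m
        (λ t lt → subst (λ j → not (D j) ∧ D (suc j) ≡ not (D' j) ∧ D' (suc j)) (ℕP.+-suc i t) (h (suc t) (s≤s lt)))))
  where
  peak : ∀ m → (∀ t → suc t < suc m → not (D (i + t)) ∧ D (suc (i + t)) ≡ not (D' (i + t)) ∧ D' (suc (i + t))) →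
    not (D i) ∧ firstBit D (suc i) m ≡ not (D' i) ∧ firstBit D' (suc i) m
  peak zero    h = trans (∧-comm (not (D i)) false) (∧-comm false (not (D' i)))
  peak (suc m) h = subst (λ j → not (D j) ∧ D (suc j) ≡ not (D' j) ∧ D' (suc j)) (ℕP.+-identityʳ i) (h 0 (s≤s (s≤s z≤n)))

-- The linear extension of F ↦ K

transform : Series → Series
transform f w = ∑ (allSigns (length w)) (λ s → euler (f ∘ reverse) s (reverse w))

sign-lengths : ∀ (w : List ℕ) → All (λ s → length s ≡ length (reverse w)) (allSigns (length w))
sign-lengths w = subst (λ n → All (λ s → length s ≡ n) (allSigns (length w))) (sym (length-reverse w)) (allSigns-length (length w))

transform-cong : ∀ {f g} w → (∀ u → length u ≡ length w → f u ≡ g u) → transform f w ≡ transform g w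
transform-cong {f} {g} w e = ∑-cong-All {P = λ s → length s ≡ length (reverse w)} {xs = allSigns (length w)} (sign-lengths w) (λ s l → euler-cong s (reverse w) l
  (λ u cs → e (reverse u) (trans (length-reverse u) (trans (cells-length cs) (length-reverse w)))))

transform-∑ : ∀ (L : List A) (f : A → Series) w → transform (λ u → ∑ L (λ i → f i u)) w ≡ ∑ L (λ i → transform (f i) w)
transform-∑ L f w = trans (∑-cong-All {P = λ s → length s ≡ length (reverse w)} {xs = allSigns (length w)} (sign-lengths w) (λ s l → euler-∑ s (reverse w) L (λ i → f i ∘ reverse) l))
  (∑-swap (allSigns (length w)) L (λ s i → euler (f i ∘ reverse) s (reverse w)))

transform-* : ∀ c f w → transform (c ·S f) w ≡ c *q transform f w
transform-* c f w = trans (∑-cong-All {P = λ s → length s ≡ length (reverse w)} {xs = allSigns (length w)} (sign-lengths w) (λ s l → euler-* s (reverse w) c (f ∘ reverse) l)) (∑-*ˡ (allSigns (length w)) c _)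

at-∷ʳ-below : ∀ xs x {j} → 1 ≤ j → j ≤ length xs → at (xs ∷ʳ x) j ≡ at xs j
at-∷ʳ-below (y ∷ xs) x {suc zero}    _ _       = refl
at-∷ʳ-below (y ∷ xs) x {suc (suc j)} _ (s≤s l) = at-∷ʳ-below xs x {suc j} (s≤s z≤n) l

at-∷ʳ-top : ∀ xs x → at (xs ∷ʳ x) (suc (length xs)) ≡ x
at-∷ʳ-top []       x = refl
at-∷ʳ-top (y ∷ xs) x = at-∷ʳ-top xs x

at-reverse : ∀ u {j} → InRange (length u) j → at (reverse u) j ≡ lk 0 u j
at-reverse []      (1≤j , j≤0) = ⊥-elim (ℕP.<⇒≱ 1≤j j≤0)
at-reverse (z ∷ u) {j} (1≤j , j≤) rewrite unfold-reverse z u with ℕP.m≤n⇒m<n∨m≡n j≤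
... | inj₁ j<   = trans (at-∷ʳ-below (reverse u) z 1≤j (subst (j ≤_) (sym (length-reverse u)) (ℕP.≤-pred j<)))
                  (trans (at-reverse u (1≤j , ℕP.≤-pred j<)) (sym (lk-below 0 z u refl (ℕP.≤-pred j<))))
... | inj₂ refl = trans (trans (cong (at (reverse u ∷ʳ z)) (cong suc (sym (length-reverse u)))) (at-∷ʳ-top (reverse u) z)) (sym (lk-top 0 z u refl))

product : (ℕ → Bool) → ℕ → ℕ → ℚ
product f i zero    = 1ℚ
product f i (suc m) = ind (f i) *q product f (suc i) m

product-shift : ∀ f i m → product (f ∘ suc) i m ≡ product f (suc i) m
product-shift f i zero    = refl
product-shift f i (suc m) = cong (ind (f (suc i)) *q_) (product-shift f (suc i) m)

ind-all : ∀ f m → ind (all f (range1 m)) ≡ product f 1 m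
ind-all f zero    = refl
ind-all f (suc m) = trans (cong (λ l → ind (all f l)) (range1-suc m)) (trans (ind-∧ (f 1) _)
  (cong (ind (f 1) *q_) (trans (cong ind (all-map suc f (range1 m))) (trans (ind-all (f ∘ suc) m) (product-shift f 1 m)))))

links : List ℕ → (ℕ → ℕ) → ℕ → ℕ → Links
links A σ i zero    = []
links A σ i (suc m) = (memB i A , σ (suc i)) ∷ links A σ (suc i) m

links-places : ∀ A σ m i → map proj₂ (links A σ i m) ≡ map (λ t → σ (suc (i + t))) (upTo m)
links-places A σ zero    i = refl
links-places A σ (suc m) i = cong₂ _∷_ (cong (σ ∘ suc) (sym (ℕP.+-identityʳ i)))
  (trans (links-places A σ m (suc i)) (trans (map-cong (λ t → cong (σ ∘ suc) (sym (ℕP.+-suc i t))) (upTo m))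
    (trans (map-upTo (λ t → σ (suc (i + suc t))) m) (sym (map-applyUpTo suc (λ t → σ (suc (i + t))) m)))))

links-range : ∀ A σ m → σ 1 ∷ map proj₂ (links A σ 1 m) ≡ map σ (range1 (suc m))
links-range A σ m = trans (cong (σ 1 ∷_) (trans (links-places A σ m 1) (map-∘ {g = σ} {f = suc ∘ suc} (upTo m))))
  (sym (trans (cong (map σ) (range1-suc m)) (cong (λ l → σ 1 ∷ map σ l) (sym (map-∘ {g = suc} {f = suc} (upTo m))))))

perm-↭ : ∀ n σ → T (isPermB n σ) → map σ (range1 n) ↭ range1 n
perm-↭ n σ t = ↭-of-⊆ (unique-map inj (unique-range1 n)) sub (length-map σ (range1 n))
  where
  e = ∧-split {all (λ i → (1 ≤ᵇ σ i) ∧ (σ i ≤ᵇ n)) (range1 n)} (T⇒≡ t)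
  inj : ∀ {x y} → x ∈ range1 n → y ∈ range1 n → σ x ≡ σ y → x ≡ y
  inj {x} {y} hx hy eq = ≡ᵇ-true x y (trans (sym (cong (λ b → not b ∨ (x ≡ᵇ y)) (≡ᵇ-yes (σ x) (σ y) eq))) (all-true (all-true (proj₂ e) hx) hy))
  sub : ∀ {y} → y ∈ map σ (range1 n) → y ∈ range1 n
  sub h with ∈-map⁻ σ h
  ... | x , hx , refl with ∧-split {1 ≤ᵇ σ x} (all-true (proj₁ e) hx)
  ...   | p , q = ∈-range1 (≤ᵇ-true 1 (σ x) p) (≤ᵇ-true (σ x) n q)

perm-injective : ∀ n σ → T (isPermB n σ) → ∀ {x y} → x ∈ range1 n → y ∈ range1 n → σ x ≡ σ y → x ≡ y
perm-injective n σ t {x} {y} hx hy eq =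
  ≡ᵇ-true x y (trans (sym (cong (λ b → not b ∨ (x ≡ᵇ y)) (≡ᵇ-yes (σ x) (σ y) eq)))
    (all-true (all-true (proj₂ (∧-split {all (λ i → (1 ≤ᵇ σ i) ∧ (σ i ≤ᵇ n)) (range1 n)} (T⇒≡ t))) hx) hy))

rel-strict : ∀ r x y → (x ≤ᵇ y) ∧ (r ⇒ᵇ (x <ᵇ y)) ≡ rel r x y
rel-strict true  x y = ≡⇔ (λ e → proj₂ (∧-split {x ≤ᵇ y} e))
  (λ e → cong₂ _∧_ (≤ᵇ-yes x y (ℕP.<⇒≤ (<ᵇ-true x y e))) e)
rel-strict false x y = ∧-comm (x ≤ᵇ y) true

FS-step : List ℕ → (ℕ → ℕ) → List ℕ → ℕ → Bool
FS-step A σ w i = (at w (σ i) ≤ᵇ at w (σ (suc i))) ∧ (memB i A ⇒ᵇ (at w (σ i) <ᵇ at w (σ (suc i))))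

product-chain : ∀ A σ w i m → product (FS-step A σ w) i m ≡ chain (at w) (σ i) (links A σ i m)
product-chain A σ w i zero    = refl
product-chain A σ w i (suc m) = cong₂ _*q_ (cong ind (rel-strict (memB i A) (at w (σ i)) (at w (σ (suc i))))) (product-chain A σ w (suc i) m)

chain-cong : ∀ {f g} j c → f j ≡ g j → All (λ l → f (proj₂ l) ≡ g (proj₂ l)) c → chain f j c ≡ chain g j c
chain-cong j []            e []        = refl
chain-cong j ((r , k) ∷ c) e (e' ∷ es) = cong₂ _*q_ (cong ind (cong₂ (rel r) e e')) (chain-cong k c e' es)

FS-off : ∀ n A σ w → length w ≢ n → FS n A σ w ≡ 0ℚ
FS-off n A σ w ne = cong (λ b → ind (b ∧ all (FS-step A σ w) (range1 (n ∸ 1)))) (≡ᵇ-no (length w) n ne)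

walk-count : ∀ A σ Y x i m → walk Y x (σ i) (links A σ i m) ≡ count (λ i → memB i A) (Y ∘ σ) x i m
walk-count A σ Y x i zero    = refl
walk-count A σ Y x i (suc m) = ∑-cong bothSigns (λ x' →
  cong (ind (precedes x (Y (σ i)) (memB i A) x' (Y (σ (suc i)))) *q_) (walk-count A σ Y x' (suc i) m))

walk-cong : ∀ {X Y} x j c → X j ≡ Y j → All (λ l → X (proj₂ l) ≡ Y (proj₂ l)) c → walk X x j c ≡ walk Y x j c
walk-cong x j []            e []        = refl
walk-cong x j ((r , k) ∷ c) e (e' ∷ es) = ∑-cong bothSigns (λ x' → cong₂ _*q_
  (cong₂ (λ p q → ind (precedes x p r x' q)) e e') (walk-cong x' k c e' es))

-- Each sign vector contributes a product of step conditions along σ. Their sum is the count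
-- defining K, with the set `A` in the place of the descents of γ.
transform-F : ∀ m A σ w → T (isPermB (suc m) σ) → length w ≡ suc m →
  transform (FS (suc m) A σ) w ≡ ∑ bothSigns (λ x → count (λ i → memB i A) (at w ∘ σ) x 1 m)
transform-F m A σ w t lw = begin
  transform (FS n A σ) w
    ≡⟨ cong (λ k → ∑ (allSigns k) (λ s → euler (FS n A σ ∘ reverse) s u)) lw ⟩
  ∑ (allSigns n) (λ s → euler (FS n A σ ∘ reverse) s u)
    ≡⟨ ∑-cong-All {P = λ s → length s ≡ n} (allSigns-length n) (λ s ls → trans
         (euler-cong s u (trans ls (sym lu)) (λ v cs → FS-chain v (trans (cells-length cs) lu)))
         (euler-chain s u (σ 1) c (trans ls (sym lu)) (subst (λ k → σ 1 ∷ map proj₂ c ↭ range1 k) (sym lu) perm))) ⟩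
  ∑ (allSigns n) (λ s → signedChain (lk false s) (lk 0 u) (σ 1) c)
    ≡⟨ ∑-signedChain n (lk 0 u) (σ 1) c perm ⟩
  ∑ bothSigns (λ x → walk (lk 0 u) x (σ 1) c)
    ≡⟨ ∑-cong bothSigns (λ x → trans (walk-cong x (σ 1) c (lookup-w (here refl)) (lookups c (λ i → there i))) (walk-count A σ (at w) x 1 m)) ⟩
  ∑ bothSigns (λ x → count (λ i → memB i A) (at w ∘ σ) x 1 m) ∎
  where
  n = suc m
  u = reverse w
  c = links A σ 1 m
  lu : length u ≡ n
  lu = trans (length-reverse w) lw
  perm : σ 1 ∷ map proj₂ c ↭ range1 n
  perm = subst (_↭ range1 n) (sym (links-range A σ m)) (perm-↭ n σ t)
  inside : ∀ {j} → j ∈ σ 1 ∷ map proj₂ c → InRange n j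
  inside h = range1-∈ (∈-resp-↭ perm h)
  lookup-w : ∀ {j} → j ∈ σ 1 ∷ map proj₂ c → lk 0 u j ≡ at w j
  lookup-w {j} h = trans (sym (at-reverse u (subst (λ k → InRange k j) (sym lu) (inside h)))) (cong (λ v → at v j) (reverse-involutive w))
  lookups : ∀ c' → (∀ {j} → j ∈ map proj₂ c' → j ∈ σ 1 ∷ map proj₂ c) → All (λ l → lk 0 u (proj₂ l) ≡ at w (proj₂ l)) c'
  lookups []       h = []
  lookups (l ∷ c') h = lookup-w (h (here refl)) ∷ lookups c' (λ i → h (there i))
  FS-chain : ∀ v → length v ≡ n → FS n A σ (reverse v) ≡ chain (lk 0 v) (σ 1) c
  FS-chain v lv = begin
    FS n A σ (reverse v)
      ≡⟨ cong (λ b → ind (b ∧ all (FS-step A σ (reverse v)) (range1 m))) (≡ᵇ-yes (length (reverse v)) n (trans (length-reverse v) lv)) ⟩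
    ind (all (FS-step A σ (reverse v)) (range1 m))
      ≡⟨ ind-all (FS-step A σ (reverse v)) m ⟩
    product (FS-step A σ (reverse v)) 1 m
      ≡⟨ product-chain A σ (reverse v) 1 m ⟩
    chain (at (reverse v)) (σ 1) c
      ≡⟨ chain-cong (σ 1) c (lookup-v (here refl)) (lookups-v c (λ i → there i)) ⟩
    chain (lk 0 v) (σ 1) c ∎
    where
    lookup-v : ∀ {j} → j ∈ σ 1 ∷ map proj₂ c → at (reverse v) j ≡ lk 0 v j
    lookup-v {j} h = at-reverse v (subst (λ k → InRange k j) (sym lv) (inside h))
    lookups-v : ∀ c' → (∀ {j} → j ∈ map proj₂ c' → j ∈ σ 1 ∷ map proj₂ c) → All (λ l → at (reverse v) (proj₂ l) ≡ lk 0 v (proj₂ l)) c'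
    lookups-v []       h = []
    lookups-v (l ∷ c') h = lookup-v (h (here refl)) ∷ lookups-v c' (λ i → h (there i))

-- The functions K as counts of admissible sign sequences

KS-key : (ℕ → ℕ) → List ℕ → List Bool → ℕ → ℕ
KS-key σ w s i = 2 * at w (σ i) + (if atB s i then 1 else 0)

KS-step : (ℕ → ℕ) → (ℕ → ℕ) → List ℕ → List Bool → ℕ → Bool
KS-step γ σ w s i = (KS-key σ w s i ≤ᵇ KS-key σ w s (suc i)) ∧ ((KS-key σ w s i ≡ᵇ KS-key σ w s (suc i)) ⇒ᵇ
  (if atB s i then γ i <ᵇ γ (suc i) else γ (suc i) <ᵇ γ i))

step-precedes : ∀ x a x' a' g g' → g ≢ g' →
  (key x a ≤ᵇ key x' a') ∧ ((key x a ≡ᵇ key x' a') ⇒ᵇ (if x then g <ᵇ g' else g' <ᵇ g)) ≡ precedes x a (g' <ᵇ g) x' a'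
step-precedes x a x' a' g g' ne with precedesView x a (g' <ᵇ g) x' a'
... | less lt e = trans (cong₂ (λ p q → p ∧ (q ⇒ᵇ (if x then g <ᵇ g' else g' <ᵇ g))) (≤ᵇ-yes (key x a) (key x' a') (ℕP.<⇒≤ lt)) (≡ᵇ-no (key x a) (key x' a') (ℕP.<⇒≢ lt))) (sym e)
... | greater gt e = trans (cong (_∧ ((key x a ≡ᵇ key x' a') ⇒ᵇ (if x then g <ᵇ g' else g' <ᵇ g))) (≤ᵇ-no (key x a) (key x' a') gt)) (sym e)
... | equal refl refl e = trans (cong₂ (λ p q → p ∧ (q ⇒ᵇ (if x then g <ᵇ g' else g' <ᵇ g))) (≤ᵇ-yes (key x a) (key x a) ℕP.≤-refl) (≡ᵇ-refl (key x a))) (trans (final x) (sym e))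
  where
  final : ∀ x → (if x then g <ᵇ g' else g' <ᵇ g) ≡ repeats x (g' <ᵇ g)
  final false = refl
  final true with ℕP.<-cmp g g'
  ... | tri< lt _ _ = trans (<ᵇ-yes g g' lt) (cong not (sym (<ᵇ-no g' g (ℕP.<⇒≤ lt))))
  ... | tri≈ _ eq _ = ⊥-elim (ne eq)
  ... | tri> _ _ gt = trans (<ᵇ-no g g' (ℕP.<⇒≤ gt)) (cong not (sym (<ᵇ-yes g' g gt)))

admissible : (D : ℕ → Bool) (X : ℕ → ℕ) → Bool → ℕ → List Bool → ℚ
admissible D X x i []       = 1ℚ
admissible D X x i (x' ∷ s) = ind (precedes x (X i) (D i) x' (X (suc i))) *q admissible D X x' (suc i) s

∑-admissible : ∀ D X x i m → ∑ (allSigns m) (admissible D X x i) ≡ count D X x i m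
∑-admissible D X x i zero    = ℚP.+-identityʳ 1ℚ
∑-admissible D X x i (suc m) = trans (∑-allSigns m (admissible D X x i)) (trans (∑-+ (allSigns m) _ _)
  (cong₂ _+q_ (branch true) (trans (branch false) (sym (ℚP.+-identityʳ _)))))
  where
  branch : ∀ x' → ∑ (allSigns m) (λ s → ind (precedes x (X i) (D i) x' (X (suc i))) *q admissible D X x' (suc i) s) ≡
    ind (precedes x (X i) (D i) x' (X (suc i))) *q count D X x' (suc i) m
  branch x' = trans (∑-*ˡ (allSigns m) (ind (precedes x (X i) (D i) x' (X (suc i)))) (admissible D X x' (suc i)))
    (cong (ind (precedes x (X i) (D i) x' (X (suc i))) *q_) (∑-admissible D X x' (suc i) m))

-- K looks signs up by index in the whole vector `s₀`, whereas `admissible` consumes them one by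
-- one. The hypothesis on lookups says that `x ∷ s` is the part of `s₀` from index `i` on, that is,
-- from position `suc i`.
product-admissible : ∀ γ σ w n s₀ i x s → (∀ t → lookupB s₀ (i + t) ≡ lookupB (x ∷ s) t) → suc (i + length s) ≤ n →
  (∀ j → suc j < n → γ (suc j) ≢ γ (suc (suc j))) →
  product (KS-step γ σ w s₀) (suc i) (length s) ≡ admissible (λ i → γ (suc i) <ᵇ γ i) (at w ∘ σ) x (suc i) s
product-admissible γ σ w n s₀ i x []       look b inj = refl
product-admissible γ σ w n s₀ i x (x' ∷ s) look b inj = cong₂ _*q_
  (cong ind (trans (cong₂ (λ y y' → (key y (X i) ≤ᵇ key y' (X (suc i))) ∧ ((key y (X i) ≡ᵇ key y' (X (suc i))) ⇒ᵇ
      (if y then γ (suc i) <ᵇ γ (suc (suc i)) else γ (suc (suc i)) <ᵇ γ (suc i))))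
      (trans (cong (lookupB s₀) (sym (ℕP.+-identityʳ i))) (look 0))
      (trans (cong (lookupB s₀) (ℕP.+-comm 1 i)) (look 1)))
    (step-precedes x (X i) x' (X (suc i)) (γ (suc i)) (γ (suc (suc i))) (inj i (ℕP.≤-trans (s≤s (ℕP.≤-trans (s≤s (ℕP.m≤m+n i (length s))) (ℕP.≤-reflexive (sym (ℕP.+-suc i (length s)))))) b)))))
  (product-admissible γ σ w n s₀ (suc i) x' s (λ t → trans (cong (lookupB s₀) (sym (ℕP.+-suc i t))) (look (suc t)))
    (subst (λ k → suc k ≤ n) (ℕP.+-suc i (length s)) b) inj)
  where
  X : ℕ → ℕ
  X i = at w (σ (suc i))

KS-count : ∀ m γ σ w → T (isPermB (suc m) γ) → length w ≡ suc m →
  KS (suc m) γ σ w ≡ ∑ bothSigns (λ x → count (λ i → γ (suc i) <ᵇ γ i) (at w ∘ σ) x 1 m)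
KS-count m γ σ w t lw = begin
  KS (suc m) γ σ w
    ≡⟨ cong (λ b → if b then ℕtoℚ (countB ok (allSigns (suc m))) else 0ℚ) (≡ᵇ-yes (length w) (suc m) lw) ⟩
  ℕtoℚ (countB ok (allSigns (suc m)))
    ≡⟨ ind-count ok (allSigns (suc m)) ⟩
  ∑ (allSigns (suc m)) (ind ∘ ok)
    ≡⟨ ∑-allSigns m (ind ∘ ok) ⟩
  ∑ (allSigns m) (λ s → ind (ok (true ∷ s)) +q ind (ok (false ∷ s)))
    ≡⟨ ∑-+ (allSigns m) (λ s → ind (ok (true ∷ s))) (λ s → ind (ok (false ∷ s))) ⟩
  ∑ (allSigns m) (λ s → ind (ok (true ∷ s))) +q ∑ (allSigns m) (λ s → ind (ok (false ∷ s)))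
    ≡⟨ cong₂ _+q_ (branch true) (trans (branch false) (sym (ℚP.+-identityʳ _))) ⟩
  ∑ bothSigns (λ x → count D (at w ∘ σ) x 1 m) ∎
  where
  D : ℕ → Bool
  D i = γ (suc i) <ᵇ γ i
  ok : List Bool → Bool
  ok s = all (KS-step γ σ w s) (range1 m)
  inj : ∀ j → suc j < suc m → γ (suc j) ≢ γ (suc (suc j))
  inj j lt e = ℕP.1+n≢n (sym (perm-injective (suc m) γ t (∈-range1 (s≤s z≤n) (ℕP.<⇒≤ lt)) (∈-range1 (s≤s z≤n) lt) e))
  branch : ∀ x → ∑ (allSigns m) (λ s → ind (ok (x ∷ s))) ≡ count D (at w ∘ σ) x 1 m
  branch x = trans (∑-cong-All {P = λ s → length s ≡ m} (allSigns-length m) (λ s ls → trans (ind-all (KS-step γ σ w (x ∷ s)) m)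
      (trans (cong (product (KS-step γ σ w (x ∷ s)) 1) (sym ls))
        (product-admissible γ σ w (suc m) (x ∷ s) 0 x s (λ t → refl) (s≤s (ℕP.≤-reflexive ls)) inj))))
    (∑-admissible D (at w ∘ σ) x 1 m)

termF termK : ThetaTerm → Series
termF t = FS (ThetaTerm.n t) (ThetaTerm.A t) (ThetaTerm.σ t)
termK t = KS (ThetaTerm.n t) (ThetaTerm.γ t) (ThetaTerm.σ t)

euler-0 : ∀ ss w → euler (λ _ → 0ℚ) ss w ≡ 0ℚ
euler-0 []       w       = refl
euler-0 (s ∷ ss) []      = refl
euler-0 (s ∷ ss) (a ∷ w) = trans (cong (λ c → euler (λ _ → c) ss w) (∫-0 (length w) s a)) (euler-0 ss w)

transform-F-off : ∀ n A σ w → length w ≢ n → transform (FS n A σ) w ≡ 0ℚ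
transform-F-off n A σ w ne = trans (transform-cong {FS n A σ} {λ _ → 0ℚ} w (λ u lu → FS-off n A σ u (λ e → ne (trans (sym lu) e))))
  (∑-zero (allSigns (length w)) (λ s → euler-0 s (reverse w)))

KS-off : ∀ n γ σ w → length w ≢ n → KS n γ σ w ≡ 0ℚ
KS-off n γ σ w ne = cong (λ b → if b then ℕtoℚ (countB (λ s → all (KS-step γ σ w s) (range1 (n ∸ 1))) (allSigns n)) else 0ℚ) (≡ᵇ-no (length w) n ne)

peak-bits : ∀ d₁ d₂ a₁ a₂ → (not d₁ ∧ d₂) ⇔ᵇ (a₂ ∧ not (a₁ ∧ true) ∧ true) ≡ true → not a₁ ∧ a₂ ≡ not d₁ ∧ d₂
peak-bits true  d₂    true  a₂    e = refl
peak-bits true  d₂    false true  ()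
peak-bits true  d₂    false false e = refl
peak-bits false true  true  true  ()
peak-bits false true  true  false ()
peak-bits false true  false true  e = refl
peak-bits false true  false false ()
peak-bits false false true  a₂    e = refl
peak-bits false false false true  ()
peak-bits false false false false e = refl

<ᵇ-flip : ∀ x y → x ≢ y → (x <ᵇ y) ≡ not (y <ᵇ x)
<ᵇ-flip x y ne with ℕP.<-cmp x y
... | tri< l _ _ = trans (<ᵇ-yes x y l) (cong not (sym (<ᵇ-no y x (ℕP.<⇒≤ l))))
... | tri> _ _ g = trans (<ᵇ-no x y (ℕP.<⇒≤ g)) (cong not (sym (<ᵇ-yes y x g)))
... | tri≈ _ e _ = ⊥-elim (ne e)

-- As γ is injective, an ascent is the negation of a descent. So a peak of γ and an element of the
-- set prescribed by Θ are both described as `not` the previous bit `∧` the current one. The first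
-- index considered is 2, where the exception made for 1 does not apply.
same-peaks : ∀ m A γ → T (isPermB (suc m) γ) → all (λ i → isPeakB (suc m) γ i ⇔ᵇ thetaSetB A i) (range1 (suc m)) ≡ true →
  ∀ t → suc t < m → not (memB (suc t) A) ∧ memB (suc (suc t)) A ≡ not (γ (suc (suc t)) <ᵇ γ (suc t)) ∧ (γ (suc (suc (suc t))) <ᵇ γ (suc (suc t)))
same-peaks m A γ pγ e t lt = peak-bits (γ (suc (suc t)) <ᵇ γ (suc t)) d₂ (memB (suc t) A) (memB (suc (suc t)) A)
  (subst₂ (λ b up → (b ∧ up ∧ d₂) ⇔ᵇ thetaSetB A (suc (suc t)) ≡ true) (≤ᵇ-yes (suc (suc t)) m lt) asc
    (all-true {p = λ i → isPeakB (suc m) γ i ⇔ᵇ thetaSetB A i} e (∈-range1 (s≤s z≤n) (s≤s (ℕP.<⇒≤ lt)))))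
  where
  d₂ = γ (suc (suc (suc t))) <ᵇ γ (suc (suc t))
  asc : (γ (suc t) <ᵇ γ (suc (suc t))) ≡ not (γ (suc (suc t)) <ᵇ γ (suc t))
  asc = <ᵇ-flip (γ (suc t)) (γ (suc (suc t))) (λ e' → ℕP.1+n≢n (sym (perm-injective (suc m) γ pγ
    (∈-range1 {suc t} {suc m} (s≤s z≤n) (s≤s (ℕP.<⇒≤ (ℕP.<-trans (ℕP.n<1+n t) lt)))) (∈-range1 {suc (suc t)} {suc m} (s≤s z≤n) (s≤s (ℕP.<⇒≤ lt))) e')))

transform-FK-on : ∀ m A σ γ w → T (isPermB (suc m) σ) → T (isPermB (suc m) γ) →
  all (λ i → isPeakB (suc m) γ i ⇔ᵇ thetaSetB A i) (range1 (suc m)) ≡ true → length w ≡ suc m →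
  transform (FS (suc m) A σ) w ≡ KS (suc m) γ σ w
transform-FK-on m A σ γ w pσ pγ e lw = trans (transform-F m A σ w pσ lw) (trans total (sym (KS-count m γ σ w pγ lw)))
  where
  D D' : ℕ → Bool
  D i  = memB i A
  D' i = γ (suc i) <ᵇ γ i
  X = at w ∘ σ
  pair : ∀ p q → p +q (q +q 0ℚ) ≡ p +q q
  pair p q = cong (p +q_) (ℚP.+-identityʳ q)
  total : ∑ bothSigns (λ x → count D X x 1 m) ≡ ∑ bothSigns (λ x → count D' X x 1 m)
  total = trans (pair (count D X true 1 m) (count D X false 1 m)) (trans (samePeaks-total (count-peaks D D' X 1 m (same-peaks m A γ pγ e)))
    (sym (pair (count D' X true 1 m) (count D' X false 1 m))))

transform-FK₀ : ∀ A σ γ w → transform (FS 0 A σ) w ≡ KS 0 γ σ w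
transform-FK₀ A σ γ []      = refl
transform-FK₀ A σ γ (x ∷ w) = trans (transform-F-off 0 A σ (x ∷ w) (λ ())) (sym (KS-off 0 γ σ (x ∷ w) (λ ())))

transform-FK : ∀ t → T (validTermB t) → transform (termF t) ≈ termK t
transform-FK (thetaTerm zero    B σ γ _) v w = transform-FK₀ B σ γ w
transform-FK (thetaTerm (suc m) B σ γ _) v w = by-length (length w ℕP.≟ suc m)
  where
  v₁ = proj₂ (∧-split {subsetB (suc m) B} (T⇒≡ v))
  v₂ = ∧-split {isPermB (suc m) σ} v₁
  v₃ = ∧-split {isPermB (suc m) γ} (proj₂ v₂)
  v₄ = proj₂ (∧-split {all (λ i → (σ (suc i) <ᵇ σ i) ⇒ᵇ memB i B) (range1 m)} (proj₂ v₃))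
  by-length : Dec (length w ≡ suc m) → transform (FS (suc m) B σ) w ≡ KS (suc m) γ σ w
  by-length (yes lw) = transform-FK-on m B σ γ w (≡⇒T (proj₁ v₂)) (≡⇒T (proj₁ v₃)) v₄ lw
  by-length (no ne)  = trans (transform-F-off (suc m) B σ w ne) (sym (KS-off (suc m) γ σ w ne))

transform-sumF : ∀ L → All (λ t → T (validTermB t)) L → transform (sumF L) ≈ sumK L
transform-sumF L vs w = trans (transform-cong {sumF L} {λ u → ∑ L (λ t → (ThetaTerm.coeff t ·S termF t) u)} w (λ u _ → sumF-∑ L u))
  (trans (transform-∑ L (λ t → ThetaTerm.coeff t ·S termF t) w) (trans
    (∑-cong-All vs (λ t v → trans (transform-* (ThetaTerm.coeff t) (termF t) w) (cong (ThetaTerm.coeff t *q_) (transform-FK t v w)))) (sym (sumK-∑ L w))))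
  where
  sumF-∑ : ∀ L u → sumF L u ≡ ∑ L (λ t → ThetaTerm.coeff t *q termF t u)
  sumF-∑ []      u = refl
  sumF-∑ (t ∷ L) u = cong (ThetaTerm.coeff t *q termF t u +q_) (sumF-∑ L u)
  sumK-∑ : ∀ L u → sumK L u ≡ ∑ L (λ t → ThetaTerm.coeff t *q termK t u)
  sumK-∑ []      u = refl
  sumK-∑ (t ∷ L) u = cong (ThetaTerm.coeff t *q termK t u +q_) (sumK-∑ L u)

-- The image depends only on `f`: any two expansions into functions F are sent to the same series.
theta-transform : ∀ {f g} → ThetaRel f g → g ≈ transform f
theta-transform {f} (L , vs , f≈ , g≈) w = trans (g≈ w) (trans (sym (transform-sumF L vs w)) (transform-cong {sumF L} {f} w (λ u _ → sym (f≈ u))))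

-- Power sums

has : ℕ → List ℕ → Bool
has b []      = false
has b (x ∷ a) = (x ≡ᵇ b) ∨ has b a

-- look d b a w is the entry of w at the first position (in reading order) labelled b.
look : A → ℕ → List ℕ → List A → A
look d b (x ∷ a) (v ∷ w) = if has b a then look d b a w else v
look d b _       _       = d

-- A position is compared only with the first position of its block, not with all earlier ones. Then
-- each position carries at most one equality, and integrating it out yields a scalar.
P : List ℕ → List ℕ → ℚ
P []      []      = 1ℚ
P (b ∷ a) (v ∷ w) = P a w *q (if has b a then ind (look 0 b a w ≡ᵇ v) else 1ℚ)
P _       _       = 0ℚ

P-length : ∀ a w → length a ≢ length w → P a w ≡ 0ℚ
P-length []      []      ne = ⊥-elim (ne refl)
P-length []      (v ∷ w) ne = refl
P-length (b ∷ a) []      ne = refl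
P-length (b ∷ a) (v ∷ w) ne = trans (cong (_*q (if has b a then ind (look 0 b a w ≡ᵇ v) else 1ℚ)) (P-length a w (λ e → ne (cong suc e)))) (ℚP.*-zeroˡ (if has b a then ind (look 0 b a w ≡ᵇ v) else 1ℚ))

look-dbl : ∀ b a w → look 0 b a (map dbl w) ≡ dbl (look 0 b a w)
look-dbl b []      w       = refl
look-dbl b (x ∷ a) []      = refl
look-dbl b (x ∷ a) (v ∷ w) with has b a
... | true  = look-dbl b a w
... | false = refl

dbl-≡ᵇ : ∀ x y → (dbl x ≡ᵇ dbl y) ≡ (x ≡ᵇ y)
dbl-≡ᵇ x y = ≡⇔ (λ e → ≡ᵇ-yes x y (let e' = ≡ᵇ-true (dbl x) (dbl y) e in
    ℕP.≤-antisym (dbl-≤⁻ (ℕP.≤-reflexive e')) (dbl-≤⁻ (ℕP.≤-reflexive (sym e')))))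
  (λ e → ≡ᵇ-yes (dbl x) (dbl y) (cong dbl (≡ᵇ-true x y e)))

P-dbl : ∀ a w → P a (map dbl w) ≡ P a w
P-dbl []      []      = refl
P-dbl []      (v ∷ w) = refl
P-dbl (b ∷ a) []      = refl
P-dbl (b ∷ a) (v ∷ w) = cong₂ (λ p q → p *q (if has b a then ind q else 1ℚ)) (P-dbl a w)
  (trans (cong (_≡ᵇ dbl v) (look-dbl b a w)) (dbl-≡ᵇ (look 0 b a w) v))

sgn : Bool → ℚ
sgn true  = 1ℚ
sgn false = -1ℚ

-- By `∫-equal`, the integral of an equality between two positions. It is 1 for equal positive
-- letters, -1 for equal negative letters and 0 otherwise.
sameKey : Bool → ℕ → Bool → ℕ → ℚ
sameKey s' a' s a = ind (precedes s' a' false s a) +q -q ind (precedes s' a' true s a)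

-- Summing over the sign of a later position leaves the sign of the first position of its block as a
-- factor. This is where the power `|B| - 1` of that sign comes from.
sameKey-sum : ∀ s' a' a → sameKey s' a' true a +q sameKey s' a' false a ≡ ind (a' ≡ᵇ a) *q sgn s'
sameKey-sum s' a' a with ℕP.<-cmp a' a
... | tri< lt ne _ rewrite ≡ᵇ-no a' a ne
  | precedes-< s' a' false true a (key-< s' true lt) | precedes-< s' a' true true a (key-< s' true lt)
  | precedes-< s' a' false false a (key-< s' false lt) | precedes-< s' a' true false a (key-< s' false lt) = sym (ℚP.*-zeroˡ (sgn s'))
... | tri> _ ne gt rewrite ≡ᵇ-no a' a ne
  | precedes-> s' a' false true a (key-< true s' gt) | precedes-> s' a' true true a (key-< true s' gt)
  | precedes-> s' a' false false a (key-< false s' gt) | precedes-> s' a' true false a (key-< false s' gt) = sym (ℚP.*-zeroˡ (sgn s'))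
sameKey-sum true a a | tri≈ _ refl _ rewrite ≡ᵇ-refl a
  | precedes-≡ true a false | precedes-≡ true a true
  | precedes-> true a false false a (key-false<true a) | precedes-> true a true false a (key-false<true a) = refl
sameKey-sum false a a | tri≈ _ refl _ rewrite ≡ᵇ-refl a
  | precedes-≡ false a false | precedes-≡ false a true
  | precedes-< false a false true a (key-false<true a) | precedes-< false a true true a (key-false<true a) = refl

signedP : List ℕ → List Bool → List ℕ → ℚ
signedP (b ∷ a) (s ∷ ss) (v ∷ w) = signedP a ss w *q (if has b a then sameKey (look false b a ss) (look 0 b a w) s v else 1ℚ)
signedP _       _        _       = 1ℚ

cells-look : ∀ {k ss w u} b a → Cells k ss w u → length a ≡ length w → has b a ≡ true → InCell k (look false b a ss) (look 0 b a w) (look 0 b a u)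
cells-look b (x ∷ a) (c ∷ cs) l h with has b a in eq
... | true  = cells-look b a cs (ℕP.suc-injective l) eq
... | false = c

euler-P : ∀ a ss w → length a ≡ length w → length ss ≡ length w → euler (P a) ss w ≡ signedP a ss w
euler-P []      []       []      _  _  = refl
euler-P (b ∷ a) (s ∷ ss) (v ∷ w) la ls = begin
  euler (λ u → ∫ (length w) s v (λ z → P (b ∷ a) (z ∷ map dbl u))) ss w
    ≡⟨ euler-cong ss w ls′ integral ⟩
  euler (λ u → κ *q P a u) ss w
    ≡⟨ euler-* ss w κ (P a) ls′ ⟩
  κ *q euler (P a) ss w
    ≡⟨ ℚP.*-comm κ _ ⟩
  euler (P a) ss w *q κ
    ≡⟨ cong (_*q κ) (euler-P a ss w la′ ls′) ⟩
  signedP a ss w *q κ ∎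
  where
  la′ = ℕP.suc-injective la
  ls′ = ℕP.suc-injective ls
  κ = if has b a then sameKey (look false b a ss) (look 0 b a w) s v else 1ℚ
  integral : ∀ u → Cells (length w) ss w u → ∫ (length w) s v (λ z → P (b ∷ a) (z ∷ map dbl u)) ≡ κ *q P a u
  integral u cs = begin
    ∫ (length w) s v (λ z → P a (map dbl u) *q (if has b a then ind (look 0 b a (map dbl u) ≡ᵇ z) else 1ℚ))
      ≡⟨ ∫-* (length w) s v (P a (map dbl u)) (λ z → if has b a then ind (look 0 b a (map dbl u) ≡ᵇ z) else 1ℚ) ⟩
    P a (map dbl u) *q ∫ (length w) s v (λ z → if has b a then ind (look 0 b a (map dbl u) ≡ᵇ z) else 1ℚ)
      ≡⟨ cong₂ _*q_ (P-dbl a u) last ⟩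
    P a u *q κ
      ≡⟨ ℚP.*-comm (P a u) κ ⟩
    κ *q P a u ∎
    where
    last : ∫ (length w) s v (λ z → if has b a then ind (look 0 b a (map dbl u) ≡ᵇ z) else 1ℚ) ≡ κ
    last with has b a in eq
    ... | false = ∫-1 (length w) s v
    ... | true  = trans (∫-cong (length w) s v (λ z _ → cong (λ x → ind (x ≡ᵇ z)) (look-dbl b a u)))
      (∫-equal (length w) s v (look false b a ss) (look 0 b a w) (look 0 b a u) (cells-look b a cs la′ eq))

flip : ℕ → (ℕ → Bool) → ℕ → Bool
flip b g c = if c ≡ᵇ b then not (g c) else g c

flip-here : ∀ b g → flip b g b ≡ not (g b)
flip-here b g = cong (λ x → if x then not (g b) else g b) (≡ᵇ-refl b)

flip-there : ∀ {b c} g → c ≢ b → flip b g c ≡ g c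
flip-there {b} {c} g ne = cong (λ x → if x then not (g c) else g c) (≡ᵇ-no c b ne)

power : Bool → Bool → ℚ
power true  s = sgn s
power false s = 1ℚ

-- The product over the blocks b of (sign of b) ^ (g b).
weight : List ℕ → List Bool → (ℕ → Bool) → ℚ
weight (b ∷ a) (s ∷ ss) g = if has b a then weight a ss g else weight a ss g *q power (g b) s
weight _       _        g = 1ℚ

has-here : ∀ b a → has b (b ∷ a) ≡ true
has-here b a = cong (_∨ has b a) (≡ᵇ-refl b)

has-there : ∀ {b c} a → c ≢ b → has c (b ∷ a) ≡ has c a
has-there {b} {c} a ne = cong (_∨ has c a) (≡ᵇ-no b c (ne ∘ sym))

has-weaken : ∀ b c a → has c a ≡ true → has c (b ∷ a) ≡ true
has-weaken b c a h with b ≡ᵇ c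
... | true  = refl
... | false = h

has-drop : ∀ b c a → has b a ≡ true → has c (b ∷ a) ≡ true → has c a ≡ true
has-drop b c a hb h with b ≡ᵇ c in eq
... | true  rewrite ≡ᵇ-true b c eq = hb
... | false = h

weight-cong : ∀ a ss {g g'} → (∀ c → has c a ≡ true → g c ≡ g' c) → weight a ss g ≡ weight a ss g'
weight-cong []      ss       e = refl
weight-cong (b ∷ a) []       e = refl
weight-cong (b ∷ a) (s ∷ ss) e with has b a
... | true  = weight-cong a ss (λ c h → e c (has-weaken b c a h))
... | false = cong₂ (λ p q → p *q power q s) (weight-cong a ss (λ c h → e c (has-weaken b c a h))) (e b (has-here b a))

true≢false : ∀ {b} → b ≡ true → b ≡ false → ⊥
true≢false refl ()

power-not : ∀ x s → power (not x) s ≡ sgn s *q power x s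
power-not true  true  = refl
power-not true  false = refl
power-not false s     = sym (ℚP.*-identityʳ (sgn s))

weight-flip : ∀ a ss g b → length a ≡ length ss → has b a ≡ true → weight a ss (flip b g) ≡ sgn (look false b a ss) *q weight a ss g
weight-flip (c ∷ a) (s ∷ ss) g b l h with has c a in hc
... | true  = trans (weight-flip a ss g b (ℕP.suc-injective l) hb) (cong (λ x → sgn (if x then look false b a ss else s) *q weight a ss g) (sym hb))
  where hb = has-drop c b a hc h
... | false with b ℕP.≟ c
...   | yes refl rewrite hc = trans (cong₂ _*q_ (weight-cong a ss (λ d hd → flip-there g (λ { refl → true≢false hd hc })))
          (trans (cong (λ x → power x s) (flip-here b g)) (power-not (g b) s)))
        (solve 3 (λ x y z → x :* (y :* z) := y :* (x :* z)) refl (weight a ss g) (sgn s) (power (g b) s))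
...   | no b≢c = trans (cong₂ _*q_ (trans (weight-flip a ss g b (ℕP.suc-injective l) hb) (cong (λ x → sgn (if x then look false b a ss else s) *q weight a ss g) (sym hb)))
          (cong (λ x → power x s) (flip-there g (b≢c ∘ sym))))
        (ℚP.*-assoc (sgn (if has b a then look false b a ss else s)) (weight a ss g) (power (g c) s))
  where hb = trans (sym (has-there a b≢c)) h

evenFactor : Bool → ℚ
evenFactor x = power x true +q power x false

-- The accumulator `g` holds, modulo 2, the number of positions of each block read so far. The first
-- position of a block is met last in the reversed list and contributes `evenFactor`, which is 2 if
-- an even number came before it and 0 otherwise. Started from `noFlip`, odd blocks thus give 2 and
-- even blocks 0.
τ : List ℕ → (ℕ → Bool) → ℚ
τ []      g = 1ℚ
τ (b ∷ a) g = if has b a then τ a (flip b g) else evenFactor (g b) *q τ a g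

-- The `weight` is what makes the induction possible: summing out the sign of a later position
-- produces the sign of the first position of its block, which is summed only at the end, so its
-- exponent has to be carried along.
∑-signedP : ∀ a w g → length a ≡ length w → ∑ (allSigns (length w)) (λ ss → signedP a ss w *q weight a ss g) ≡ τ a g *q P a w
∑-signedP []      []      g _ = refl
∑-signedP (b ∷ a) (v ∷ w) g l with has b a in eq
... | true  = begin
  ∑ (allSigns (suc (length w))) (λ ss → signedP′ ss *q weight′ ss)
    ≡⟨ ∑-allSigns (length w) (λ ss → signedP′ ss *q weight′ ss) ⟩
  ∑ (allSigns (length w)) (λ ss → signedP′ (true ∷ ss) *q weight′ (true ∷ ss) +q signedP′ (false ∷ ss) *q weight′ (false ∷ ss))
    ≡⟨ ∑-cong-All {P = λ s → length s ≡ length w} (allSigns-length (length w)) step ⟩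
  ∑ (allSigns (length w)) (λ ss → i *q (signedP a ss w *q weight a ss (flip b g)))
    ≡⟨ ∑-*ˡ (allSigns (length w)) i _ ⟩
  i *q ∑ (allSigns (length w)) (λ ss → signedP a ss w *q weight a ss (flip b g))
    ≡⟨ cong (i *q_) (∑-signedP a w (flip b g) (ℕP.suc-injective l)) ⟩
  i *q (τ a (flip b g) *q P a w)
    ≡⟨ solve 3 (λ x y z → x :* (y :* z) := y :* (z :* x)) refl i (τ a (flip b g)) (P a w) ⟩
  τ a (flip b g) *q (P a w *q i) ∎
  where
  i = ind (look 0 b a w ≡ᵇ v)
  signedP′ : List Bool → ℚ
  signedP′ ss = signedP (b ∷ a) ss (v ∷ w)
  weight′ : List Bool → ℚ
  weight′ ss = weight (b ∷ a) ss g
  step : ∀ ss → length ss ≡ length w → signedP′ (true ∷ ss) *q weight′ (true ∷ ss) +q signedP′ (false ∷ ss) *q weight′ (false ∷ ss)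
    ≡ i *q (signedP a ss w *q weight a ss (flip b g))
  step ss ls rewrite eq = begin
    (S *q sameKey l' w' true v) *q W +q (S *q sameKey l' w' false v) *q W
      ≡⟨ solve 4 (λ S W x y → (S :* x) :* W :+ (S :* y) :* W := S :* W :* (x :+ y)) refl S W (sameKey l' w' true v) (sameKey l' w' false v) ⟩
    S *q W *q (sameKey l' w' true v +q sameKey l' w' false v)
      ≡⟨ cong (S *q W *q_) (sameKey-sum l' w' v) ⟩
    S *q W *q (i *q sgn l')
      ≡⟨ solve 4 (λ S W i x → S :* W :* (i :* x) := i :* (S :* (x :* W))) refl S W i (sgn l') ⟩
    i *q (S *q (sgn l' *q W))
      ≡⟨ cong (λ x → i *q (S *q x)) (sym (weight-flip a ss g b (trans (ℕP.suc-injective l) (sym ls)) eq)) ⟩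
    i *q (S *q weight a ss (flip b g)) ∎
    where
    S = signedP a ss w
    W = weight a ss g
    l' = look false b a ss
    w' = look 0 b a w
... | false = begin
  ∑ (allSigns (suc (length w))) (λ ss → signedP (b ∷ a) ss (v ∷ w) *q weight (b ∷ a) ss g)
    ≡⟨ ∑-allSigns (length w) (λ ss → signedP (b ∷ a) ss (v ∷ w) *q weight (b ∷ a) ss g) ⟩
  ∑ (allSigns (length w)) (λ ss → signedP (b ∷ a) (true ∷ ss) (v ∷ w) *q weight (b ∷ a) (true ∷ ss) g +q signedP (b ∷ a) (false ∷ ss) (v ∷ w) *q weight (b ∷ a) (false ∷ ss) g)
    ≡⟨ ∑-cong (allSigns (length w)) step ⟩
  ∑ (allSigns (length w)) (λ ss → evenFactor (g b) *q (signedP a ss w *q weight a ss g))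
    ≡⟨ ∑-*ˡ (allSigns (length w)) (evenFactor (g b)) _ ⟩
  evenFactor (g b) *q ∑ (allSigns (length w)) (λ ss → signedP a ss w *q weight a ss g)
    ≡⟨ cong (evenFactor (g b) *q_) (∑-signedP a w g (ℕP.suc-injective l)) ⟩
  evenFactor (g b) *q (τ a g *q P a w)
    ≡⟨ solve 3 (λ x y z → x :* (y :* z) := x :* y :* (z :* con 1ℚ)) refl (evenFactor (g b)) (τ a g) (P a w) ⟩
  evenFactor (g b) *q τ a g *q (P a w *q 1ℚ) ∎
  where
  step : ∀ ss → signedP (b ∷ a) (true ∷ ss) (v ∷ w) *q weight (b ∷ a) (true ∷ ss) g +q signedP (b ∷ a) (false ∷ ss) (v ∷ w) *q weight (b ∷ a) (false ∷ ss) g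
    ≡ evenFactor (g b) *q (signedP a ss w *q weight a ss g)
  step ss rewrite eq = solve 4 (λ S W x y → (S :* con 1ℚ) :* (W :* x) :+ (S :* con 1ℚ) :* (W :* y) := (x :+ y) :* (S :* W)) refl
    (signedP a ss w) (weight a ss g) (power (g b) true) (power (g b) false)

weight-trivial : ∀ a ss → weight a ss (λ _ → false) ≡ 1ℚ
weight-trivial []      ss       = refl
weight-trivial (b ∷ a) []       = refl
weight-trivial (b ∷ a) (s ∷ ss) with has b a
... | true  = weight-trivial a ss
... | false = trans (ℚP.*-identityʳ _) (weight-trivial a ss)

noFlip : ℕ → Bool
noFlip _ = false

transform-P : ∀ a w → transform (P a ∘ reverse) w ≡ τ a noFlip *q P a (reverse w)
transform-P a w with length a ℕP.≟ length w
... | yes e = begin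
  ∑ (allSigns (length w)) (λ ss → euler (P a ∘ reverse ∘ reverse) ss u)
    ≡⟨ ∑-cong-All {P = λ s → length s ≡ length u} (sign-lengths w) (λ ss ls → trans
         (euler-cong ss u ls (λ v _ → cong (P a) (reverse-involutive v))) (trans (euler-P a ss u (trans e (sym lu)) ls)
         (trans (sym (ℚP.*-identityʳ _)) (cong (signedP a ss u *q_) (sym (weight-trivial a ss)))))) ⟩
  ∑ (allSigns (length w)) (λ ss → signedP a ss u *q weight a ss noFlip)
    ≡⟨ cong (λ n → ∑ (allSigns n) (λ ss → signedP a ss u *q weight a ss noFlip)) (sym lu) ⟩
  ∑ (allSigns (length u)) (λ ss → signedP a ss u *q weight a ss noFlip)
    ≡⟨ ∑-signedP a u noFlip (trans e (sym lu)) ⟩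
  τ a noFlip *q P a u ∎
  where
  u = reverse w
  lu : length u ≡ length w
  lu = length-reverse w
... | no ne = trans (transform-cong {P a ∘ reverse} {0ℚ ·S (P a ∘ reverse)} w
      (λ u lu → trans (P-length a (reverse u) (λ e → ne (trans e (trans (length-reverse u) lu)))) (sym (ℚP.*-zeroˡ (P a (reverse u))))))
  (trans (transform-* 0ℚ (P a ∘ reverse) w) (trans (ℚP.*-zeroˡ (transform (P a ∘ reverse) w))
    (sym (trans (cong (τ a noFlip *q_) (P-length a (reverse w) (λ e → ne (trans e (length-reverse w))))) (ℚP.*-zeroʳ (τ a noFlip))))))

-- Parity of the blocks

odd? : ℕ → List ℕ → Bool
odd? b []      = false
odd? b (x ∷ a) = if x ≡ᵇ b then not (odd? b a) else odd? b a

odd?-here : ∀ b a → odd? b (b ∷ a) ≡ not (odd? b a)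
odd?-here b a = cong (λ x → if x then not (odd? b a) else odd? b a) (≡ᵇ-refl b)

odd?-there : ∀ {b c} a → c ≢ b → odd? c (b ∷ a) ≡ odd? c a
odd?-there {b} {c} a ne = cong (λ x → if x then not (odd? c a) else odd? c a) (≡ᵇ-no b c (ne ∘ sym))

odd?-absent : ∀ b a → has b a ≡ false → odd? b a ≡ false
odd?-absent b []      h = refl
odd?-absent b (x ∷ a) h with x ≡ᵇ b
... | false = odd?-absent b a h

xor-not : ∀ x y → not x xor y ≡ x xor not y
xor-not true  true  = refl
xor-not true  false = refl
xor-not false true  = refl
xor-not false false = refl

odd?-flip : ∀ b c a g → odd? c (b ∷ a) xor g c ≡ odd? c a xor flip b g c
odd?-flip b c a g with c ℕP.≟ b
... | yes refl = trans (cong (_xor g c) (odd?-here c a)) (trans (xor-not (odd? c a) (g c)) (cong (odd? c a xor_) (sym (flip-here c g))))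
... | no ne    = cong₂ _xor_ (odd?-there a ne) (sym (flip-there g ne))

τ-odd : ∀ a g → (∀ b → has b a ≡ true → odd? b a xor g b ≡ true) → τ a g ≢ 0ℚ
τ-odd []      g h = λ ()
τ-odd (b ∷ a) g h with has b a in eq
... | true  = τ-odd a (flip b g) (λ c hc → trans (sym (odd?-flip b c a g)) (h c (has-weaken b c a hc)))
... | false = *≢0 factor (τ-odd a g (λ c hc → trans (cong (_xor g c) (sym (odd?-there {b} {c} a (λ { refl → true≢false hc eq })))) (h c (has-weaken b c a hc))))
  where
  gb : g b ≡ false
  gb with g b | trans (cong (_xor g b) (sym (trans (odd?-here b a) (cong not (odd?-absent b a eq))))) (h b (has-here b a))
  ... | false | _ = refl
  factor : evenFactor (g b) ≢ 0ℚ
  factor rewrite gb = λ ()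

τ-even : ∀ a g b → has b a ≡ true → odd? b a xor g b ≡ false → τ a g ≡ 0ℚ
τ-even (c ∷ a) g b h e with has c a in eq
... | true  = τ-even a (flip c g) b (has-drop c b a eq h) (trans (sym (odd?-flip c b a g)) e)
... | false with b ℕP.≟ c
...   | no b≢c   = trans (cong (evenFactor (g c) *q_) (τ-even a g b (trans (sym (has-there a b≢c)) h) (trans (cong (_xor g b) (sym (odd?-there {c} {b} a b≢c))) e))) (ℚP.*-zeroʳ (evenFactor (g c)))
...   | yes refl = trans (cong (_*q τ a g) (cong evenFactor gb)) (ℚP.*-zeroˡ (τ a g))
  where
  gb : g b ≡ true
  gb with g b | trans (cong (_xor g b) (sym (trans (odd?-here b a) (cong not (odd?-absent b a eq))))) e
  ... | true | _ = refl

-- The sign of a permutation whose cycles are the blocks: -1 for each position that is not the first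
-- of its block.
ε : List ℕ → ℚ
ε []      = 1ℚ
ε (b ∷ a) = if has b a then -1ℚ *q ε a else ε a

negatives : List ℕ → List Bool
negatives = map (λ _ → false)

look-negatives : ∀ b a c → look false b a (negatives c) ≡ false
look-negatives b []      c       = refl
look-negatives b (x ∷ a) []      = refl
look-negatives b (x ∷ a) (y ∷ c) with has b a
... | true  = look-negatives b a c
... | false = refl

-- With all signs negative, every toggle of the accumulator changes the weight by -1, just as `ε`
-- changes. Where `τ a g` is nonzero, the accumulator is even when a block is completed, so no
-- further sign appears. Taking `noFlip` for `g`, whose weight is 1, gives `τ-ε`.
ε-weight : ∀ a g → τ a g ≢ 0ℚ → ε a ≡ weight a (negatives a) g
ε-weight []      g _ = refl
ε-weight (b ∷ a) g ne with has b a in eq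
... | true  = trans (cong (-1ℚ *q_) (trans (ε-weight a (flip b g) ne) (trans (weight-flip a (negatives a) g b (sym (length-map _ a)) eq)
        (cong (λ s → sgn s *q weight a (negatives a) g) (look-negatives b a a)))))
      (solve 1 (λ x → con -1ℚ :* (con -1ℚ :* x) := x) refl (weight a (negatives a) g))
... | false = trans (ε-weight a g (λ e → ne (trans (cong (evenFactor (g b) *q_) e) (ℚP.*-zeroʳ (evenFactor (g b))))))
      (sym (trans (cong (λ x → weight a (negatives a) g *q power x false) gb) (ℚP.*-identityʳ _)))
  where
  gb : g b ≡ false
  gb with g b
  ... | false = refl
  ... | true  = ⊥-elim (ne (ℚP.*-zeroˡ (τ a g)))

τ-ε : ∀ a → τ a noFlip ≢ 0ℚ → ε a ≡ 1ℚ
τ-ε a ne = trans (ε-weight a noFlip ne) (weight-trivial a (negatives a))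

-- Restricted growth strings and the expansions of h and e in power sums

nb : List ℕ → ℕ
nb = foldr (λ a m → suc a ⊔ m) 0

data RG : List ℕ → Set where
  []  : RG []
  _∷_ : ∀ {b a} → b ≤ nb a → RG a → RG (b ∷ a)

has-< : ∀ b a → has b a ≡ true → b < nb a
has-< b (x ∷ a) h with x ≡ᵇ b in eq
... | true  rewrite ≡ᵇ-true x b eq = ℕP.m≤m⊔n (suc b) (nb a)
... | false = ℕP.≤-trans (has-< b a h) (ℕP.m≤n⊔m (suc x) (nb a))

has-new : ∀ a → has (nb a) a ≡ false
has-new a with has (nb a) a in eq
... | false = refl
... | true  = ⊥-elim (ℕP.n≮n (nb a) (has-< (nb a) a eq))

nb-new : ∀ a → nb (nb a ∷ a) ≡ suc (nb a)
nb-new a = ℕP.m≥n⇒m⊔n≡m (ℕP.n≤1+n (nb a))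

nb-old : ∀ {b} a → b < nb a → nb (b ∷ a) ≡ nb a
nb-old a lt = ℕP.m≤n⇒m⊔n≡n lt

RG-has : ∀ {a b} → RG a → b < nb a → has b a ≡ true
RG-has {x ∷ a} {b} (x≤ ∷ r) lt with x ℕP.≟ b
... | yes refl = has-here x a
... | no ne with ℕP.m≤n⇒m<n∨m≡n x≤
...   | inj₁ x<   = trans (has-there a (ne ∘ sym)) (RG-has r (subst (b <_) (nb-old a x<) lt))
...   | inj₂ refl = trans (has-there a (ne ∘ sym)) (RG-has r (ℕP.≤∧≢⇒< (ℕP.≤-pred (subst (b <_) (nb-new a) lt)) (ne ∘ sym)))

nb≤length : ∀ {a} → RG a → nb a ≤ length a
nb≤length []                = z≤n
nb≤length {x ∷ a} (x≤ ∷ r) = ℕP.⊔-lub (s≤s (ℕP.≤-trans x≤ (nb≤length r))) (ℕP.m≤n⇒m≤1+n (nb≤length r))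

-- Indices count from the head of the reversed word.
indices : ℕ → List ℕ → List ℕ
indices b []      = []
indices b (x ∷ a) = if x ≡ᵇ b then 0 ∷ map suc (indices b a) else map suc (indices b a)

IndexOf : ℕ → List ℕ → ℕ → Set
IndexOf b a i = (i < length a) × (lookupD a i ≡ b)

All-map : ∀ {Q : A → Set} {R : B → Set} {f xs} → (∀ x → Q x → R (f x)) → All Q xs → All R (map f xs)
All-map h []       = []
All-map h (p ∷ ps) = h _ p ∷ All-map h ps

All-concatMap : ∀ {Q : A → Set} {R : B → Set} {f : A → List B} {xs} → (∀ x → Q x → All R (f x)) → All Q xs → All R (concatMap f xs)
All-concatMap h []       = []
All-concatMap h (p ∷ ps) = AllP.++⁺ (h _ p) (All-concatMap h ps)

indices-sound : ∀ b a → All (IndexOf b a) (indices b a)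
indices-sound b []      = []
indices-sound b (x ∷ a) with x ≡ᵇ b in eq
... | true  = (s≤s z≤n , ≡ᵇ-true x b eq) ∷ All-map (λ i p → s≤s (proj₁ p) , proj₂ p) (indices-sound b a)
... | false = All-map (λ i p → s≤s (proj₁ p) , proj₂ p) (indices-sound b a)

indices-absent : ∀ b a → has b a ≡ false → indices b a ≡ []
indices-absent b []      h = refl
indices-absent b (x ∷ a) h with x ≡ᵇ b
... | false = cong (map suc) (indices-absent b a h)

indices-present : ∀ b a → has b a ≡ true → Σ ℕ λ i → i ∈ indices b a
indices-present b (x ∷ a) h with x ≡ᵇ b
... | true  = 0 , here refl
... | false with indices-present b a h
...   | i , m = suc i , ∈-map⁺ suc m

has-lookup : ∀ a i → i < length a → has (lookupD a i) a ≡ true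
has-lookup (x ∷ a) zero    lt       = has-here x a
has-lookup (x ∷ a) (suc i) (s≤s lt) = has-weaken x (lookupD a i) a (has-lookup a i lt)

-- Either the word already violates a block condition, or all positions of a block carry the letter
-- of the first. Hence a new position attached to the block may be compared with any of its
-- positions, as in `P-attach`.
P-look : ∀ ρ w i → i < length ρ → length ρ ≡ length w → (P ρ w ≡ 0ℚ) ⊎ (look 0 (lookupD ρ i) ρ w ≡ lookupD w i)
P-look (b ∷ ρ) (v ∷ w) zero lt l with has b ρ in eq
... | false = inj₂ refl
... | true with look 0 b ρ w ≡ᵇ v in e
...   | true  = inj₂ (≡ᵇ-true (look 0 b ρ w) v e)
...   | false = inj₁ (ℚP.*-zeroʳ (P ρ w))
P-look (b ∷ ρ) (v ∷ w) (suc i) (s≤s lt) l with P-look ρ w i lt (ℕP.suc-injective l)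
... | inj₁ z = inj₁ (trans (cong (_*q (if has b ρ then ind (look 0 b ρ w ≡ᵇ v) else 1ℚ)) z) (ℚP.*-zeroˡ (if has b ρ then ind (look 0 b ρ w ≡ᵇ v) else 1ℚ)))
... | inj₂ e rewrite has-lookup ρ i lt = inj₂ e

P-attach : ∀ ρ v w i → i < length ρ → P (lookupD ρ i ∷ ρ) (v ∷ w) ≡ P ρ w *q ind (lookupD w i ≡ᵇ v)
P-attach ρ v w i lt rewrite has-lookup ρ i lt with length ρ ℕP.≟ length w
... | no ne = trans (zero* (ind (look 0 (lookupD ρ i) ρ w ≡ᵇ v))) (sym (zero* (ind (lookupD w i ≡ᵇ v))))
  where
  zero* : ∀ x → P ρ w *q x ≡ 0ℚ
  zero* x = trans (cong (_*q x) (P-length ρ w ne)) (ℚP.*-zeroˡ x)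
... | yes l with P-look ρ w i lt l
...   | inj₁ z = trans (zero* (ind (look 0 (lookupD ρ i) ρ w ≡ᵇ v))) (sym (zero* (ind (lookupD w i ≡ᵇ v))))
  where
  zero* : ∀ x → P ρ w *q x ≡ 0ℚ
  zero* x = trans (cong (_*q x) z) (ℚP.*-zeroˡ x)
...   | inj₂ e = cong (λ x → P ρ w *q ind (x ≡ᵇ v)) e

P-new : ∀ ρ v w → P (nb ρ ∷ ρ) (v ∷ w) ≡ P ρ w
P-new ρ v w rewrite has-new ρ = ℚP.*-identityʳ (P ρ w)

matches : List ℕ → List ℕ → ℕ → ℚ
matches J w v = ∑ J (λ i → ind (lookupD w i ≡ᵇ v))

-- Appending a position multiplies h by 1 plus the number of earlier positions of its block with the
-- same letter, which builds up the factorials. In e that number is subtracted from 1: as long as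
-- the earlier letters of the block are distinct it is 0 or 1, and the factor tests whether they
-- stay distinct.
H E : List ℕ → List ℕ → ℚ
H []      []      = 1ℚ
H (b ∷ a) (v ∷ w) = H a w *q (1ℚ +q matches (indices b a) w v)
H _       _       = 0ℚ
E []      []      = 1ℚ
E (b ∷ a) (v ∷ w) = E a w *q (1ℚ +q -1ℚ *q matches (indices b a) w v)
E _       _       = 0ℚ

attach : List ℕ → ℕ → List ℕ
attach ρ i = lookupD ρ i ∷ ρ

extend : List ℕ → List ℕ → List (List ℕ)
extend J ρ = (nb ρ ∷ ρ) ∷ map (attach ρ) J

-- Set partitions arising from permutations that preserve the blocks of a, one for each such permutation
-- (its cycle partition): a new position opens a cycle or is inserted after an earlier one of its block.
expand : List ℕ → List (List ℕ)
expand []      = [ [] ]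
expand (b ∷ a) = concatMap (extend (indices b a)) (expand a)

-- Of the refinement only what triangularity uses is kept: `ρ` is `a` itself or has more blocks.
Refines : List ℕ → List ℕ → Set
Refines a ρ = RG ρ × (length ρ ≡ length a) × ((ρ ≡ a) ⊎ (nb a < nb ρ))

RG-attach : ∀ {ρ} i → RG ρ → i < length ρ → RG (attach ρ i) × (nb (attach ρ i) ≡ nb ρ)
RG-attach {ρ} i r lt = ℕP.<⇒≤ b< ∷ r , nb-old ρ b<
  where b< = has-< (lookupD ρ i) ρ (has-lookup ρ i lt)

RG-new : ∀ {ρ} → RG ρ → RG (nb ρ ∷ ρ)
RG-new r = ℕP.≤-refl ∷ r

expand-refines : ∀ {a} → RG a → All (Refines a) (expand a)
expand-refines []                 = ([] , refl , inj₁ refl) ∷ []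
expand-refines {b ∷ a} (b≤ ∷ r) = All-concatMap step (expand-refines r)
  where
  attached : ∀ ρ → Refines a ρ → b < nb a → ∀ {J} → All (IndexOf b a) J → All (Refines (b ∷ a)) (map (attach ρ) J)
  attached ρ R b< []                             = []
  attached ρ R@(rρ , lρ , c) b< {i ∷ J} ((i< , e) ∷ ps) = (proj₁ RA , cong suc lρ , finer c) ∷ attached ρ R b< ps
    where
    RA = RG-attach i rρ (subst (i <_) (sym lρ) i<)
    finer : (ρ ≡ a) ⊎ (nb a < nb ρ) → (attach ρ i ≡ b ∷ a) ⊎ (nb (b ∷ a) < nb (attach ρ i))
    finer (inj₁ refl) = inj₁ (cong (_∷ ρ) e)
    finer (inj₂ lt)   = inj₂ (subst₂ _<_ (sym (nb-old a b<)) (sym (proj₂ RA)) lt)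
  step : ∀ ρ → Refines a ρ → All (Refines (b ∷ a)) (extend (indices b a) ρ)
  step ρ R@(rρ , lρ , c) with ℕP.m≤n⇒m<n∨m≡n b≤
  ... | inj₁ b<   = (RG-new rρ , cong suc lρ , inj₂ (subst₂ _<_ (sym (nb-old a b<)) (sym (nb-new ρ)) (s≤s (coarser c))))
                    ∷ attached ρ R b< (indices-sound b a)
    where
    coarser : (ρ ≡ a) ⊎ (nb a < nb ρ) → nb a ≤ nb ρ
    coarser (inj₁ refl) = ℕP.≤-refl
    coarser (inj₂ lt)   = ℕP.<⇒≤ lt
  -- A label occurring for the first time has no earlier position to be inserted after, so opening a
  -- cycle is the only choice.
  ... | inj₂ refl rewrite indices-absent (nb a) a (has-new a) = (RG-new rρ , cong suc lρ , finer c) ∷ []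
    where
    finer : (ρ ≡ a) ⊎ (nb a < nb ρ) → (nb ρ ∷ ρ ≡ nb a ∷ a) ⊎ (nb (nb a ∷ a) < nb (nb ρ ∷ ρ))
    finer (inj₁ refl) = inj₁ refl
    finer (inj₂ lt)   = inj₂ (subst₂ _<_ (sym (nb-new a)) (sym (nb-new ρ)) (s≤s lt))

∈-concatMap : ∀ {f : A → List B} {x y} xs → x ∈ xs → y ∈ f x → y ∈ concatMap f xs
∈-concatMap {f = f} (x ∷ xs) (here refl) h = ∈-++⁺ˡ h
∈-concatMap {f = f} (z ∷ xs) (there i)   h = ∈-++⁺ʳ (f z) (∈-concatMap xs i h)

lookup-All : ∀ {Q : A → Set} {xs x} → All Q xs → x ∈ xs → Q x
lookup-All (p ∷ ps) (here refl) = p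
lookup-All (p ∷ ps) (there i)   = lookup-All ps i

-- Some permutation has exactly the blocks as its cycles: insert each position after an earlier one
-- of its block whenever there is one. It provides the nonzero diagonal coefficient.
expand-self : ∀ {a} → RG a → a ∈ expand a
expand-self []                 = here refl
expand-self {b ∷ a} (b≤ ∷ r) = ∈-concatMap (expand a) (expand-self r) inside
  where
  inside : b ∷ a ∈ extend (indices b a) a
  inside with ℕP.m≤n⇒m<n∨m≡n b≤
  ... | inj₂ refl = here refl
  ... | inj₁ b< with indices-present b a (RG-has r b<)
  ...   | i , m = there (subst (λ c → c ∷ a ∈ map (attach a) (indices b a)) (proj₂ (lookup-All (indices-sound b a) m)) (∈-map⁺ (attach a) m))

expand-length : ∀ a → All (λ ρ → length ρ ≡ length a) (expand a)
expand-length []      = refl ∷ []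
expand-length (b ∷ a) = All-concatMap (λ ρ l → cong suc l ∷ All-map {Q = λ _ → ⊤} (λ i _ → cong suc l) (trivial (indices b a))) (expand-length a)
  where
  trivial : ∀ (xs : List ℕ) → All (λ _ → ⊤) xs
  trivial []       = []
  trivial (x ∷ xs) = tt ∷ trivial xs

-- c is 1 for complete homogeneous and -1 for elementary functions
∑-expand : ∀ (t : List ℕ → ℚ) c (X : List ℕ → List ℕ → ℚ) →
  (∀ ρ → t (nb ρ ∷ ρ) ≡ t ρ) → (∀ ρ i → i < length ρ → t (attach ρ i) ≡ c *q t ρ) →
  t [] *q 1ℚ ≡ X [] [] → (∀ v w → X [] (v ∷ w) ≡ 0ℚ) → (∀ b a → X (b ∷ a) [] ≡ 0ℚ) →
  (∀ b a v w → X (b ∷ a) (v ∷ w) ≡ X a w *q (1ℚ +q c *q matches (indices b a) w v)) →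
  ∀ a w → ∑ (expand a) (λ ρ → t ρ *q P ρ w) ≡ X a w
∑-expand t c X new old nil nilˡ nilʳ cons = go
  where
  go : ∀ a w → ∑ (expand a) (λ ρ → t ρ *q P ρ w) ≡ X a w
  go []      []      = trans (ℚP.+-identityʳ _) nil
  go []      (v ∷ w) = trans (trans (ℚP.+-identityʳ _) (ℚP.*-zeroʳ (t []))) (sym (nilˡ v w))
  go (b ∷ a) []      = trans (∑-cong-All (expand-length (b ∷ a)) (λ ρ l → trans (cong (t ρ *q_) (P-length ρ [] (λ e → case trans (sym l) e of λ ()))) (ℚP.*-zeroʳ (t ρ))))
                        (trans (∑-0 (expand (b ∷ a))) (sym (nilʳ b a)))
  go (b ∷ a) (v ∷ w) = begin
    ∑ (concatMap (extend J) (expand a)) (λ ρ → t ρ *q P ρ (v ∷ w))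
      ≡⟨ ∑-concatMap (extend J) (expand a) _ ⟩
    ∑ (expand a) (λ ρ → ∑ (extend J ρ) (λ ρ → t ρ *q P ρ (v ∷ w)))
      ≡⟨ ∑-cong-All (expand-length a) one ⟩
    ∑ (expand a) (λ ρ → t ρ *q P ρ w *q (1ℚ +q c *q matches J w v))
      ≡⟨ ∑-*ʳ (expand a) (1ℚ +q c *q matches J w v) (λ ρ → t ρ *q P ρ w) ⟩
    ∑ (expand a) (λ ρ → t ρ *q P ρ w) *q (1ℚ +q c *q matches J w v)
      ≡⟨ cong (_*q (1ℚ +q c *q matches J w v)) (go a w) ⟩
    X a w *q (1ℚ +q c *q matches J w v)
      ≡⟨ sym (cons b a v w) ⟩
    X (b ∷ a) (v ∷ w) ∎
    where
    J = indices b a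
    one : ∀ ρ → length ρ ≡ length a → ∑ (extend J ρ) (λ ρ → t ρ *q P ρ (v ∷ w)) ≡ t ρ *q P ρ w *q (1ℚ +q c *q matches J w v)
    one ρ l = begin
      t (nb ρ ∷ ρ) *q P (nb ρ ∷ ρ) (v ∷ w) +q ∑ (map (attach ρ) J) (λ ρ → t ρ *q P ρ (v ∷ w))
        ≡⟨ cong₂ _+q_ (cong₂ _*q_ (new ρ) (P-new ρ v w)) (∑-map (attach ρ) J _) ⟩
      t ρ *q P ρ w +q ∑ J (λ i → t (attach ρ i) *q P (attach ρ i) (v ∷ w))
        ≡⟨ cong (t ρ *q P ρ w +q_) (∑-cong-All (indices-sound b a) (λ i p → cong₂ _*q_ (old ρ i (subst (i <_) (sym l) (proj₁ p))) (P-attach ρ v w i (subst (i <_) (sym l) (proj₁ p))))) ⟩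
      t ρ *q P ρ w +q ∑ J (λ i → c *q t ρ *q (P ρ w *q ind (lookupD w i ≡ᵇ v)))
        ≡⟨ cong (t ρ *q P ρ w +q_) (trans (∑-cong J (λ i → sym (ℚP.*-assoc (c *q t ρ) (P ρ w) (ind (lookupD w i ≡ᵇ v))))) (∑-*ˡ J (c *q t ρ *q P ρ w) (λ i → ind (lookupD w i ≡ᵇ v)))) ⟩
      t ρ *q P ρ w +q c *q t ρ *q P ρ w *q matches J w v
        ≡⟨ solve 4 (λ t p c m → t :* p :+ c :* t :* p :* m := t :* p :* (con 1ℚ :+ c :* m)) refl (t ρ) (P ρ w) c (matches J w v) ⟩
      t ρ *q P ρ w *q (1ℚ +q c *q matches J w v) ∎

H-expand : ∀ a w → ∑ (expand a) (λ ρ → 1ℚ *q P ρ w) ≡ H a w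
H-expand = ∑-expand (λ _ → 1ℚ) 1ℚ H (λ _ → refl) (λ _ _ _ → refl) refl (λ _ _ → refl) (λ _ _ → refl)
  (λ b a v w → cong (λ m → H a w *q (1ℚ +q m)) (sym (ℚP.*-identityˡ (matches (indices b a) w v))))

E-expand : ∀ a w → ∑ (expand a) (λ ρ → ε ρ *q P ρ w) ≡ E a w
E-expand = ∑-expand ε -1ℚ E (λ ρ → cong (λ b → if b then -1ℚ *q ε ρ else ε ρ) (has-new ρ))
  (λ ρ i lt → cong (λ b → if b then -1ℚ *q ε ρ else ε ρ) (has-lookup ρ i lt)) refl (λ _ _ → refl) (λ _ _ → refl) (λ _ _ _ _ → refl)

-- The bases of the statement on reversed words

nb-∷ʳ : ∀ xs x → nb (xs ∷ʳ x) ≡ nb (x ∷ xs)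
nb-∷ʳ []       x = refl
nb-∷ʳ (y ∷ xs) x = trans (cong (suc y ⊔_) (nb-∷ʳ xs x)) (trans (sym (ℕP.⊔-assoc (suc y) (suc x) (nb xs)))
  (trans (cong (_⊔ nb xs) (ℕP.⊔-comm (suc y) (suc x))) (ℕP.⊔-assoc (suc x) (suc y) (nb xs))))

nb-reverse : ∀ a → nb (reverse a) ≡ nb a
nb-reverse []      = refl
nb-reverse (b ∷ a) = trans (cong nb (unfold-reverse b a)) (trans (nb-∷ʳ (reverse a) b) (cong (suc b ⊔_) (nb-reverse a)))

∧-assoc : ∀ a b c → (a ∧ b) ∧ c ≡ a ∧ (b ∧ c)
∧-assoc true  b c = refl
∧-assoc false b c = refl

rgsFrom-∷ʳ : ∀ m xs x → rgsFrom m (xs ∷ʳ x) ≡ rgsFrom m xs ∧ (x ≤ᵇ m ⊔ nb xs)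
rgsFrom-∷ʳ m []       x = trans (∧-comm (x ≤ᵇ m) true) (cong (x ≤ᵇ_) (sym (ℕP.⊔-identityʳ m)))
rgsFrom-∷ʳ m (y ∷ xs) x = trans (cong ((y ≤ᵇ m) ∧_) (rgsFrom-∷ʳ (m ⊔ suc y) xs x))
  (trans (sym (∧-assoc (y ≤ᵇ m) (rgsFrom (m ⊔ suc y) xs) (x ≤ᵇ m ⊔ suc y ⊔ nb xs)))
    (cong (λ k → ((y ≤ᵇ m) ∧ rgsFrom (m ⊔ suc y) xs) ∧ (x ≤ᵇ k)) (ℕP.⊔-assoc m (suc y) (nb xs))))

isRGS-reverse : ∀ b a → isRGS (reverse (b ∷ a)) ≡ isRGS (reverse a) ∧ (b ≤ᵇ nb a)
isRGS-reverse b a = trans (cong isRGS (unfold-reverse b a)) (trans (rgsFrom-∷ʳ 0 (reverse a) b) (cong (λ k → isRGS (reverse a) ∧ (b ≤ᵇ k)) (nb-reverse a)))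

RG⇒isRGS : ∀ {a} → RG a → isRGS (reverse a) ≡ true
RG⇒isRGS []                = refl
RG⇒isRGS {b ∷ a} (b≤ ∷ r) = trans (isRGS-reverse b a) (cong₂ _∧_ (RG⇒isRGS r) (≤ᵇ-yes b (nb a) b≤))

isRGS⇒RG : ∀ a → isRGS (reverse a) ≡ true → RG a
isRGS⇒RG []      e = []
isRGS⇒RG (b ∷ a) e with ∧-split {isRGS (reverse a)} (trans (sym (isRGS-reverse b a)) e)
... | p , q = ≤ᵇ-true b (nb a) q ∷ isRGS⇒RG a p

rev : SetPartition → List ℕ
rev π = reverse (proj₁ π)

rev-RG : ∀ π → RG (rev π)
rev-RG (l , t) = isRGS⇒RG (reverse l) (trans (cong isRGS (reverse-involutive l)) (T⇒≡ t))

partition : ∀ {a} → RG a → SetPartition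
partition {a} r = reverse a , ≡⇒T (RG⇒isRGS r)

rev-partition : ∀ {a} (r : RG a) → rev (partition r) ≡ a
rev-partition {a} r = reverse-involutive a

SP-≡ : ∀ {π π' : SetPartition} → proj₁ π ≡ proj₁ π' → π ≡ π'
SP-≡ {l , t} {_ , t'} refl = cong (l ,_) (T-irr t t')

rev-injective : ∀ {π π'} → rev π ≡ rev π' → π ≡ π'
rev-injective {π} {π'} e = SP-≡ (trans (sym (reverse-involutive (proj₁ π))) (trans (cong reverse e) (reverse-involutive (proj₁ π'))))

-- Coefficients defined by conditions on pairs of positions

zall : (ℕ → ℕ → Bool) → List ℕ → List ℕ → Bool
zall f (x ∷ a) (y ∷ w) = f x y ∧ zall f a w
zall f _       _       = true

pairwise : (Bool → Bool → Bool) → List ℕ → List ℕ → Bool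
pairwise R []      []      = true
pairwise R (b ∷ a) (v ∷ w) = pairwise R a w ∧ zall (λ x y → R (x ≡ᵇ b) (y ≡ᵇ v)) a w
pairwise R _       _       = false

at-reverse-below : ∀ z u {j} → InRange (length u) j → at (reverse (z ∷ u)) j ≡ at (reverse u) j
at-reverse-below z u {j} (1≤j , j≤) = trans (at-reverse (z ∷ u) (1≤j , ℕP.m≤n⇒m≤1+n j≤)) (trans (lk-below 0 z u refl j≤) (sym (at-reverse u (1≤j , j≤))))

at-reverse-top : ∀ z u → at (reverse (z ∷ u)) (suc (length u)) ≡ z
at-reverse-top z u = trans (at-reverse (z ∷ u) (s≤s z≤n , ℕP.≤-refl)) (lk-top 0 z u refl)

zall-range : ∀ f a w → length a ≡ length w → all (λ j → f (at (reverse a) j) (at (reverse w) j)) (range1 (length a)) ≡ zall f a w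
zall-range f []      []      l = refl
zall-range f (x ∷ a) (y ∷ w) l = trans (all-range-suc _ (length a)) (trans
  (cong₂ _∧_ (trans (all-range-cong (length a) (λ j 1≤j j≤ → cong₂ f (at-reverse-below x a (1≤j , j≤)) (at-reverse-below y w (1≤j , subst (j ≤_) l′ j≤))))
      (zall-range f a w l′))
    (cong₂ f (at-reverse-top x a) (trans (cong (at (reverse (y ∷ w))) (cong suc l′)) (at-reverse-top y w))))
  (∧-comm (zall f a w) (f x y)))
  where l′ = ℕP.suc-injective l

allPairs-suc : ∀ n Q → (∀ j k → Q j k ≡ Q k j) → Q (suc n) (suc n) ≡ true → allPairs (suc n) Q ≡ allPairs n Q ∧ all (λ j → Q j (suc n)) (range1 n)
allPairs-suc n Q symmetric diagonal = begin
  allPairs (suc n) Q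
    ≡⟨ all-range-suc (λ j → all (Q j) (range1 (suc n))) n ⟩
  all (λ j → all (Q j) (range1 (suc n))) (range1 n) ∧ all (Q (suc n)) (range1 (suc n))
    ≡⟨ cong₂ _∧_ (trans (all-range-cong n (λ j _ _ → all-range-suc (Q j) n)) (all-∧ (λ j → all (Q j) (range1 n)) (λ j → Q j (suc n)) (range1 n)))
         (trans (all-range-suc (Q (suc n)) n) (trans (cong₂ _∧_ (all-range-cong n (λ k _ _ → symmetric (suc n) k)) diagonal) (∧-comm last true))) ⟩
  (allPairs n Q ∧ last) ∧ last
    ≡⟨ idem (allPairs n Q) last ⟩
  allPairs n Q ∧ last ∎
  where
  last = all (λ j → Q j (suc n)) (range1 n)
  idem : ∀ x y → (x ∧ y) ∧ y ≡ x ∧ y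
  idem true  true  = refl
  idem true  false = refl
  idem false y     = refl

-- A common form for m, p and e. The first Boolean marks the diagonal, where e must not compare a
-- position with itself; off the diagonal `S` becomes the condition `R` of `pairwise`.
Triples : (Bool → Bool → Bool → Bool) → List ℕ → List ℕ → ℕ → ℕ → Bool
Triples S l w j k = S (j ≡ᵇ k) (at l j ≡ᵇ at l k) (at w j ≡ᵇ at w k)

pairwise-allPairs : ∀ S R → S true true true ≡ true → (∀ x y → S false x y ≡ R x y) → ∀ a w → length a ≡ length w →
  allPairs (length a) (Triples S (reverse a) (reverse w)) ≡ pairwise R a w
pairwise-allPairs S R St SR []      []      l = refl
pairwise-allPairs S R St SR (b ∷ a) (v ∷ w) l = begin
  allPairs (suc n) Q⁺
    ≡⟨ allPairs-suc n Q⁺ symmetric diagonal ⟩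
  allPairs n Q⁺ ∧ all (λ j → Q⁺ j (suc n)) (range1 n)
    ≡⟨ cong₂ _∧_
         (trans (all-range-cong n (λ j 1≤j j≤ → all-range-cong n (λ k 1≤k k≤ → below (1≤j , j≤) (1≤k , k≤)))) (pairwise-allPairs S R St SR a w l′))
         (trans (all-range-cong n top) (zall-range (λ x y → R (x ≡ᵇ b) (y ≡ᵇ v)) a w l′)) ⟩
  pairwise R a w ∧ zall (λ x y → R (x ≡ᵇ b) (y ≡ᵇ v)) a w ∎
  where
  n = length a
  l′ = ℕP.suc-injective l
  Q⁺ = Triples S (reverse (b ∷ a)) (reverse (v ∷ w))
  inW : ∀ {j} → InRange n j → InRange (length w) j
  inW {j} (1≤j , j≤) = 1≤j , subst (j ≤_) l′ j≤
  symmetric : ∀ j k → Q⁺ j k ≡ Q⁺ k j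
  symmetric j k rewrite ≡ᵇ-sym j k | ≡ᵇ-sym (at (reverse (b ∷ a)) j) (at (reverse (b ∷ a)) k) | ≡ᵇ-sym (at (reverse (v ∷ w)) j) (at (reverse (v ∷ w)) k) = refl
  diagonal : Q⁺ (suc n) (suc n) ≡ true
  diagonal rewrite ≡ᵇ-refl (suc n) | ≡ᵇ-refl (at (reverse (b ∷ a)) (suc n)) | ≡ᵇ-refl (at (reverse (v ∷ w)) (suc n)) = St
  below : ∀ {j k} → InRange n j → InRange n k → Q⁺ j k ≡ Triples S (reverse a) (reverse w) j k
  below {j} {k} rj rk rewrite at-reverse-below b a rj | at-reverse-below b a rk | at-reverse-below v w (inW rj) | at-reverse-below v w (inW rk) = refl
  top : ∀ j → 1 ≤ j → j ≤ n → Q⁺ j (suc n) ≡ R (at (reverse a) j ≡ᵇ b) (at (reverse w) j ≡ᵇ v)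
  top j 1≤j j≤ rewrite ≡ᵇ-no j (suc n) (ℕP.<⇒≢ (s≤s j≤)) | at-reverse-below b a (1≤j , j≤) | at-reverse-below v w (inW (1≤j , j≤))
    | at-reverse-top b a | l′ | at-reverse-top v w = SR _ _

pairwise-length : ∀ R a w → length a ≢ length w → pairwise R a w ≡ false
pairwise-length R []      []      ne = ⊥-elim (ne refl)
pairwise-length R []      (v ∷ w) ne = refl
pairwise-length R (b ∷ a) []      ne = refl
pairwise-length R (b ∷ a) (v ∷ w) ne = cong (_∧ zall (λ x y → R (x ≡ᵇ b) (y ≡ᵇ v)) a w) (pairwise-length R a w (λ e → ne (cong suc e)))

series-pairwise : ∀ S R → S true true true ≡ true → (∀ x y → S false x y ≡ R x y) → ∀ (l w : List ℕ) →
  (length w ≡ᵇ length l) ∧ allPairs (length l) (Triples S l w) ≡ pairwise R (reverse l) (reverse w)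
series-pairwise S R St SR l w with length (reverse l) ℕP.≟ length (reverse w)
... | no ne = trans (cong (_∧ allPairs (length l) (Triples S l w)) (≡ᵇ-no (length w) (length l) (λ e → ne (trans (length-reverse l) (trans (sym e) (sym (length-reverse w)))))))
  (sym (pairwise-length R (reverse l) (reverse w) ne))
... | yes e = trans (cong (_∧ allPairs (length l) (Triples S l w)) (≡ᵇ-yes (length w) (length l) (trans (sym (length-reverse w)) (trans (sym e) (length-reverse l)))))
  (trans (sym (trans (cong (λ k → allPairs k (Triples S (reverse (reverse l)) (reverse (reverse w)))) (length-reverse l))
      (cong₂ (λ l' w' → allPairs (length l) (Triples S l' w')) (reverse-involutive l) (reverse-involutive w))))
    (pairwise-allPairs S R St SR (reverse l) (reverse w) e))

-- If the earlier positions satisfy the condition of p, those labelled `b` all carry one letter, so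
-- comparing `v` with all of them amounts to comparing it with the first.
zall-look : ∀ a w b v → pairwise _⇒ᵇ_ a w ≡ true → zall (λ x y → (x ≡ᵇ b) ⇒ᵇ (y ≡ᵇ v)) a w ≡ (if has b a then (look 0 b a w ≡ᵇ v) else true)
zall-look []      []      b v h = refl
zall-look (x ∷ a) (y ∷ w) b v h with ∧-split {pairwise _⇒ᵇ_ a w} h
... | p , q with x ≡ᵇ b in eb
...   | false = trans (zall-look a w b v p) shape
  where
  shape : (if has b a then (look 0 b a w ≡ᵇ v) else true) ≡ (if has b a then ((if has b a then look 0 b a w else y) ≡ᵇ v) else true)
  shape with has b a
  ... | true  = refl
  ... | false = refl
...   | true  with refl ← ≡ᵇ-true x b eb = trans (cong ((y ≡ᵇ v) ∧_) (zall-look a w b v p)) (shape (trans (sym (zall-look a w b y p)) q))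
  where
  ∧-idem : ∀ b → b ∧ b ≡ b
  ∧-idem true  = refl
  ∧-idem false = refl
  shape : (if has b a then (look 0 b a w ≡ᵇ y) else true) ≡ true →
    (y ≡ᵇ v) ∧ (if has b a then (look 0 b a w ≡ᵇ v) else true) ≡ ((if has b a then look 0 b a w else y) ≡ᵇ v)
  shape e with has b a
  ... | true  = trans (cong (λ z → (z ≡ᵇ v) ∧ (look 0 b a w ≡ᵇ v)) (sym (≡ᵇ-true (look 0 b a w) y e))) (∧-idem _)
  ... | false = ∧-comm (y ≡ᵇ v) true

P-pairwise : ∀ a w → ind (pairwise _⇒ᵇ_ a w) ≡ P a w
P-pairwise []      []      = refl
P-pairwise []      (v ∷ w) = refl
P-pairwise (b ∷ a) []      = refl
P-pairwise (b ∷ a) (v ∷ w) with pairwise _⇒ᵇ_ a w in eq | P-pairwise a w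
... | false | e = sym (trans (cong (_*q (if has b a then ind (look 0 b a w ≡ᵇ v) else 1ℚ)) (sym e)) (ℚP.*-zeroˡ (if has b a then ind (look 0 b a w ≡ᵇ v) else 1ℚ)))
... | true  | e = trans (cong ind (zall-look a w b v eq)) (trans last (trans (sym (ℚP.*-identityˡ _)) (cong (_*q (if has b a then ind (look 0 b a w ≡ᵇ v) else 1ℚ)) e)))
  where
  last : ind (if has b a then (look 0 b a w ≡ᵇ v) else true) ≡ (if has b a then ind (look 0 b a w ≡ᵇ v) else 1ℚ)
  last with has b a
  ... | true  = refl
  ... | false = refl

pS-rev : ∀ π w → pS π w ≡ P (rev π) (reverse w)
pS-rev π w = trans (cong ind (series-pairwise (λ _ → _⇒ᵇ_) _⇒ᵇ_ refl (λ _ _ → refl) (proj₁ π) w)) (P-pairwise (rev π) (reverse w))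

matches-map-suc : ∀ J y w v → matches (map suc J) (y ∷ w) v ≡ matches J w v
matches-map-suc J y w v = ∑-map suc J _

matches-cons : ∀ x a y w b v → matches (indices b (x ∷ a)) (y ∷ w) v ≡ ind ((x ≡ᵇ b) ∧ (y ≡ᵇ v)) +q matches (indices b a) w v
matches-cons x a y w b v with x ≡ᵇ b
... | true  = cong (ind (y ≡ᵇ v) +q_) (matches-map-suc (indices b a) y w v)
... | false = trans (matches-map-suc (indices b a) y w v) (sym (ℚP.+-identityˡ _))

distinct : Bool → Bool → Bool
distinct x y = x ⇒ᵇ not y

-- The right side could drop below 0 if several positions matched. By hypothesis the letters within
-- a block are distinct so far, so a second match is impossible and both sides are 0 or 1.
zall-matches : ∀ a w b v → pairwise distinct a w ≡ true →
  ind (zall (λ x y → distinct (x ≡ᵇ b) (y ≡ᵇ v)) a w) ≡ 1ℚ +q -1ℚ *q matches (indices b a) w v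
zall-matches []      []      b v h = refl
zall-matches (x ∷ a) (y ∷ w) b v h with ∧-split {pairwise distinct a w} h
... | p , q = trans (shape (x ≡ᵇ b) (y ≡ᵇ v) refl refl) (cong (λ m → 1ℚ +q -1ℚ *q m) (sym (matches-cons x a y w b v)))
  where
  m = matches (indices b a) w v
  Z = zall (λ x y → distinct (x ≡ᵇ b) (y ≡ᵇ v)) a w
  IH : ind Z ≡ 1ℚ +q -1ℚ *q m
  IH = zall-matches a w b v p
  shape : ∀ s t → (x ≡ᵇ b) ≡ s → (y ≡ᵇ v) ≡ t → ind (distinct s t ∧ Z) ≡ 1ℚ +q -1ℚ *q (ind (s ∧ t) +q m)
  shape false t     _ _ = trans IH (cong (λ m → 1ℚ +q -1ℚ *q m) (sym (ℚP.+-identityˡ m)))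
  shape true  false _ _ = trans IH (cong (λ m → 1ℚ +q -1ℚ *q m) (sym (ℚP.+-identityˡ m)))
  shape true  true  ex ey with refl ← ≡ᵇ-true x b ex | refl ← ≡ᵇ-true y v ey =
    trans (sym (cong (_+q -1ℚ) (trans (sym IH) (cong ind q))))
      (solve 1 (λ m → con 1ℚ :+ con -1ℚ :* m :+ con -1ℚ := con 1ℚ :+ con -1ℚ :* (con 1ℚ :+ m)) refl m)

E-pairwise : ∀ a w → ind (pairwise distinct a w) ≡ E a w
E-pairwise []      []      = refl
E-pairwise []      (v ∷ w) = refl
E-pairwise (b ∷ a) []      = refl
E-pairwise (b ∷ a) (v ∷ w) with pairwise distinct a w in eq | E-pairwise a w
... | false | e = sym (trans (cong (_*q (1ℚ +q -1ℚ *q matches (indices b a) w v)) (sym e)) (ℚP.*-zeroˡ (1ℚ +q -1ℚ *q matches (indices b a) w v)))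
... | true  | e = trans (zall-matches a w b v eq) (trans (sym (ℚP.*-identityˡ _)) (cong (_*q (1ℚ +q -1ℚ *q matches (indices b a) w v)) e))

eS-rev : ∀ π w → eS π w ≡ E (rev π) (reverse w)
eS-rev π w = trans (cong ind (series-pairwise (λ d x y → (not d ∧ x) ⇒ᵇ not y) distinct refl (λ _ _ → refl) (proj₁ π) w)) (E-pairwise (rev π) (reverse w))

-- The coefficients of h as products of factorials

∏ : List A → (A → ℚ) → ℚ
∏ xs f = prodQ (map f xs)

∏-++ : ∀ xs ys → prodQ (xs ++ ys) ≡ prodQ xs *q prodQ ys
∏-++ []       ys = sym (ℚP.*-identityˡ (prodQ ys))
∏-++ (x ∷ xs) ys = trans (cong (x *q_) (∏-++ xs ys)) (sym (ℚP.*-assoc x (prodQ xs) (prodQ ys)))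

∏-concatMap : ∀ (f : A → List ℚ) xs → prodQ (concatMap f xs) ≡ ∏ xs (prodQ ∘ f)
∏-concatMap f []       = refl
∏-concatMap f (x ∷ xs) = trans (∏-++ (f x) (concatMap f xs)) (cong (prodQ (f x) *q_) (∏-concatMap f xs))

∏-cong : ∀ {Q : A → Set} {xs : List A} {f g} → All Q xs → (∀ x → Q x → f x ≡ g x) → ∏ xs f ≡ ∏ xs g
∏-cong []       h = refl
∏-cong (p ∷ ps) h = cong₂ _*q_ (h _ p) (∏-cong ps h)

∏-1 : ∀ (xs : List A) → ∏ xs (λ _ → 1ℚ) ≡ 1ℚ
∏-1 []       = refl
∏-1 (x ∷ xs) = trans (ℚP.*-identityˡ _) (∏-1 xs)

∏-change : ∀ {xs : List A} {x f g c} → Unique xs → x ∈ xs → f x ≡ g x *q c → (∀ y → x ≢ y → f y ≡ g y) → ∏ xs f ≡ ∏ xs g *q c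
∏-change {xs = x ∷ xs} {f = f} {g} {c} (n ∷ u) (here refl) e h = trans (cong₂ _*q_ e (∏-cong n h))
  (solve 3 (λ x c r → x :* c :* r := x :* r :* c) refl (g x) c (∏ xs g))
∏-change {xs = y ∷ xs} {f = f} {g} {c} (n ∷ u) (there i) e h = trans
  (cong₂ _*q_ (h y (λ { refl → All≢-∉ n i })) (∏-change {f = f} {g} {c} u i e h))
  (sym (ℚP.*-assoc (g y) (∏ xs g) c))

zcount : ℕ → ℕ → List ℕ → List ℕ → ℕ
zcount b v (x ∷ a) (y ∷ w) = if (x ≡ᵇ b) ∧ (y ≡ᵇ v) then suc (zcount b v a w) else zcount b v a w
zcount b v _       _       = 0

zcount-matches : ∀ b v a w → length a ≡ length w → ℕtoℚ (zcount b v a w) ≡ matches (indices b a) w v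
zcount-matches b v []      []      l = refl
zcount-matches b v (x ∷ a) (y ∷ w) l = trans shape (sym (matches-cons x a y w b v))
  where
  shape : ℕtoℚ (if (x ≡ᵇ b) ∧ (y ≡ᵇ v) then suc (zcount b v a w) else zcount b v a w) ≡ ind ((x ≡ᵇ b) ∧ (y ≡ᵇ v)) +q matches (indices b a) w v
  shape with (x ≡ᵇ b) ∧ (y ≡ᵇ v)
  ... | true  = trans (ℕtoℚ-+ 1 (zcount b v a w)) (cong (1ℚ +q_) (zcount-matches b v a w (ℕP.suc-injective l)))
  ... | false = trans (zcount-matches b v a w (ℕP.suc-injective l)) (sym (ℚP.+-identityˡ _))

countB-∷ʳ : ∀ (p : ℕ → Bool) xs x → countB p (xs ∷ʳ x) ≡ (if p x then suc (countB p xs) else countB p xs)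
countB-∷ʳ p []       x = refl
countB-∷ʳ p (y ∷ xs) x with p y | p x | countB-∷ʳ p xs x
... | true  | true  | e = cong suc e
... | true  | false | e = cong suc e
... | false | true  | e = e
... | false | false | e = e

countB-range-suc : ∀ p n → countB p (range1 (suc n)) ≡ (if p (suc n) then suc (countB p (range1 n)) else countB p (range1 n))
countB-range-suc p n = trans (cong (countB p) (range1-∷ʳ n)) (countB-∷ʳ p (range1 n) (suc n))

countB-cong : ∀ n {p q : ℕ → Bool} → (∀ j → 1 ≤ j → j ≤ n → p j ≡ q j) → countB p (range1 n) ≡ countB q (range1 n)
countB-cong zero    h = refl
countB-cong (suc n) {p} {q} h = trans (countB-range-suc p n) (trans
  (cong₂ (λ b k → if b then suc k else k) (h (suc n) (s≤s z≤n) ℕP.≤-refl) (countB-cong n (λ j 1≤j j≤ → h j 1≤j (ℕP.m≤n⇒m≤1+n j≤))))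
  (sym (countB-range-suc q n)))

countB-zcount : ∀ b v a w → length a ≡ length w →
  countB (λ j → (at (reverse a) j ≡ᵇ b) ∧ (at (reverse w) j ≡ᵇ v)) (range1 (length a)) ≡ zcount b v a w
countB-zcount b v []      []      l = refl
countB-zcount b v (x ∷ a) (y ∷ w) l = trans (countB-range-suc _ (length a)) (cong₂ (λ p k → if p then suc k else k)
  (cong₂ (λ p q → (p ≡ᵇ b) ∧ (q ≡ᵇ v)) (at-reverse-top x a) (trans (cong (at (reverse (y ∷ w))) (cong suc l′)) (at-reverse-top y w)))
  (trans (countB-cong (length a) (λ j 1≤j j≤ → cong₂ (λ p q → (p ≡ᵇ b) ∧ (q ≡ᵇ v)) (at-reverse-below x a (1≤j , j≤)) (at-reverse-below y w (1≤j , subst (j ≤_) l′ j≤))))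
    (countB-zcount b v a w l′)))
  where l′ = ℕP.suc-injective l

factorials : ℕ → ℕ → List ℕ → List ℕ → ℚ
factorials m n a w = ∏ (upTo m) (λ b → ∏ (upTo n) (λ v → ℕtoℚ (zcount b v a w !)))

∈-upTo : ∀ {i n} → i < n → i ∈ upTo n
∈-upTo {i} {n} i<n = go n i<n
  where
  go : ∀ n → i < n → i ∈ upTo n
  go (suc n) lt with ℕP.m≤n⇒m<n∨m≡n (ℕP.≤-pred lt)
  ... | inj₁ i<   = subst (i ∈_) (upTo-∷ʳ n) (∈-++⁺ˡ (go n i<))
  ... | inj₂ refl = subst (i ∈_) (upTo-∷ʳ n) (∈-++⁺ʳ (upTo n) (here refl))

-- Appending a position raises a single count, that of its own block and letter, from `k` to
-- `k + 1`, so the product gains the factor `k + 1`, where `k` is the number of matches.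
factorials-H : ∀ m n a w → length a ≡ length w → All (_< m) a → All (_< n) w → factorials m n a w ≡ H a w
factorials-H m n []      []      l _ _ = trans (∏-cong (AllP.all-upTo m) (λ b _ → ∏-1 (upTo n))) (∏-1 (upTo m))
factorials-H m n (b ∷ a) (v ∷ w) l (b< ∷ a<) (v< ∷ w<) = trans
  (∏-change {x = b} (UniqueP.upTo⁺ m) (∈-upTo b<)
    (∏-change {x = v} (UniqueP.upTo⁺ n) (∈-upTo v<) grow (λ v' ne → cong (λ z → ℕtoℚ (z !)) (unaffectedˡ b v' (λ e → ne e))))
    (λ b' ne → ∏-cong (AllP.all-upTo n) (λ v' _ → cong (λ z → ℕtoℚ (z !)) (unaffectedʳ b' v' ne))))
  (cong (_*q c) (factorials-H m n a w l′ a< w<))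
  where
  l′ = ℕP.suc-injective l
  c = 1ℚ +q matches (indices b a) w v
  unaffectedˡ : ∀ b' v' → v ≢ v' → zcount b' v' (b ∷ a) (v ∷ w) ≡ zcount b' v' a w
  unaffectedˡ b' v' ne rewrite ≡ᵇ-no v v' ne | ∧-comm (b ≡ᵇ b') false = refl
  unaffectedʳ : ∀ b' v' → b ≢ b' → zcount b' v' (b ∷ a) (v ∷ w) ≡ zcount b' v' a w
  unaffectedʳ b' v' ne rewrite ≡ᵇ-no b b' ne = refl
  self : zcount b v (b ∷ a) (v ∷ w) ≡ suc (zcount b v a w)
  self rewrite ≡ᵇ-refl b | ≡ᵇ-refl v = refl
  grow : ℕtoℚ (zcount b v (b ∷ a) (v ∷ w) !) ≡ ℕtoℚ (zcount b v a w !) *q c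
  grow = trans (cong (λ k → ℕtoℚ (k !)) self) (trans (ℕtoℚ-* (suc (zcount b v a w)) (zcount b v a w !))
    (trans (ℚP.*-comm (ℕtoℚ (suc (zcount b v a w))) (ℕtoℚ (zcount b v a w !))) (cong (ℕtoℚ (zcount b v a w !) *q_)
      (trans (ℕtoℚ-+ 1 (zcount b v a w)) (cong (1ℚ +q_) (zcount-matches b v a w l′))))))

labels-< : ∀ l → All (_< nb l) l
labels-< []      = []
labels-< (x ∷ l) = ℕP.m≤m⊔n (suc x) (nb l) ∷ weaken (labels-< l)
  where
  weaken : ∀ {k} → All (_< nb l) k → All (_< suc x ⊔ nb l) k
  weaken []       = []
  weaken (p ∷ ps) = ℕP.≤-trans p (ℕP.m≤n⊔m (suc x) (nb l)) ∷ weaken ps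

letters-< : ∀ w → All (_< suc (maxL w)) w
letters-< []      = []
letters-< (x ∷ l) = s≤s (ℕP.m≤m⊔n x (maxL l)) ∷ weaken (letters-< l)
  where
  weaken : ∀ {k} → All (_< suc (maxL l)) k → All (_< suc (x ⊔ maxL l)) k
  weaken []       = []
  weaken (p ∷ ps) = ℕP.≤-trans p (s≤s (ℕP.m≤n⊔m x (maxL l))) ∷ weaken ps

H-length : ∀ a w → length a ≢ length w → H a w ≡ 0ℚ
H-length []      []      ne = ⊥-elim (ne refl)
H-length []      (v ∷ w) ne = refl
H-length (b ∷ a) []      ne = refl
H-length (b ∷ a) (v ∷ w) ne = trans (cong (_*q (1ℚ +q matches (indices b a) w v)) (H-length a w (λ e → ne (cong suc e)))) (ℚP.*-zeroˡ (1ℚ +q matches (indices b a) w v))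

hS-rev : ∀ π w → hS π w ≡ H (rev π) (reverse w)
hS-rev π@(l , _) w = by-length (length w ℕP.≟ length l)
  where
  factorial : ℕ → ℕ → ℚ
  factorial b v = ℕtoℚ (countB (λ j → (at l j ≡ᵇ b) ∧ (at w j ≡ᵇ v)) (range1 (length l)) !)
  value = prodQ (concatMap (λ b → map (factorial b) (upTo (suc (maxL w)))) (upTo (nb l)))
  counted : length (reverse l) ≡ length (reverse w) → ∀ b v →
    countB (λ j → (at l j ≡ᵇ b) ∧ (at w j ≡ᵇ v)) (range1 (length l)) ≡ zcount b v (reverse l) (reverse w)
  counted e b v = trans (cong₂ (λ l' n → countB (λ j → (at l' j ≡ᵇ b) ∧ (at w j ≡ᵇ v)) (range1 n)) (sym (reverse-involutive l)) (sym (length-reverse l)))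
    (trans (cong (λ w' → countB (λ j → (at (reverse (reverse l)) j ≡ᵇ b) ∧ (at w' j ≡ᵇ v)) (range1 (length (reverse l)))) (sym (reverse-involutive w)))
      (countB-zcount b v (reverse l) (reverse w) e))
  value-H : length (reverse l) ≡ length (reverse w) → value ≡ H (reverse l) (reverse w)
  value-H e = trans (∏-concatMap (λ b → map (factorial b) (upTo (suc (maxL w)))) (upTo (nb l)))
    (trans (∏-cong (AllP.all-upTo (nb l)) (λ b _ → ∏-cong (AllP.all-upTo (suc (maxL w))) (λ v _ → cong (λ z → ℕtoℚ (z !)) (counted e b v))))
      (factorials-H (nb l) (suc (maxL w)) (reverse l) (reverse w) e
        (All-resp-↭ (↭-sym (↭-reverse l)) (labels-< l)) (All-resp-↭ (↭-sym (↭-reverse w)) (letters-< w))))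
  by-length : Dec (length w ≡ length l) → (if length w ≡ᵇ length l then value else 0ℚ) ≡ H (reverse l) (reverse w)
  by-length (no ne) = trans (cong (λ b → if b then value else 0ℚ) (≡ᵇ-no (length w) (length l) ne))
    (sym (H-length (reverse l) (reverse w) (λ e → ne (trans (sym (length-reverse w)) (trans (sym e) (length-reverse l))))))
  by-length (yes e) = trans (cong (λ b → if b then value else 0ℚ) (≡ᵇ-yes (length w) (length l) e))
    (value-H (trans (length-reverse l) (trans (sym e) (sym (length-reverse w)))))

-- Monomial functions

monoRel : Bool → Bool → Bool
monoRel x y = y ⇔ᵇ x

M : List ℕ → List ℕ → ℚ
M a w = ind (pairwise monoRel a w)

mS-rev : ∀ π w → mS π w ≡ M (rev π) (reverse w)
mS-rev π w = cong ind (series-pairwise (λ _ → monoRel) monoRel refl (λ _ _ → refl) (proj₁ π) w)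

⇔ᵇ-≡ : ∀ {x y} → (x ⇔ᵇ y) ≡ true → x ≡ y
⇔ᵇ-≡ {true}  {true}  _ = refl
⇔ᵇ-≡ {false} {false} _ = refl

≡-⇔ᵇ : ∀ {x y} → x ≡ y → (x ⇔ᵇ y) ≡ true
≡-⇔ᵇ {true}  refl = refl
≡-⇔ᵇ {false} refl = refl

zall-at : ∀ f a w → zall f a w ≡ true → length a ≡ length w → ∀ i → i < length a → f (lookupD a i) (lookupD w i) ≡ true
zall-at f (x ∷ a) (y ∷ w) e l zero    lt       = proj₁ (∧-split {f x y} e)
zall-at f (x ∷ a) (y ∷ w) e l (suc i) (s≤s lt) = zall-at f a w (proj₂ (∧-split {f x y} e)) (ℕP.suc-injective l) i lt

zall-intro : ∀ f a w → length a ≡ length w → (∀ i → i < length a → f (lookupD a i) (lookupD w i) ≡ true) → zall f a w ≡ true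
zall-intro f []      []      l h = refl
zall-intro f (x ∷ a) (y ∷ w) l h = cong₂ _∧_ (h 0 (s≤s z≤n)) (zall-intro f a w (ℕP.suc-injective l) (λ i lt → h (suc i) (s≤s lt)))

pairwise-same-length : ∀ R a w → pairwise R a w ≡ true → length a ≡ length w
pairwise-same-length R []      []      e = refl
pairwise-same-length R (b ∷ a) (v ∷ w) e = cong suc (pairwise-same-length R a w (proj₁ (∧-split {pairwise R a w} e)))

mono-at : ∀ a w → pairwise monoRel a w ≡ true → ∀ i k → i < length a → k < length a →
  (lookupD w k ≡ᵇ lookupD w i) ≡ (lookupD a k ≡ᵇ lookupD a i)
mono-at (b ∷ a) (v ∷ w) e i k i< k< with ∧-split {pairwise monoRel a w} e
mono-at (b ∷ a) (v ∷ w) e zero    zero    _ _ | p , q = trans (≡ᵇ-refl v) (sym (≡ᵇ-refl b))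
mono-at (b ∷ a) (v ∷ w) e (suc i) (suc k) (s≤s i<) (s≤s k<) | p , q = mono-at a w p i k i< k<
mono-at (b ∷ a) (v ∷ w) e zero    (suc k) _ (s≤s k<) | p , q =
  ⇔ᵇ-≡ (zall-at (λ x y → monoRel (x ≡ᵇ b) (y ≡ᵇ v)) a w q (pairwise-same-length monoRel a w p) k k<)
mono-at (b ∷ a) (v ∷ w) e (suc i) zero    (s≤s i<) _ | p , q =
  trans (≡ᵇ-sym v (lookupD w i)) (trans (⇔ᵇ-≡ (zall-at (λ x y → monoRel (x ≡ᵇ b) (y ≡ᵇ v)) a w q (pairwise-same-length monoRel a w p) i i<)) (≡ᵇ-sym (lookupD a i) b))

M-attach : ∀ a v w i → i < length a → M (attach a i) (v ∷ w) ≡ M a w *q ind (lookupD w i ≡ᵇ v)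
M-attach a v w i i< with pairwise monoRel a w in eq
... | false = sym (ℚP.*-zeroˡ (ind (lookupD w i ≡ᵇ v)))
... | true  = trans (cong ind (≡⇔ forth back)) (sym (ℚP.*-identityˡ (ind (lookupD w i ≡ᵇ v))))
  where
  l = pairwise-same-length monoRel a w eq
  f = λ x y → monoRel (x ≡ᵇ lookupD a i) (y ≡ᵇ v)
  forth : zall f a w ≡ true → (lookupD w i ≡ᵇ v) ≡ true
  forth e = trans (⇔ᵇ-≡ (zall-at f a w e l i i<)) (≡ᵇ-refl (lookupD a i))
  back : (lookupD w i ≡ᵇ v) ≡ true → zall f a w ≡ true
  back e with refl ← ≡ᵇ-true (lookupD w i) v e = zall-intro f a w l (λ k k< → ≡-⇔ᵇ (mono-at a w eq i k i< k<))

∑-single : ∀ {xs : List A} {x f} → Unique xs → x ∈ xs → (∀ y → y ∈ xs → y ≢ x → f y ≡ 0ℚ) → ∑ xs f ≡ f x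
∑-single {xs = x ∷ xs} {f = f} (n ∷ u) (here refl) h = trans
  (cong (f x +q_) (vanish xs n (λ y i → h y (there i)))) (ℚP.+-identityʳ (f x))
  where
  vanish : ∀ ys → All (x ≢_) ys → (∀ y → y ∈ ys → y ≢ x → f y ≡ 0ℚ) → ∑ ys f ≡ 0ℚ
  vanish []       []       h = refl
  vanish (y ∷ ys) (p ∷ ps) h = cong₂ _+q_ (h y (here refl) (p ∘ sym)) (vanish ys ps (λ z i → h z (there i)))
∑-single {xs = y ∷ xs} {x} {f} (n ∷ u) (there i) h = trans
  (cong₂ _+q_ (h y (here refl) (λ { refl → All≢-∉ n i })) (∑-single u i (λ z j → h z (there j)))) (ℚP.+-identityˡ (f x))

upTo-∈ : ∀ {i n} → i ∈ upTo n → i < n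
upTo-∈ {n = n} h = lookup-All (AllP.all-upTo n) h

find-letter : ∀ v w → (Σ ℕ λ i → (i < length w) × (lookupD w i ≡ v)) ⊎ (∀ i → i < length w → lookupD w i ≢ v)
find-letter v []      = inj₂ (λ i ())
find-letter v (y ∷ w) with y ℕP.≟ v
... | yes e = inj₁ (0 , s≤s z≤n , e)
... | no ne with find-letter v w
...   | inj₁ (i , i< , e) = inj₁ (suc i , s≤s i< , e)
...   | inj₂ h            = inj₂ (λ { zero _ → ne ; (suc i) (s≤s i<) → h i i< })

indexOf : ∀ {a b} → RG a → b < nb a → Σ ℕ (IndexOf b a)
indexOf {a} {b} r b< with indices-present b a (RG-has r b<)
... | i , m = i , lookup-All (indices-sound b a) m

-- Exactly one label suits the new position: that of an earlier position with letter `v`, or the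
-- fresh label `nb a` if there is none.
M-sum : ∀ {a} → RG a → ∀ v w → ∑ (upTo (suc (nb a))) (λ b → M (b ∷ a) (v ∷ w)) ≡ M a w
M-sum {a} r v w with pairwise monoRel a w in eq
... | false = ∑-0 (upTo (suc (nb a)))
... | true  with find-letter v w
...   | inj₁ (i , i<w , e) = trans (∑-single {x = lookupD a i} (UniqueP.upTo⁺ (suc (nb a))) (∈-upTo (ℕP.m≤n⇒m≤1+n (has-< _ a (has-lookup a i i<)))) others)
    (trans (cong (λ b → ind (b ∧ zall f a w)) (sym eq)) (trans (M-attach a v w i i<) (cong₂ (λ p q → ind p *q ind q) eq (≡ᵇ-yes (lookupD w i) v e))))
  where
  l = pairwise-same-length monoRel a w eq
  i< = subst (i <_) (sym l) i<w
  f = λ x y → monoRel (x ≡ᵇ lookupD a i) (y ≡ᵇ v)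
  others : ∀ b → b ∈ upTo (suc (nb a)) → b ≢ lookupD a i → ind (zall (λ x y → monoRel (x ≡ᵇ b) (y ≡ᵇ v)) a w) ≡ 0ℚ
  others b _ ne with zall (λ x y → monoRel (x ≡ᵇ b) (y ≡ᵇ v)) a w in ez
  ... | false = refl
  ... | true  = ⊥-elim (ne (sym (≡ᵇ-true (lookupD a i) b (trans (sym (⇔ᵇ-≡ (zall-at _ a w ez l i i<))) (≡ᵇ-yes (lookupD w i) v e)))))
...   | inj₂ absent = trans (∑-single {x = nb a} (UniqueP.upTo⁺ (suc (nb a))) (∈-upTo ℕP.≤-refl) others) (cong ind fresh)
  where
  l = pairwise-same-length monoRel a w eq
  others : ∀ b → b ∈ upTo (suc (nb a)) → b ≢ nb a → ind (zall (λ x y → monoRel (x ≡ᵇ b) (y ≡ᵇ v)) a w) ≡ 0ℚ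
  others b m ne with zall (λ x y → monoRel (x ≡ᵇ b) (y ≡ᵇ v)) a w in ez
  ... | false = refl
  ... | true  with indexOf r (ℕP.≤∧≢⇒< (ℕP.≤-pred (upTo-∈ m)) ne)
  ...   | i , i< , e = ⊥-elim (absent i (subst (i <_) l i<) (≡ᵇ-true (lookupD w i) v (trans (⇔ᵇ-≡ (zall-at _ a w ez l i i<)) (≡ᵇ-yes (lookupD a i) b e))))
  fresh : zall (λ x y → monoRel (x ≡ᵇ nb a) (y ≡ᵇ v)) a w ≡ true
  fresh = zall-intro _ a w l (λ i i< → ≡-⇔ᵇ (trans (≡ᵇ-no (lookupD w i) v (absent i (subst (i <_) l i<)))
    (sym (≡ᵇ-no (lookupD a i) (nb a) (ℕP.<⇒≢ (has-< (lookupD a i) a (has-lookup a i i<)))))))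

-- Spans

Span : (I → Set) → (I → Series) → Series → Set
Span {I} Q v f = Σ (List (I × ℚ)) λ L → All (λ x → Q (proj₁ x)) L × (f ≈ lincomb v L)

lincomb-++ : ∀ (v : I → Series) L L' → lincomb v (L ++ L') ≈ lincomb v L +S lincomb v L'
lincomb-++ v L L' w = trans (lincomb-∑ v (L ++ L') w) (trans (∑-++ L L' _) (cong₂ _+q_ (sym (lincomb-∑ v L w)) (sym (lincomb-∑ v L' w))))

scale : ℚ → List (I × ℚ) → List (I × ℚ)
scale c = map (λ x → proj₁ x , c *q proj₂ x)

lincomb-scale : ∀ (v : I → Series) c L → lincomb v (scale c L) ≈ c ·S lincomb v L
lincomb-scale v c L w = trans (lincomb-∑ v (scale c L) w) (trans (∑-map _ L _)
  (trans (∑-cong L (λ x → ℚP.*-assoc c (proj₂ x) (v (proj₁ x) w))) (trans (∑-*ˡ L c _) (cong (c *q_) (sym (lincomb-∑ v L w))))))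

span-cong : ∀ {Q : I → Set} {v f g} → f ≈ g → Span Q v g → Span Q v f
span-cong e (L , q , h) = L , q , λ w → trans (e w) (h w)

span-0 : ∀ {Q : I → Set} {v} → Span Q v 0S
span-0 = [] , [] , λ w → refl

span-+ : ∀ {Q : I → Set} {v f g} → Span Q v f → Span Q v g → Span Q v (f +S g)
span-+ {v = v} (L , q , h) (L' , q' , h') = L ++ L' , AllP.++⁺ q q' , λ w → trans (cong₂ _+q_ (h w) (h' w)) (sym (lincomb-++ v L L' w))

span-* : ∀ {Q : I → Set} {v f} c → Span Q v f → Span Q v (c ·S f)
span-* {v = v} c (L , q , h) = scale c L , All-map (λ _ p → p) q , λ w → trans (cong (c *q_) (h w)) (sym (lincomb-scale v c L w))

span-∑ : ∀ {Q : I → Set} {v} {R : A → Set} {f : A → Series} {xs} → All R xs → (∀ x → R x → Span Q v (f x)) → Span Q v (λ w → ∑ xs (λ x → f x w))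
span-∑ []       h = span-0
span-∑ (p ∷ ps) h = span-+ (h _ p) (span-∑ ps h)

span-of : ∀ {Q : I → Set} {v i} → Q i → Span Q v (v i)
span-of {v = v} {i} q = (i , 1ℚ) ∷ [] , q ∷ [] , λ w → sym (trans (ℚP.+-identityʳ _) (ℚP.*-identityˡ (v i w)))

span-op : ∀ {Q : I → Set} {Q' : I′ → Set} {v v' f} (op : Series → Series) → (∀ {f g} → f ≈ g → op f ≈ op g) →
  (∀ L w → op (lincomb v L) w ≡ ∑ L (λ x → proj₂ x *q op (v (proj₁ x)) w)) →
  (∀ i → Q i → Span Q' v' (op (v i))) → Span Q v f → Span Q' v' (op f)
span-op op ext lin h (L , q , e) = span-cong (λ w → trans (ext e w) (lin L w)) (span-∑ q (λ x p → span-* (proj₂ x) (h (proj₁ x) p)))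

span-bind : ∀ {Q : I → Set} {Q' : I′ → Set} {v v' f} → (∀ i → Q i → Span Q' v' (v i)) → Span Q v f → Span Q' v' f
span-bind {v = v} = span-op id id (lincomb-∑ v)

-- Two ways of appending a position: with a free letter (`newOp`) or repeating the letter of index
-- `i` (`attOp`). Both send a P to a P. On an M, `attOp` gives an M and `newOp` the sum over all
-- labels of the new position. This yields both changes of basis by induction on the length.
newOp : Series → Series
newOp f []      = 0ℚ
newOp f (v ∷ w) = f w

attOp : ℕ → Series → Series
attOp i f []      = 0ℚ
attOp i f (v ∷ w) = f w *q ind (lookupD w i ≡ᵇ v)

newOp-linear : ∀ (V : I → Series) L w → newOp (lincomb V L) w ≡ ∑ L (λ x → proj₂ x *q newOp (V (proj₁ x)) w)
newOp-linear V L []      = sym (∑-zero L (λ x → ℚP.*-zeroʳ (proj₂ x)))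
newOp-linear V L (v ∷ w) = lincomb-∑ V L w

attOp-linear : ∀ i (V : I → Series) L w → attOp i (lincomb V L) w ≡ ∑ L (λ x → proj₂ x *q attOp i (V (proj₁ x)) w)
attOp-linear i V L []      = sym (∑-zero L (λ x → ℚP.*-zeroʳ (proj₂ x)))
attOp-linear i V L (v ∷ w) = trans (cong (_*q ind (lookupD w i ≡ᵇ v)) (lincomb-∑ V L w))
  (trans (sym (∑-*ʳ L (ind (lookupD w i ≡ᵇ v)) (λ x → proj₂ x *q V (proj₁ x) w))) (∑-cong L (λ x → ℚP.*-assoc (proj₂ x) (V (proj₁ x) w) _)))

newOp-cong : ∀ {f g} → f ≈ g → newOp f ≈ newOp g
newOp-cong e []      = refl
newOp-cong e (v ∷ w) = e w

attOp-cong : ∀ i {f g} → f ≈ g → attOp i f ≈ attOp i g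
attOp-cong i e []      = refl
attOp-cong i e (v ∷ w) = cong (_*q ind (lookupD w i ≡ᵇ v)) (e w)

RGₙ : ℕ → List ℕ → Set
RGₙ n a = RG a × (length a ≡ n)

P-newOp : ∀ a → P (nb a ∷ a) ≈ newOp (P a)
P-newOp a []      = refl
P-newOp a (v ∷ w) = P-new a v w

P-attOp : ∀ a i → i < length a → P (attach a i) ≈ attOp i (P a)
P-attOp a i i< []      = refl
P-attOp a i i< (v ∷ w) = P-attach a v w i i<

M-attOp : ∀ a i → i < length a → M (attach a i) ≈ attOp i (M a)
M-attOp a i i< []      = refl
M-attOp a i i< (v ∷ w) = M-attach a v w i i<

M-newOp : ∀ {a} → RG a → newOp (M a) ≈ (λ w → ∑ (upTo (suc (nb a))) (λ b → M (b ∷ a) w))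
M-newOp {a} r []      = sym (∑-0 (upTo (suc (nb a))))
M-newOp     r (v ∷ w) = sym (M-sum r v w)

span-P-newOp : ∀ {n f} → Span (RGₙ n) P f → Span (RGₙ (suc n)) P (newOp f)
span-P-newOp = span-op newOp newOp-cong (newOp-linear P)
  (λ a g → span-cong (λ w → sym (P-newOp a w)) (span-of (RG-new (proj₁ g) , cong suc (proj₂ g))))

span-P-attOp : ∀ {n f} i → i < n → Span (RGₙ n) P f → Span (RGₙ (suc n)) P (attOp i f)
span-P-attOp i i< = span-op (attOp i) (attOp-cong i) (attOp-linear i P)
  (λ { a (r , refl) → span-cong (λ w → sym (P-attOp a i i< w)) (span-of (proj₁ (RG-attach i r i<) , refl)) })

span-M-attOp : ∀ {n f} i → i < n → Span (RGₙ n) M f → Span (RGₙ (suc n)) M (attOp i f)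
span-M-attOp i i< = span-op (attOp i) (attOp-cong i) (attOp-linear i M)
  (λ { a (r , refl) → span-cong (λ w → sym (M-attOp a i i< w)) (span-of (proj₁ (RG-attach i r i<) , refl)) })

span-M-newOp : ∀ {n f} → Span (RGₙ n) M f → Span (RGₙ (suc n)) M (newOp f)
span-M-newOp = span-op newOp newOp-cong (newOp-linear M)
  (λ { a (r , refl) → span-cong (M-newOp r) (span-∑ (AllP.all-upTo (suc (nb a))) (λ b b< → span-of ((ℕP.≤-pred b< ∷ r) , refl))) })

P-in-M : ∀ {a} → RG a → Span (RGₙ (length a)) M (P a)
P-in-M [] = span-cong base (span-of ([] , refl))
  where
  base : P [] ≈ M []
  base []      = refl
  base (v ∷ w) = refl
P-in-M {b ∷ a} (b≤ ∷ r) with ℕP.m≤n⇒m<n∨m≡n b≤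
... | inj₂ refl = span-cong (P-newOp a) (span-M-newOp (P-in-M r))
... | inj₁ b< with indexOf r b<
...   | i , i< , refl = span-cong (P-attOp a i i<) (span-M-attOp i i< (P-in-M r))

M-in-P : ∀ {a} → RG a → Span (RGₙ (length a)) P (M a)
M-in-P [] = span-cong base (span-of ([] , refl))
  where
  base : M [] ≈ P []
  base []      = refl
  base (v ∷ w) = refl
M-in-P {b ∷ a} (b≤ ∷ r) with ℕP.m≤n⇒m<n∨m≡n b≤
... | inj₁ b< = old b b<
  where
  old : ∀ b → b < nb a → Span (RGₙ (suc (length a))) P (M (b ∷ a))
  old b b< with indexOf r b<
  ... | i , i< , refl = span-cong (M-attOp a i i<) (span-P-attOp i i< (M-in-P r))
-- `newOp (M a)` contains every label for the new position; subtracting the terms with old labels,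
-- already known to lie in the span, isolates the fresh one.
... | inj₂ refl = span-cong e (span-+ (span-P-newOp (M-in-P r)) (span-* -1ℚ (span-∑ (AllP.all-upTo (nb a)) old)))
  where
  old : ∀ b → b < nb a → Span (RGₙ (suc (length a))) P (M (b ∷ a))
  old b b< with indexOf r b<
  ... | i , i< , refl = span-cong (M-attOp a i i<) (span-P-attOp i i< (M-in-P r))
  e : M (nb a ∷ a) ≈ newOp (M a) +S (-1ℚ ·S (λ w → ∑ (upTo (nb a)) (λ b → M (b ∷ a) w)))
  e w = sym (begin
    newOp (M a) w +q -1ℚ *q S
      ≡⟨ cong (_+q -1ℚ *q S) (trans (M-newOp r w) (trans (cong (λ l → ∑ l (λ b → M (b ∷ a) w)) (sym (upTo-∷ʳ (nb a)))) (∑-++ (upTo (nb a)) [ nb a ] (λ b → M (b ∷ a) w)))) ⟩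
    S +q (M (nb a ∷ a) w +q 0ℚ) +q -1ℚ *q S
      ≡⟨ solve 2 (λ s m → s :+ (m :+ con 0ℚ) :+ con -1ℚ :* s := m) refl S (M (nb a ∷ a) w) ⟩
    M (nb a ∷ a) w ∎)
    where S = ∑ (upTo (nb a)) (λ b → M (b ∷ a) w)

span-partition : ∀ {n V v f} → (∀ π w → v π w ≡ V (rev π) (reverse w)) → Span (RGₙ n) V f → Span (λ (_ : SetPartition) → ⊤) v (f ∘ reverse)
span-partition {n} {V} {v} {f} e (L , q , h) = go L q , trivial (go L q) , λ w → trans (h (reverse w)) (agree L q w)
  where
  go : ∀ L → All (λ x → RGₙ n (proj₁ x)) L → List (SetPartition × ℚ)
  go []            []             = []
  go ((a , c) ∷ L) ((r , _) ∷ rs) = (partition r , c) ∷ go L rs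
  trivial : ∀ (L : List (SetPartition × ℚ)) → All (λ x → ⊤) L
  trivial []      = []
  trivial (x ∷ L) = tt ∷ trivial L
  agree : ∀ L (q : All (λ x → RGₙ n (proj₁ x)) L) w → lincomb V L (reverse w) ≡ lincomb v (go L q) w
  agree []            []             w = refl
  agree ((a , c) ∷ L) ((r , _) ∷ rs) w = cong₂ (λ x y → c *q x +q y) (sym (trans (e (partition r) w) (cong (λ b → V b (reverse w)) (rev-partition r)))) (agree L rs w)

-- Triangularity

-- A single list of coefficients for two families, as `OmegaRel` demands the same expansion in h and
-- in e.
JointSpan : (I → Set) → (I → Series) → (I → Series) → Series → Series → Set
JointSpan {I} Q u u' f f' = Σ (List (I × ℚ)) λ L → All (λ x → Q (proj₁ x)) L × (f ≈ lincomb u L) × (f' ≈ lincomb u' L)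

joint-cong : ∀ {Q : I → Set} {u u' f f' g g'} → f ≈ g → f' ≈ g' → JointSpan Q u u' g g' → JointSpan Q u u' f f'
joint-cong e e' (L , q , h , h') = L , q , (λ w → trans (e w) (h w)) , (λ w → trans (e' w) (h' w))

joint-0 : ∀ {Q : I → Set} {u u'} → JointSpan Q u u' 0S 0S
joint-0 = [] , [] , (λ w → refl) , (λ w → refl)

joint-+ : ∀ {Q : I → Set} {u u' f f' g g'} → JointSpan Q u u' f f' → JointSpan Q u u' g g' → JointSpan Q u u' (f +S g) (f' +S g')
joint-+ {u = u} {u'} (L , q , h , h') (K , p , k , k') = L ++ K , AllP.++⁺ q p ,
  (λ w → trans (cong₂ _+q_ (h w) (k w)) (sym (lincomb-++ u L K w))) ,
  (λ w → trans (cong₂ _+q_ (h' w) (k' w)) (sym (lincomb-++ u' L K w)))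

joint-* : ∀ {Q : I → Set} {u u' f f'} c → JointSpan Q u u' f f' → JointSpan Q u u' (c ·S f) (c ·S f')
joint-* {u = u} {u'} c (L , q , h , h') = scale c L , All-map (λ _ p → p) q ,
  (λ w → trans (cong (c *q_) (h w)) (sym (lincomb-scale u c L w))) ,
  (λ w → trans (cong (c *q_) (h' w)) (sym (lincomb-scale u' c L w)))

joint-∑ : ∀ {Q : I → Set} {u u'} {R : A → Set} {f f' : A → Series} {xs} → All R xs → (∀ x → R x → JointSpan Q u u' (f x) (f' x)) →
  JointSpan Q u u' (λ w → ∑ xs (λ x → f x w)) (λ w → ∑ xs (λ x → f' x w))
joint-∑ []       h = joint-0
joint-∑ (p ∷ ps) h = joint-+ (h _ p) (joint-∑ ps h)

joint-of : ∀ {Q : I → Set} {u u' i} → Q i → JointSpan Q u u' (u i) (u' i)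
joint-of {u = u} {u'} {i} q = (i , 1ℚ) ∷ [] , q ∷ [] ,
  (λ w → sym (trans (ℚP.+-identityʳ _) (ℚP.*-identityˡ (u i w)))) , (λ w → sym (trans (ℚP.+-identityʳ _) (ℚP.*-identityˡ (u' i w))))

joint-span : ∀ {Q : I → Set} {u u' f f'} → JointSpan Q u u' f f' → Span Q u f
joint-span (L , q , h , _) = L , q , h

_≟L_ : (a b : List ℕ) → Dec (a ≡ b)
_≟L_ = ≡-dec ℕP._≟_

-- `expand` lists a partition once for every permutation producing it. The number of occurrences is
-- the diagonal coefficient, which has to be inverted over ℚ.
multiplicity : List ℕ → List (List ℕ) → ℕ
multiplicity a []       = 0
multiplicity a (x ∷ xs) with x ≟L a
... | yes _ = suc (multiplicity a xs)
... | no  _ = multiplicity a xs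

others : List ℕ → List (List ℕ) → List (List ℕ)
others a []       = []
others a (x ∷ xs) with x ≟L a
... | yes _ = others a xs
... | no  _ = x ∷ others a xs

∑-multiplicity : ∀ a xs f → ∑ xs f ≡ ℕtoℚ (multiplicity a xs) *q f a +q ∑ (others a xs) f
∑-multiplicity a []       f = sym (trans (ℚP.+-identityʳ _) (ℚP.*-zeroˡ (f a)))
∑-multiplicity a (x ∷ xs) f with x ≟L a
... | no  _    = trans (cong (f x +q_) (∑-multiplicity a xs f))
  (solve 3 (λ x y z → x :+ (y :+ z) := y :+ (x :+ z)) refl (f x) (ℕtoℚ (multiplicity a xs) *q f a) (∑ (others a xs) f))
... | yes refl = begin
  f x +q ∑ xs f
    ≡⟨ cong (f x +q_) (∑-multiplicity x xs f) ⟩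
  f x +q (ℕtoℚ m *q f x +q ∑ (others x xs) f)
    ≡⟨ solve 3 (λ x m z → x :+ (m :* x :+ z) := (con 1ℚ :+ m) :* x :+ z) refl (f x) (ℕtoℚ m) (∑ (others x xs) f) ⟩
  (1ℚ +q ℕtoℚ m) *q f x +q ∑ (others x xs) f
    ≡⟨ cong (λ c → c *q f x +q ∑ (others x xs) f) (sym (ℕtoℚ-+ 1 m)) ⟩
  ℕtoℚ (suc m) *q f x +q ∑ (others x xs) f ∎
  where m = multiplicity x xs

multiplicity>0 : ∀ {a xs} → a ∈ xs → 0 < multiplicity a xs
multiplicity>0 {a} {x ∷ xs} i with x ≟L a
... | yes _ = s≤s z≤n
multiplicity>0 (here refl) | no ne = ⊥-elim (ne refl)
multiplicity>0 (there i)   | no ne = multiplicity>0 i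

multiplicity≢0 : ∀ {a xs} → a ∈ xs → ℕtoℚ (multiplicity a xs) ≢ 0ℚ
multiplicity≢0 {a} {xs} i e = ℕP.<⇒≢ (multiplicity>0 i) (sym (ℕtoℚ-injective {multiplicity a xs} {0} e))

others-All : ∀ {Q : List ℕ → Set} a {xs} → All Q xs → All (λ x → Q x × (x ≢ a)) (others a xs)
others-All a {[]}     []       = []
others-All a {x ∷ xs} (p ∷ ps) with x ≟L a
... | yes _ = others-All a ps
... | no ne = (p , ne) ∷ others-All a ps

-- Since expand ρ consists of ρ and partitions with more blocks, the expansions can be inverted.
triangular : ∀ {Q : SetPartition → Set} {u u' : SetPartition → Series} {t t' : List ℕ → ℚ} →
  (∀ π w → u π w ≡ ∑ (expand (rev π)) (λ ρ → t ρ *q P ρ (reverse w))) →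
  (∀ π w → u' π w ≡ ∑ (expand (rev π)) (λ ρ → t' ρ *q P ρ (reverse w))) →
  (∀ {ρ} (r : RG ρ) → Q (partition r) ⊎ ((t ρ ≡ 0ℚ) × (t' ρ ≡ 0ℚ))) →
  ∀ {ρ} → RG ρ → JointSpan Q u u' (λ w → t ρ *q P ρ (reverse w)) (λ w → t' ρ *q P ρ (reverse w))
triangular {Q} {u} {u'} {t} {t'} U U' dec {ρ} r = go (suc (length ρ ∸ nb ρ)) r ℕP.≤-refl
  where
  go : ∀ n {ρ} (r : RG ρ) → length ρ ∸ nb ρ < n → JointSpan Q u u' (λ w → t ρ *q P ρ (reverse w)) (λ w → t' ρ *q P ρ (reverse w))
  go (suc n) {ρ} r lt with dec r
  ... | inj₂ (z , z') = joint-cong (λ w → trans (cong (_*q P ρ (reverse w)) z) (ℚP.*-zeroˡ (P ρ (reverse w))))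
                                   (λ w → trans (cong (_*q P ρ (reverse w)) z') (ℚP.*-zeroˡ (P ρ (reverse w)))) joint-0
  ... | inj₁ q = joint-cong (invert u t U) (invert u' t' U')
        (joint-* y (joint-+ (joint-of q) (joint-* -1ℚ (joint-∑ (others-All ρ (expand-refines r)) finer))))
    where
    k = ℕtoℚ (multiplicity ρ (expand ρ))
    y = proj₁ (inverse k (multiplicity≢0 (expand-self r)))
    yk≡1 : y *q k ≡ 1ℚ
    yk≡1 = proj₂ (inverse k (multiplicity≢0 (expand-self r)))
    invert : ∀ u t → (∀ π w → u π w ≡ ∑ (expand (rev π)) (λ ρ → t ρ *q P ρ (reverse w))) →
      (λ w → t ρ *q P ρ (reverse w)) ≈ (y ·S (u (partition r) +S (-1ℚ ·S (λ w → ∑ (others ρ (expand ρ)) (λ ρ' → t ρ' *q P ρ' (reverse w))))))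
    invert u t U w = sym (begin
      y *q (u (partition r) w +q -1ℚ *q S)
        ≡⟨ cong (λ c → y *q (c +q -1ℚ *q S)) (trans (U (partition r) w) (trans (cong (λ a → ∑ (expand a) (λ ρ → t ρ *q P ρ (reverse w))) (rev-partition r)) (∑-multiplicity ρ (expand ρ) _))) ⟩
      y *q (k *q x +q S +q -1ℚ *q S)
        ≡⟨ solve 4 (λ y k x s → y :* (k :* x :+ s :+ con -1ℚ :* s) := y :* k :* x) refl y k x S ⟩
      y *q k *q x
        ≡⟨ trans (cong (_*q x) yk≡1) (ℚP.*-identityˡ x) ⟩
      x ∎)
      where
      x = t ρ *q P ρ (reverse w)
      S = ∑ (others ρ (expand ρ)) (λ ρ' → t ρ' *q P ρ' (reverse w))
    finer : ∀ ρ' → Refines ρ ρ' × (ρ' ≢ ρ) → JointSpan Q u u' (λ w → t ρ' *q P ρ' (reverse w)) (λ w → t' ρ' *q P ρ' (reverse w))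
    finer ρ' ((r' , l , inj₁ e) , ne)  = ⊥-elim (ne e)
    finer ρ' ((r' , l , inj₂ nb<) , _) = go n r' (ℕP.≤-trans
      (ℕP.∸-monoʳ-< nb< (nb≤length r')) (ℕP.≤-trans (ℕP.≤-reflexive (cong (_∸ nb ρ) l)) (ℕP.≤-pred lt)))

-- Equation `i` involves, besides `c i`, only unknowns of smaller rank, which vanish by induction;
-- the diagonal entry is then cancelled.
triangular-independent : ∀ {I : Set} (rank : I → ℕ) (m : I → I → ℚ) (c : I → ℚ) {K : List I} {Q : I → Set} → Unique K → All Q K →
  (∀ i → Q i → ∑ K (λ j → c j *q m i j) ≡ 0ℚ) → (∀ i → Q i → m i i ≢ 0ℚ) →
  (∀ i j → Q i → Q j → m i j ≢ 0ℚ → (j ≡ i) ⊎ (rank j < rank i)) → All (λ i → c i ≡ 0ℚ) K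
triangular-independent {I} rank m c {K} {Q} u qs zero-sum diagonal tri = all-zero qs (λ i → i)
  where
  go : ∀ n i → i ∈ K → rank i < n → c i ≡ 0ℚ
  go (suc n) i i∈ lt = *-integral (diagonal i qi) (trans (ℚP.*-comm (m i i) (c i)) (trans (sym (∑-single u i∈ off)) (zero-sum i qi)))
    where
    qi = lookup-All qs i∈
    off : ∀ j → j ∈ K → j ≢ i → c j *q m i j ≡ 0ℚ
    off j j∈ ne with m i j ℚP.≟ 0ℚ
    ... | yes z = trans (cong (c j *q_) z) (ℚP.*-zeroʳ (c j))
    ... | no nz with tri i j qi (lookup-All qs j∈) nz
    ...   | inj₁ e = ⊥-elim (ne e)
    ...   | inj₂ r = trans (cong (_*q m i j) (go n j j∈ (ℕP.≤-trans r (ℕP.≤-pred lt)))) (ℚP.*-zeroˡ (m i j))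
  all-zero : ∀ {K'} → All Q K' → (∀ {i} → i ∈ K' → i ∈ K) → All (λ i → c i ≡ 0ℚ) K'
  all-zero []       sub = []
  all-zero (p ∷ ps) sub = go _ _ (sub (here refl)) ℕP.≤-refl ∷ all-zero ps (λ i → sub (there i))

-- Power sums evaluated at label words

look-has : ∀ b ρ a → length ρ ≡ length a → has b ρ ≡ true → has (look 0 b ρ a) a ≡ true
look-has b (x ∷ ρ) (y ∷ a) l h with has b ρ in eq
... | true  = has-weaken y (look 0 b ρ a) a (look-has b ρ a (ℕP.suc-injective l) eq)
... | false = has-here y a

look-self : ∀ b a → has b a ≡ true → look 0 b a a ≡ b
look-self b (x ∷ a) h with has b a in eq
... | true  = look-self b a eq
... | false with x ≡ᵇ b in e
...   | true  = ≡ᵇ-true x b e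
...   | false with () ← h

P-self : ∀ a → P a a ≡ 1ℚ
P-self []      = refl
P-self (b ∷ a) with has b a in eq
... | true  = trans (cong₂ (λ x y → x *q ind (y ≡ᵇ b)) (P-self a) (look-self b a eq)) (cong (λ c → 1ℚ *q ind c) (≡ᵇ-refl b))
... | false = cong (_*q 1ℚ) (P-self a)

factor≢0 : ∀ {x y : ℚ} → x *q y ≢ 0ℚ → (x ≢ 0ℚ) × (y ≢ 0ℚ)
factor≢0 {x} {y} h = (λ e → h (trans (cong (_*q y) e) (ℚP.*-zeroˡ y))) , (λ e → h (trans (cong (x *q_) e) (ℚP.*-zeroʳ x)))

-- A label string is itself a word, with equal letters exactly on its blocks. So p_ρ is nonzero on
-- it only if every block of ρ lies inside a block of `a`, and these words serve as test points for
-- independence.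
P-refines : ∀ {ρ a} → RG ρ → RG a → P ρ a ≢ 0ℚ → Refines a ρ
P-refines {[]}    {[]}    _ _ h = [] , refl , inj₁ refl
P-refines {[]}    {_ ∷ _} _ _ h = ⊥-elim (h refl)
P-refines {_ ∷ _} {[]}    _ _ h = ⊥-elim (h refl)
P-refines {b ∷ ρ} {x ∷ a} (b≤ ∷ r) (x≤ ∷ s) h with factor≢0 h
... | hP , hv with P-refines r s hP
... | _ , l , c with ℕP.m≤n⇒m<n∨m≡n b≤
...   | inj₁ b< with RG-has r b<
...     | hb rewrite hb = (b≤ ∷ r) , cong suc l , finer c
  where
  x≡ : look 0 b ρ a ≡ x
  x≡ = ≡ᵇ-true (look 0 b ρ a) x (ind≢0 hv)
  x< : x < nb a
  x< = has-< x a (subst (λ y → has y a ≡ true) x≡ (look-has b ρ a l hb))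
  finer : (ρ ≡ a) ⊎ (nb a < nb ρ) → (b ∷ ρ ≡ x ∷ a) ⊎ (nb (x ∷ a) < nb (b ∷ ρ))
  finer (inj₁ refl) = inj₁ (cong (_∷ ρ) (trans (sym (look-self b ρ hb)) x≡))
  finer (inj₂ lt)   = inj₂ (subst₂ _<_ (sym (nb-old a x<)) (sym (nb-old ρ b<)) lt)
P-refines {b ∷ ρ} {x ∷ a} (b≤ ∷ r) (x≤ ∷ s) h | hP , hv | _ , l , c | inj₂ refl = (b≤ ∷ r) , cong suc l , finer c (ℕP.m≤n⇒m<n∨m≡n x≤)
  where
  finer : (ρ ≡ a) ⊎ (nb a < nb ρ) → (x < nb a) ⊎ (x ≡ nb a) → (nb ρ ∷ ρ ≡ x ∷ a) ⊎ (nb (x ∷ a) < nb (nb ρ ∷ ρ))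
  finer (inj₁ refl) (inj₂ refl) = inj₁ refl
  finer (inj₂ lt)   (inj₂ refl) = inj₂ (subst₂ _<_ (sym (nb-new a)) (sym (nb-new ρ)) (s≤s lt))
  finer (inj₁ refl) (inj₁ x<)   = inj₂ (subst₂ _<_ (sym (nb-old a x<)) (sym (nb-new ρ)) ℕP.≤-refl)
  finer (inj₂ lt)   (inj₁ x<)   = inj₂ (subst₂ _<_ (sym (nb-old a x<)) (sym (nb-new ρ)) (ℕP.m≤n⇒m≤1+n lt))

colength : List ℕ → ℕ
colength a = length a ∸ nb a

P-independent : ∀ {K : List I} (f : I → List ℕ) → (∀ {i j} → f i ≡ f j → i ≡ j) → Unique K → All (λ i → RG (f i)) K → (c : I → ℚ) →
  (∀ w → ∑ K (λ i → c i *q P (f i) w) ≡ 0ℚ) → All (λ i → c i ≡ 0ℚ) K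
P-independent f inj u rs c zero-sum = triangular-independent (colength ∘ f) (λ i j → P (f j) (f i)) c u rs
  (λ i _ → zero-sum (f i)) (λ i _ e → 1≢0ℚ (trans (sym (P-self (f i))) e)) finer
  where
  finer : ∀ i j → RG (f i) → RG (f j) → P (f j) (f i) ≢ 0ℚ → (j ≡ i) ⊎ (colength (f j) < colength (f i))
  finer i j ri rj ne with P-refines rj ri ne
  ... | _ , l , inj₁ e  = inj₁ (inj e)
  ... | r , l , inj₂ lt = inj₂ (ℕP.≤-trans (ℕP.∸-monoʳ-< lt (nb≤length r)) (ℕP.≤-reflexive (cong (_∸ nb (f i)) l)))

-- Extracting coefficients from combinations of power sums

δ : List ℕ → List ℕ → ℚ
δ a b with a ≟L b
... | yes _ = 1ℚ
... | no  _ = 0ℚ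

δ-refl : ∀ a → δ a a ≡ 1ℚ
δ-refl a with a ≟L a
... | yes _ = refl
... | no ne = ⊥-elim (ne refl)

δ-≢ : ∀ {a b} → a ≢ b → δ a b ≡ 0ℚ
δ-≢ {a} {b} ne with a ≟L b
... | yes e = ⊥-elim (ne e)
... | no _  = refl

regroup : ∀ (L : List (List ℕ × ℚ)) {U} → Unique U → (∀ {x} → x ∈ L → proj₁ x ∈ U) → ∀ (θ : List ℕ → ℚ) →
  ∑ L (λ x → proj₂ x *q θ (proj₁ x)) ≡ ∑ U (λ a → ∑ L (λ x → proj₂ x *q δ (proj₁ x) a) *q θ a)
regroup L {U} u sub θ = sym (begin
  ∑ U (λ a → ∑ L (λ x → proj₂ x *q δ (proj₁ x) a) *q θ a)
    ≡⟨ ∑-cong U (λ a → sym (∑-*ʳ L (θ a) (λ x → proj₂ x *q δ (proj₁ x) a))) ⟩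
  ∑ U (λ a → ∑ L (λ x → proj₂ x *q δ (proj₁ x) a *q θ a))
    ≡⟨ ∑-swap U L (λ a x → proj₂ x *q δ (proj₁ x) a *q θ a) ⟩
  ∑ L (λ x → ∑ U (λ a → proj₂ x *q δ (proj₁ x) a *q θ a))
    ≡⟨ inner L sub ⟩
  ∑ L (λ x → proj₂ x *q θ (proj₁ x)) ∎)
  where
  inner : ∀ K → (∀ {x} → x ∈ K → proj₁ x ∈ U) → ∑ K (λ x → ∑ U (λ a → proj₂ x *q δ (proj₁ x) a *q θ a)) ≡ ∑ K (λ x → proj₂ x *q θ (proj₁ x))
  inner []            sub = refl
  inner ((a , c) ∷ K) sub = cong₂ _+q_
    (trans (∑-single {x = a} u (sub (here refl)) (λ b _ ne → trans (cong (λ d → c *q d *q θ b) (δ-≢ (ne ∘ sym)))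
        (solve 2 (λ c t → c :* con 0ℚ :* t := con 0ℚ) refl c (θ b))))
      (trans (cong (λ d → c *q d *q θ a) (δ-refl a)) (cong (_*q θ a) (ℚP.*-identityʳ c))))
    (inner K (λ i → sub (there i)))

-- A list may mention a partition several times, so its entries need not vanish one by one. What
-- vanishes is the total coefficient of each partition, and with it every linear functional `θ` of
-- the combination; taking `θ` to be a coordinate extracts a coefficient.
P-coefficients : ∀ (L : List (List ℕ × ℚ)) → All (λ x → RG (proj₁ x)) L → (∀ w → ∑ L (λ x → proj₂ x *q P (proj₁ x) w) ≡ 0ℚ) →
  ∀ θ → ∑ L (λ x → proj₂ x *q θ (proj₁ x)) ≡ 0ℚ
P-coefficients L rs zero-sum θ = trans (regroup L u sub θ)
  (trans (∑-cong-All zeros (λ a z → trans (cong (_*q θ a) z) (ℚP.*-zeroˡ (θ a)))) (∑-0 U))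
  where
  U = deduplicate _≟L_ (map proj₁ L)
  u : Unique U
  u = DecUniqueP.deduplicate-! _≟L_ (map proj₁ L)
  sub : ∀ {x} → x ∈ L → proj₁ x ∈ U
  sub i = ∈-deduplicate⁺ _≟L_ (∈-map⁺ proj₁ i)
  rU : ∀ {a} → a ∈ U → RG a
  rU i with ∈-map⁻ proj₁ (∈-deduplicate⁻ _≟L_ (map proj₁ L) i)
  ... | x , x∈ , refl = lookup-All rs x∈
  rsU : ∀ K → (∀ {a} → a ∈ K → a ∈ U) → All RG K
  rsU []      h = []
  rsU (a ∷ K) h = rU (h (here refl)) ∷ rsU K (λ i → h (there i))
  zeros : All (λ a → ∑ L (λ x → proj₂ x *q δ (proj₁ x) a) ≡ 0ℚ) U
  zeros = P-independent id (λ e → e) u (rsU U (λ i → i)) (λ a → ∑ L (λ x → proj₂ x *q δ (proj₁ x) a))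
    (λ w → trans (sym (regroup L u sub (λ a → P a w))) (zero-sum w))

-- Odd blocks

OddBlocks : List ℕ → Set
OddBlocks a = ∀ b → has b a ≡ true → odd? b a ≡ true

isOddB-suc : ∀ n → isOddB (suc n) ≡ not (isOddB n)
isOddB-suc zero          = refl
isOddB-suc (suc n) = trans (sym (not-not (isOddB n))) (cong not (sym (isOddB-suc n)))

count-odd : ∀ b a → isOddB (countB (λ j → at (reverse a) j ≡ᵇ b) (range1 (length a))) ≡ odd? b a
count-odd b []      = refl
count-odd b (x ∷ a) = trans (cong isOddB (trans (countB-range-suc _ (length a)) (cong₂ (λ p k → if p then suc k else k)
    (cong (_≡ᵇ b) (at-reverse-top x a)) (countB-cong (length a) (λ j 1≤j j≤ → cong (_≡ᵇ b) (at-reverse-below x a (1≤j , j≤)))))))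
  (parity (x ≡ᵇ b))
  where
  k = countB (λ j → at (reverse a) j ≡ᵇ b) (range1 (length a))
  parity : ∀ p → isOddB (if p then suc k else k) ≡ (if p then not (odd? b a) else odd? b a)
  parity true  = trans (isOddB-suc k) (cong not (count-odd b a))
  parity false = count-odd b a

blockSize-odd : ∀ π b → isOddB (blockSize π b) ≡ odd? b (rev π)
blockSize-odd (l , _) b = trans (cong₂ (λ l' n → isOddB (countB (λ j → at l' j ≡ᵇ b) (range1 n))) (sym (reverse-involutive l)) (sym (length-reverse l)))
  (count-odd b (reverse l))

AllOdd⇒OddBlocks : ∀ π → AllOdd π → OddBlocks (rev π)
AllOdd⇒OddBlocks π@(l , _) o b h = trans (sym (blockSize-odd π b))
  (all-true (T⇒≡ o) (∈-upTo (subst (b <_) (nb-reverse l) (has-< b (reverse l) h))))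

OddBlocks⇒AllOdd : ∀ π → OddBlocks (rev π) → AllOdd π
OddBlocks⇒AllOdd π@(l , _) o = ≡⇒T (all-intro (upTo (nb l)) (λ {b} i →
  trans (blockSize-odd π b) (o b (RG-has (rev-RG π) (subst (b <_) (sym (nb-reverse l)) (upTo-∈ i))))))

all-false : ∀ {p : A → Bool} xs → all p xs ≡ false → Σ A λ x → (x ∈ xs) × (p x ≡ false)
all-false {p = p} (x ∷ xs) e with p x in eq
... | false = x , here refl , eq
... | true  with all-false xs e
...   | y , i , f = y , there i , f

xor-false : ∀ x → x xor false ≡ x
xor-false true  = refl
xor-false false = refl

τ-AllOdd : ∀ π → AllOdd π → τ (rev π) noFlip ≢ 0ℚ
τ-AllOdd π o = τ-odd (rev π) noFlip (λ b h → trans (xor-false _) (AllOdd⇒OddBlocks π o b h))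

-- The vanishing is stated twice in order to fit `triangular` with both of its families equal to q.
odd-or-zero : ∀ {ρ} (r : RG ρ) → AllOdd (partition r) ⊎ ((τ ρ noFlip ≡ 0ℚ) × (τ ρ noFlip ≡ 0ℚ))
odd-or-zero {ρ} r with allOddB (partition r) in eq
... | true  = inj₁ tt
... | false with all-false (upTo (nb (reverse ρ))) eq
...   | b , i , e = inj₂ (zero-τ , zero-τ)
  where
  zero-τ : τ ρ noFlip ≡ 0ℚ
  zero-τ = τ-even ρ noFlip b (RG-has r (subst (b <_) (nb-reverse ρ) (upTo-∈ i)))
    (trans (xor-false _) (trans (cong (odd? b) (sym (rev-partition r))) (trans (sym (blockSize-odd (partition r) b)) e)))

-- NCSym

Any-partition : SetPartition → Set
Any-partition _ = ⊤

hS-expand : ∀ π w → hS π w ≡ ∑ (expand (rev π)) (λ ρ → 1ℚ *q P ρ (reverse w))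
hS-expand π w = trans (hS-rev π w) (sym (H-expand (rev π) (reverse w)))

eS-expand : ∀ π w → eS π w ≡ ∑ (expand (rev π)) (λ ρ → ε ρ *q P ρ (reverse w))
eS-expand π w = trans (eS-rev π w) (sym (E-expand (rev π) (reverse w)))

-- The classical rule that ω multiplies p_ρ by a sign. It comes from inverting in parallel the
-- expansions of h and e, which run over the same partitions.
omega-p : ∀ {ρ} → RG ρ → JointSpan Any-partition hS eS (λ w → 1ℚ *q P ρ (reverse w)) (λ w → ε ρ *q P ρ (reverse w))
omega-p = triangular {u = hS} {u' = eS} {t = λ _ → 1ℚ} {t' = ε} hS-expand eS-expand (λ _ → inj₁ tt)

pS-partition : ∀ {ρ} (r : RG ρ) → (P ρ ∘ reverse) ≈ pS (partition r)
pS-partition r w = sym (trans (pS-rev (partition r) w) (cong (λ a → P a (reverse w)) (rev-partition r)))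

anyPartition : ∀ (L : List (SetPartition × ℚ)) → All (λ x → Any-partition (proj₁ x)) L
anyPartition []      = []
anyPartition (x ∷ L) = tt ∷ anyPartition L

m-in-p : ∀ π → Span Any-partition pS (mS π)
m-in-p π = span-cong (mS-rev π) (span-partition pS-rev (M-in-P (rev-RG π)))

NCSym-in-p : ∀ f → InNCSym f → Span Any-partition pS f
NCSym-in-p f (L , e) = span-bind {Q = Any-partition} {v = mS} {f = f} (λ π _ → m-in-p π) (L , anyPartition L , e)

h-in-NCSym : ∀ π → Span Any-partition mS (hS π)
h-in-NCSym π = span-cong (hS-expand π) (span-∑ (expand-refines (rev-RG π))
  (λ ρ R → span-* 1ℚ (span-partition mS-rev (P-in-M (proj₁ R)))))

span-NCSym : ∀ {f} → Span Any-partition mS f → InNCSym f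
span-NCSym (L , _ , e) = L , e

lincomb-h-NCSym : ∀ L → InNCSym (lincomb hS L)
lincomb-h-NCSym L = span-NCSym {lincomb hS L}
  (span-bind {Q = Any-partition} {v = hS} {f = lincomb hS L} (λ π _ → h-in-NCSym π) (L , anyPartition L , λ w → refl))

-- Linearity of the relation defining Θ

scaleTerm : ℚ → ThetaTerm → ThetaTerm
scaleTerm c (thetaTerm n B σ γ d) = thetaTerm n B σ γ (c *q d)

sumF-scale : ∀ c L → sumF (map (scaleTerm c) L) ≈ c ·S sumF L
sumF-scale c []      w = sym (ℚP.*-zeroʳ c)
sumF-scale c (t ∷ L) w = trans (cong₂ _+q_ (ℚP.*-assoc c (ThetaTerm.coeff t) (termF t w)) (sumF-scale c L w)) (sym (ℚP.*-distribˡ-+ c _ _))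

sumK-scale : ∀ c L → sumK (map (scaleTerm c) L) ≈ c ·S sumK L
sumK-scale c []      w = sym (ℚP.*-zeroʳ c)
sumK-scale c (t ∷ L) w = trans (cong₂ _+q_ (ℚP.*-assoc c (ThetaTerm.coeff t) (termK t w)) (sumK-scale c L w)) (sym (ℚP.*-distribˡ-+ c _ _))

sumF-++ : ∀ L K → sumF (L ++ K) ≈ sumF L +S sumF K
sumF-++ []      K w = sym (ℚP.+-identityˡ (sumF K w))
sumF-++ (t ∷ L) K w = trans (cong (ThetaTerm.coeff t *q termF t w +q_) (sumF-++ L K w)) (sym (ℚP.+-assoc (ThetaTerm.coeff t *q termF t w) (sumF L w) (sumF K w)))

sumK-++ : ∀ L K → sumK (L ++ K) ≈ sumK L +S sumK K
sumK-++ []      K w = sym (ℚP.+-identityˡ (sumK K w))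
sumK-++ (t ∷ L) K w = trans (cong (ThetaTerm.coeff t *q termK t w +q_) (sumK-++ L K w)) (sym (ℚP.+-assoc (ThetaTerm.coeff t *q termK t w) (sumK L w) (sumK K w)))

theta-+ : ∀ {f g f' g'} c → ThetaRel f g → ThetaRel f' g' → ThetaRel ((c ·S f) +S f') ((c ·S g) +S g')
theta-+ c (K , v , e , e') (K' , v' , d , d') = map (scaleTerm c) K ++ K' , AllP.++⁺ (All-map (λ _ p → p) v) v' ,
  (λ w → trans (cong₂ _+q_ (trans (cong (c *q_) (e w)) (sym (sumF-scale c K w))) (d w)) (sym (sumF-++ (map (scaleTerm c) K) K' w))) ,
  (λ w → trans (cong₂ _+q_ (trans (cong (c *q_) (e' w)) (sym (sumK-scale c K w))) (d' w)) (sym (sumK-++ (map (scaleTerm c) K) K' w)))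

theta-lincomb : ∀ (f g : I → Series) → (∀ i → ThetaRel (f i) (g i)) → ∀ L → ThetaRel (lincomb f L) (lincomb g L)
theta-lincomb f g θ []            = [] , [] , (λ w → refl) , (λ w → refl)
theta-lincomb f g θ ((i , c) ∷ L) = theta-+ {f i} {g i} {lincomb f L} {lincomb g L} c (θ i) (theta-lincomb f g θ L)

independent-p : LinIndep AllOdd pS
independent-p K u os c z = P-independent rev rev-injective u (rgs K) c
  (λ w → trans (∑-cong K (λ π → cong (c π *q_) (sym (trans (pS-rev π (reverse w)) (cong (P (rev π)) (reverse-involutive w))))))
    (trans (sym (trans (lincomb-∑ pS (map (λ i → i , c i) K) (reverse w)) (∑-map (λ i → i , c i) K _))) (z (reverse w))))
  where
  rgs : ∀ K → All (λ π → RG (rev π)) K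
  rgs []      = []
  rgs (π ∷ K) = rev-RG π ∷ rgs K

-- The functions q: invariance under ω and bases of NCΩ

module Image (q : SetPartition → Series) (θ : ∀ π → ThetaRel (hS π) (q π)) where

  q-expand : ∀ π w → q π w ≡ ∑ (expand (rev π)) (λ ρ → τ ρ noFlip *q P ρ (reverse w))
  q-expand π w = begin
    q π w
      ≡⟨ theta-transform (θ π) w ⟩
    transform (hS π) w
      ≡⟨ transform-cong {hS π} {λ u → ∑ (expand (rev π)) (λ ρ → 1ℚ *q P ρ (reverse u))} w (λ u _ → hS-expand π u) ⟩
    transform (λ u → ∑ (expand (rev π)) (λ ρ → 1ℚ *q P ρ (reverse u))) w
      ≡⟨ transform-∑ (expand (rev π)) (λ ρ u → 1ℚ *q P ρ (reverse u)) w ⟩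
    ∑ (expand (rev π)) (λ ρ → transform (λ u → 1ℚ *q P ρ (reverse u)) w)
      ≡⟨ ∑-cong (expand (rev π)) (λ ρ → trans (transform-* 1ℚ (P ρ ∘ reverse) w) (trans (ℚP.*-identityˡ _) (transform-P ρ w))) ⟩
    ∑ (expand (rev π)) (λ ρ → τ ρ noFlip *q P ρ (reverse w)) ∎

  omega-q : ∀ π → OmegaRel (q π) (q π)
  omega-q π = joint-omega (joint-cong
      (λ w → trans (q-expand π w) (∑-cong (expand (rev π)) (λ ρ → cong (τ ρ noFlip *q_) (sym (ℚP.*-identityˡ (P ρ (reverse w)))))))
      (λ w → trans (q-expand π w) (∑-cong (expand (rev π)) (λ ρ → sign ρ (P ρ (reverse w)))))
      (joint-∑ (expand-refines (rev-RG π)) (λ ρ R → joint-* (τ ρ noFlip) (omega-p (proj₁ R)))))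
    where
    joint-omega : ∀ {f} → JointSpan Any-partition hS eS f f → OmegaRel f f
    joint-omega (L , _ , e , e') = L , e , e'
    sign : ∀ ρ x → τ ρ noFlip *q x ≡ τ ρ noFlip *q (ε ρ *q x)
    sign ρ x = by-zero (τ ρ noFlip ℚP.≟ 0ℚ)
      where
      by-zero : Dec (τ ρ noFlip ≡ 0ℚ) → τ ρ noFlip *q x ≡ τ ρ noFlip *q (ε ρ *q x)
      by-zero (yes z) = trans (trans (cong (_*q x) z) (ℚP.*-zeroˡ x)) (sym (trans (cong (_*q (ε ρ *q x)) z) (ℚP.*-zeroˡ (ε ρ *q x))))
      by-zero (no ne) = cong (τ ρ noFlip *q_) (sym (trans (cong (_*q x) (τ-ε ρ ne)) (ℚP.*-identityˡ x)))

  τp-in-q : ∀ {ρ} → RG ρ → Span AllOdd q (λ w → τ ρ noFlip *q P ρ (reverse w))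
  τp-in-q r = joint-span (triangular {u = q} {u' = q} {t = t} {t' = t} q-expand q-expand odd-or-zero r)
    where
    t : List ℕ → ℚ
    t ρ = τ ρ noFlip

  q-in-odd : ∀ π → Span AllOdd q (q π)
  q-in-odd π = span-cong (q-expand π) (span-∑ (expand-refines (rev-RG π)) (λ ρ R → τp-in-q (proj₁ R)))

  p-in-q : ∀ π → AllOdd π → Span AllOdd q (pS π)
  p-in-q π o = span-cong e (span-* (proj₁ inv) (τp-in-q (rev-RG π)))
    where
    t = τ (rev π) noFlip
    inv = inverse t (τ-AllOdd π o)
    e : pS π ≈ (proj₁ inv ·S (λ w → t *q P (rev π) (reverse w)))
    e w = trans (pS-rev π w) (sym (trans (sym (ℚP.*-assoc (proj₁ inv) t _)) (trans (cong (_*q P (rev π) (reverse w)) (proj₂ inv)) (ℚP.*-identityˡ _))))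

  -- A preimage has to be given together with an expansion into F. The expansions that `θ` provides
  -- for the h_π are combined with the coefficients of `f` in the q_π.
  span-NCΩ : ∀ {Q : SetPartition → Set} {f} → Span Q q f → InNCΩ f
  span-NCΩ {f = f} (L , _ , e) = lincomb hS L , lincomb-h-NCSym L , respond (theta-lincomb hS q θ L)
    where
    respond : ThetaRel (lincomb hS L) (lincomb q L) → ThetaRel (lincomb hS L) f
    respond (K , v , d , d') = K , v , d , λ w → trans (e w) (d' w)

  -- Θ multiplies p_ρ by τ_ρ, which vanishes unless all blocks are odd.
  NCΩ-in-τp : ∀ {Q : SetPartition → Set} {v} → (∀ π → Span Q v (λ w → τ (rev π) noFlip *q P (rev π) (reverse w))) → ∀ g → InNCΩ g → Span Q v g
  NCΩ-in-τp {Q} {v} h g (f , fN , fg) = from-p (NCSym-in-p f fN)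
    where
    from-p : Span Any-partition pS f → Span Q v g
    from-p (L , q , e) = span-cong image (span-∑ q (λ x _ → span-* (proj₂ x) (h (proj₁ x))))
      where
      image : g ≈ (λ w → ∑ L (λ x → proj₂ x *q (τ (rev (proj₁ x)) noFlip *q P (rev (proj₁ x)) (reverse w))))
      image w = begin
        g w
          ≡⟨ theta-transform fg w ⟩
        transform f w
          ≡⟨ transform-cong {f} {λ u → ∑ L (λ x → proj₂ x *q P (rev (proj₁ x)) (reverse u))} w
               (λ u _ → trans (e u) (trans (lincomb-∑ pS L u) (∑-cong L (λ x → cong (proj₂ x *q_) (pS-rev (proj₁ x) u))))) ⟩
        transform (λ u → ∑ L (λ x → proj₂ x *q P (rev (proj₁ x)) (reverse u))) w
          ≡⟨ transform-∑ L (λ x u → proj₂ x *q P (rev (proj₁ x)) (reverse u)) w ⟩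
        ∑ L (λ x → transform (λ u → proj₂ x *q P (rev (proj₁ x)) (reverse u)) w)
          ≡⟨ ∑-cong L (λ x → trans (transform-* (proj₂ x) (P (rev (proj₁ x)) ∘ reverse) w) (cong (proj₂ x *q_) (transform-P (rev (proj₁ x)) w))) ⟩
        ∑ L (λ x → proj₂ x *q (τ (rev (proj₁ x)) noFlip *q P (rev (proj₁ x)) (reverse w))) ∎

  spans-q : SpansNCΩ AllOdd q
  spans-q = NCΩ-in-τp (λ π → τp-in-q (rev-RG π))

  spans-p : SpansNCΩ AllOdd pS
  spans-p = NCΩ-in-τp odd-p
    where
    odd-p : ∀ π → Span AllOdd pS (λ w → τ (rev π) noFlip *q P (rev π) (reverse w))
    odd-p π = by-parity (odd-or-zero (rev-RG π))
      where
      t = τ (rev π) noFlip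
      by-parity : AllOdd (partition (rev-RG π)) ⊎ ((t ≡ 0ℚ) × (t ≡ 0ℚ)) → Span AllOdd pS (λ w → t *q P (rev π) (reverse w))
      by-parity (inj₁ o)       = span-cong (λ w → cong (t *q_) (pS-partition (rev-RG π) w)) (span-* t (span-of {v = pS} {i = partition (rev-RG π)} o))
      by-parity (inj₂ (z , _)) = span-cong (λ w → trans (cong (_*q P (rev π) (reverse w)) z) (ℚP.*-zeroˡ (P (rev π) (reverse w)))) span-0

  -- `m i j` is the coefficient of p_i in q_j, read off with the functional `δ`. It vanishes unless
  -- `i` is `j` or has more blocks, so the system is triangular when ranked by the number of blocks;
  -- the diagonal is nonzero because `τ` is nonzero on odd partitions.
  independent-q : LinIndep AllOdd q
  independent-q K u os c z = triangular-independent (nb ∘ rev) m c u os zero-sum diagonal finer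
    where
    m : SetPartition → SetPartition → ℚ
    m i j = ∑ (expand (rev j)) (λ ρ → τ ρ noFlip *q δ ρ (rev i))
    L : List (List ℕ × ℚ)
    L = concatMap (λ π → map (λ ρ → ρ , c π *q τ ρ noFlip) (expand (rev π))) K
    L-sum : ∀ (φ : List ℕ → ℚ) → ∑ L (λ x → proj₂ x *q φ (proj₁ x)) ≡ ∑ K (λ π → c π *q ∑ (expand (rev π)) (λ ρ → τ ρ noFlip *q φ ρ))
    L-sum φ = trans (∑-concatMap _ K _) (∑-cong K (λ π → trans (∑-map _ (expand (rev π)) _)
      (trans (∑-cong (expand (rev π)) (λ ρ → ℚP.*-assoc (c π) (τ ρ noFlip) (φ ρ))) (∑-*ˡ (expand (rev π)) (c π) _))))
    rgs : ∀ K → All (λ x → RG (proj₁ x)) (concatMap (λ π → map (λ ρ → ρ , c π *q τ ρ noFlip) (expand (rev π))) K)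
    rgs []      = []
    rgs (π ∷ K) = AllP.++⁺ (All-map (λ ρ R → proj₁ R) (expand-refines (rev-RG π))) (rgs K)
    zero-sum : ∀ i → AllOdd i → ∑ K (λ j → c j *q m i j) ≡ 0ℚ
    zero-sum i _ = trans (sym (L-sum (λ ρ → δ ρ (rev i)))) (P-coefficients L (rgs K)
      (λ w → trans (L-sum (λ ρ → P ρ w)) (trans (∑-cong K (λ π → cong (c π *q_)
          (trans (∑-cong (expand (rev π)) (λ ρ → cong (λ v → τ ρ noFlip *q P ρ v) (sym (reverse-involutive w)))) (sym (q-expand π (reverse w))))))
        (trans (sym (trans (lincomb-∑ q (map (λ i → i , c i) K) (reverse w)) (∑-map (λ i → i , c i) K _))) (z (reverse w)))))
      (λ ρ → δ ρ (rev i)))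
    diagonal : ∀ i → AllOdd i → m i i ≢ 0ℚ
    diagonal i o e = *≢0 (multiplicity≢0 (expand-self (rev-RG i))) (τ-AllOdd i o) (begin
      k *q τ (rev i) noFlip
        ≡⟨ sym (trans (cong₂ _+q_ (cong (λ d → k *q (τ (rev i) noFlip *q d)) (δ-refl (rev i)))
             (trans (∑-cong-All (others-All (rev i) (expand-refines (rev-RG i)))
               (λ ρ R → trans (cong (τ ρ noFlip *q_) (δ-≢ (proj₂ R))) (ℚP.*-zeroʳ (τ ρ noFlip)))) (∑-0 (others (rev i) (expand (rev i))))))
             (solve 2 (λ k t → k :* (t :* con 1ℚ) :+ con 0ℚ := k :* t) refl k (τ (rev i) noFlip))) ⟩
      k *q (τ (rev i) noFlip *q δ (rev i) (rev i)) +q ∑ (others (rev i) (expand (rev i))) (λ ρ → τ ρ noFlip *q δ ρ (rev i))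
        ≡⟨ sym (∑-multiplicity (rev i) (expand (rev i)) (λ ρ → τ ρ noFlip *q δ ρ (rev i))) ⟩
      m i i
        ≡⟨ e ⟩
      0ℚ ∎)
      where k = ℕtoℚ (multiplicity (rev i) (expand (rev i)))
    finer : ∀ i j → AllOdd i → AllOdd j → m i j ≢ 0ℚ → (j ≡ i) ⊎ (nb (rev j) < nb (rev i))
    finer i j _ _ ne = compare (rev j ≟L rev i) (nb (rev j) ℕP.<? nb (rev i))
      where
      absent : rev j ≢ rev i → ¬ (nb (rev j) < nb (rev i)) → ¬ Refines (rev j) (rev i)
      absent j≢i nlt (_ , _ , inj₁ e)  = j≢i (sym e)
      absent j≢i nlt (_ , _ , inj₂ lt) = nlt lt
      vanish : ¬ Refines (rev j) (rev i) → m i j ≡ 0ℚ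
      vanish h = trans (∑-cong-All (expand-refines (rev-RG j)) (λ ρ R →
        trans (cong (τ ρ noFlip *q_) (δ-≢ {ρ} {rev i} (λ e → h (subst (Refines (rev j)) e R)))) (ℚP.*-zeroʳ (τ ρ noFlip)))) (∑-0 (expand (rev j)))
      compare : Dec (rev j ≡ rev i) → Dec (nb (rev j) < nb (rev i)) → (j ≡ i) ⊎ (nb (rev j) < nb (rev i))
      compare (yes e)   _        = inj₁ (rev-injective e)
      compare (no _)    (yes lt) = inj₂ lt
      compare (no j≢i)  (no nlt) = ⊥-elim (ne (vanish (absent j≢i nlt)))

  basis-q : IsBasisNCΩ AllOdd q
  basis-q = (λ π _ → span-NCΩ {AllOdd} {q π} (q-in-odd π)) , independent-q , spans-q

  basis-p : IsBasisNCΩ AllOdd pS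
  basis-p = (λ π o → span-NCΩ {AllOdd} {pS π} (p-in-q π o)) , independent-p , spans-p

-- Concatenation: the labels of the right factor are shifted past those of the left one

cat : List ℕ → List ℕ → List ℕ
cat a []      = a
cat a (x ∷ b) = nb a + x ∷ cat a b

nb-cat : ∀ a b → nb (cat a b) ≡ nb a + nb b
nb-cat a []      = sym (ℕP.+-identityʳ (nb a))
nb-cat a (x ∷ b) = trans (cong₂ _⊔_ (sym (ℕP.+-suc (nb a) x)) (nb-cat a b)) (sym (ℕP.+-distribˡ-⊔ (nb a) (suc x) (nb b)))

RG-cat : ∀ {a b} → RG a → RG b → RG (cat a b)
RG-cat r []                      = r
RG-cat {a} {x ∷ b} r (x≤ ∷ s) = subst (nb a + x ≤_) (sym (nb-cat a b)) (ℕP.+-monoʳ-≤ (nb a) x≤) ∷ RG-cat r s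

length-cat : ∀ a b → length (cat a b) ≡ length b + length a
length-cat a []      = refl
length-cat a (x ∷ b) = cong suc (length-cat a b)

+-≡ᵇ : ∀ k m n → (k + m ≡ᵇ k + n) ≡ (m ≡ᵇ n)
+-≡ᵇ zero    m n = refl
+-≡ᵇ (suc k) m n = +-≡ᵇ k m n

has-beyond : ∀ a x → has (nb a + x) a ≡ false
has-beyond a x with has (nb a + x) a in eq
... | false = refl
... | true  = ⊥-elim (ℕP.<⇒≱ (has-< (nb a + x) a eq) (ℕP.m≤m+n (nb a) x))

has-cat : ∀ a x b → has (nb a + x) (cat a b) ≡ has x b
has-cat a x []      = has-beyond a x
has-cat a x (z ∷ b) = cong₂ _∨_ (+-≡ᵇ (nb a) z x) (has-cat a x b)

look-cat : ∀ a x b y u → length b ≡ length y → has x b ≡ true → look 0 (nb a + x) (cat a b) (y ++ u) ≡ look 0 x b y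
look-cat a x (z ∷ b) (v ∷ y) u l h rewrite has-cat a x b with has x b in eq
... | true  = look-cat a x b y u (ℕP.suc-injective l) eq
... | false = refl

P-cat : ∀ a b y u → length a ≡ length u → P (cat a b) (y ++ u) ≡ P a u *q P b y
P-cat a b y u la with length b ℕP.≟ length y
... | no ne = trans (P-length (cat a b) (y ++ u) (λ e → ne (ℕP.+-cancelʳ-≡ (length u) (length b) (length y)
    (trans (cong (λ k → length b + k) (sym la)) (trans (sym (length-cat a b)) (trans e (length-++ y)))))))
  (sym (trans (cong (P a u *q_) (P-length b y ne)) (ℚP.*-zeroʳ (P a u))))
... | yes l = go b y l
  where
  go : ∀ b y → length b ≡ length y → P (cat a b) (y ++ u) ≡ P a u *q P b y
  go []      []      l = sym (ℚP.*-identityʳ (P a u))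
  go (x ∷ b) (v ∷ y) l = trans (cong₂ _*q_ (go b y l′) last) (ℚP.*-assoc (P a u) (P b y) (if has x b then ind (look 0 x b y ≡ᵇ v) else 1ℚ))
    where
    l′ = ℕP.suc-injective l
    last : (if has (nb a + x) (cat a b) then ind (look 0 (nb a + x) (cat a b) (y ++ u) ≡ᵇ v) else 1ℚ) ≡ (if has x b then ind (look 0 x b y ≡ᵇ v) else 1ℚ)
    last rewrite has-cat a x b with has x b in eq
    ... | true  = cong (λ z → ind (z ≡ᵇ v)) (look-cat a x b y u l′ eq)
    ... | false = refl

flip-cong : ∀ b {g g'} c → g c ≡ g' c → flip b g c ≡ flip b g' c
flip-cong b c e with c ≡ᵇ b
... | true  = cong not e
... | false = e

τ-cong : ∀ a {g g'} → (∀ c → has c a ≡ true → g c ≡ g' c) → τ a g ≡ τ a g'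
τ-cong []      h = refl
τ-cong (b ∷ a) {g} {g'} h with has b a
... | true  = τ-cong a (λ c hc → flip-cong b {g} {g'} c (h c (has-weaken b c a hc)))
... | false = cong₂ (λ x y → evenFactor x *q y) (h b (has-here b a)) (τ-cong a (λ c hc → h c (has-weaken b c a hc)))

τ-cat : ∀ a b g → τ (cat a b) g ≡ τ a g *q τ b (λ c → g (nb a + c))
τ-cat a []      g = sym (ℚP.*-identityʳ (τ a g))
τ-cat a (x ∷ b) g rewrite has-cat a x b with has x b
... | true  = trans (τ-cat a b (flip (nb a + x) g)) (cong₂ _*q_
    (τ-cong a (λ c h → flip-there g (λ { refl → true≢false h (has-beyond a x) })))
    (τ-cong b (λ c _ → cong (λ z → if z then not (g (nb a + c)) else g (nb a + c)) (+-≡ᵇ (nb a) c x))))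
... | false = trans (cong (evenFactor (g (nb a + x)) *q_) (τ-cat a b g))
    (solve 3 (λ e s t → e :* (s :* t) := s :* (e :* t)) refl (evenFactor (g (nb a + x))) (τ a g) (τ b (λ c → g (nb a + c))))

indices-cat : ∀ a x b → indices (nb a + x) (cat a b) ≡ indices x b
indices-cat a x []      = indices-absent (nb a + x) a (has-beyond a x)
indices-cat a x (z ∷ b) = cong₂ (λ p l → if p then 0 ∷ map suc l else map suc l) (+-≡ᵇ (nb a) z x) (indices-cat a x b)

lookup-cat : ∀ a b i → i < length b → lookupD (cat a b) i ≡ nb a + lookupD b i
lookup-cat a (x ∷ b) zero    lt       = refl
lookup-cat a (x ∷ b) (suc i) (s≤s lt) = lookup-cat a b i lt

∑-extend-cat : ∀ ρ ρ' {n} {J} → All (_< n) J → length ρ' ≡ n → ∀ F → ∑ (extend J (cat ρ ρ')) F ≡ ∑ (extend J ρ') (F ∘ cat ρ)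
∑-extend-cat ρ ρ' {J = J} bs l F = cong₂ _+q_ (cong (λ z → F (z ∷ cat ρ ρ')) (nb-cat ρ ρ'))
  (trans (∑-map (attach (cat ρ ρ')) J F) (trans (∑-cong-All bs (λ i i< → cong (λ z → F (z ∷ cat ρ ρ')) (lookup-cat ρ ρ' i (subst (i <_) (sym l) i<))))
    (sym (∑-map (attach ρ') J (F ∘ cat ρ)))))

-- No cycle joins the two factors: the earlier positions in the block of a right-hand position all
-- lie in the right factor. So a block-preserving permutation of a concatenation is a pair of such
-- permutations.
∑-expand-cat : ∀ a b F → ∑ (expand (cat a b)) F ≡ ∑ (expand a) (λ ρ → ∑ (expand b) (λ ρ' → F (cat ρ ρ')))
∑-expand-cat a []      F = ∑-cong (expand a) (λ ρ → sym (ℚP.+-identityʳ (F ρ)))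
∑-expand-cat a (x ∷ b) F = begin
  ∑ (concatMap (extend (indices (nb a + x) (cat a b))) (expand (cat a b))) F
    ≡⟨ ∑-concatMap (extend (indices (nb a + x) (cat a b))) (expand (cat a b)) F ⟩
  ∑ (expand (cat a b)) (λ r → ∑ (extend (indices (nb a + x) (cat a b)) r) F)
    ≡⟨ ∑-cong (expand (cat a b)) (λ r → cong (λ J → ∑ (extend J r) F) (indices-cat a x b)) ⟩
  ∑ (expand (cat a b)) (λ r → ∑ (extend (indices x b) r) F)
    ≡⟨ ∑-expand-cat a b (λ r → ∑ (extend (indices x b) r) F) ⟩
  ∑ (expand a) (λ ρ → ∑ (expand b) (λ ρ' → ∑ (extend (indices x b) (cat ρ ρ')) F))
    ≡⟨ ∑-cong (expand a) (λ ρ → trans (∑-cong-All (expand-length b) (λ ρ' l → ∑-extend-cat ρ ρ' (bounds (indices-sound x b)) l F))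
         (sym (∑-concatMap (extend (indices x b)) (expand b) (F ∘ cat ρ)))) ⟩
  ∑ (expand a) (λ ρ → ∑ (expand (x ∷ b)) (λ ρ' → F (cat ρ ρ'))) ∎
  where
  bounds : ∀ {J} → All (IndexOf x b) J → All (_< length b) J
  bounds []       = []
  bounds (p ∷ ps) = proj₁ p ∷ bounds ps

-- Products of series

foldr-∑ : ∀ (xs : List A) f → foldr _+q_ 0ℚ (map f xs) ≡ ∑ xs f
foldr-∑ []       f = refl
foldr-∑ (x ∷ xs) f = cong (f x +q_) (foldr-∑ xs f)

length-take : ∀ {k} (w : List ℕ) → k ≤ length w → length (take k w) ≡ k
length-take {zero}  w       h       = refl
length-take {suc k} (x ∷ w) (s≤s h) = cong suc (length-take w h)

take-++-drop : ∀ k (w : List ℕ) → take k w ++ drop k w ≡ w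
take-++-drop zero    w       = refl
take-++-drop (suc k) []      = refl
take-++-drop (suc k) (x ∷ w) = cong (x ∷_) (take-++-drop k w)

_HomogeneousOf_ : Series → ℕ → Set
f HomogeneousOf n = ∀ w → length w ≢ n → f w ≡ 0ℚ

-- Every cut other than the one after `n` letters gives the left factor an argument of the wrong
-- length.
*S-homogeneous : ∀ {f n} g w → f HomogeneousOf n → n ≤ length w → (f *S g) w ≡ f (take n w) *q g (drop n w)
*S-homogeneous {f} {n} g w h n≤ = trans (foldr-∑ (upTo (suc (length w))) (λ k → f (take k w) *q g (drop k w)))
  (∑-single {x = n} (UniqueP.upTo⁺ (suc (length w))) (∈-upTo (s≤s n≤)) (λ k k∈ ne →
    trans (cong (_*q g (drop k w)) (h (take k w) (λ e → ne (trans (sym (length-take w (ℕP.≤-pred (upTo-∈ k∈)))) e)))) (ℚP.*-zeroˡ (g (drop k w)))))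

*S-short : ∀ {f n} g w → f HomogeneousOf n → length w < n → (f *S g) w ≡ 0ℚ
*S-short {f} {n} g w h lt = trans (foldr-∑ (upTo (suc (length w))) (λ k → f (take k w) *q g (drop k w)))
  (trans (∑-cong-All (AllP.all-upTo (suc (length w))) (λ k k< → trans (cong (_*q g (drop k w)) (h (take k w)
      (λ e → ℕP.<⇒≱ lt (subst (_≤ length w) (trans (sym (length-take w (ℕP.≤-pred k<))) e) (ℕP.≤-pred k<))))) (ℚP.*-zeroˡ (g (drop k w)))))
    (∑-0 (upTo (suc (length w)))))

*S-cong : ∀ {f f' g g'} → f ≈ f' → g ≈ g' → f *S g ≈ f' *S g'
*S-cong {f} {f'} {g} {g'} e e' w = trans (foldr-∑ (upTo (suc (length w))) (λ k → f (take k w) *q g (drop k w)))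
  (trans (∑-cong (upTo (suc (length w))) (λ k → cong₂ _*q_ (e (take k w)) (e' (drop k w)))) (sym (foldr-∑ (upTo (suc (length w))) (λ k → f' (take k w) *q g' (drop k w)))))

infixr 7 _∙_
_∙_ : SetPartition → SetPartition → SetPartition
π ∙ σ = partition (RG-cat (rev-RG π) (rev-RG σ))

rev-∙ : ∀ π σ → rev (π ∙ σ) ≡ cat (rev π) (rev σ)
rev-∙ π σ = rev-partition (RG-cat (rev-RG π) (rev-RG σ))

shiftBy : ℕ → List ℕ → List ℕ
shiftBy k = map (λ x → k + x)

cat-++ : ∀ a b → cat a b ≡ shiftBy (nb a) b ++ a
cat-++ a []      = refl
cat-++ a (x ∷ b) = cong (nb a + x ∷_) (cat-++ a b)

labels-∙ : ∀ π σ → proj₁ (π ∙ σ) ≡ proj₁ π ++ shiftBy (nb (proj₁ π)) (proj₁ σ)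
labels-∙ π@(l , _) σ@(l' , _) = begin
  reverse (cat (reverse l) (reverse l'))
    ≡⟨ cong reverse (trans (cat-++ (reverse l) (reverse l')) (cong (λ k → shiftBy k (reverse l') ++ reverse l) (nb-reverse l))) ⟩
  reverse (shiftBy (nb l) (reverse l') ++ reverse l)
    ≡⟨ reverse-++ (shiftBy (nb l) (reverse l')) (reverse l) ⟩
  reverse (reverse l) ++ reverse (shiftBy (nb l) (reverse l'))
    ≡⟨ cong₂ _++_ (reverse-involutive l) (trans (sym (reverse-map (λ x → nb l + x) (reverse l'))) (cong (shiftBy (nb l)) (reverse-involutive l'))) ⟩
  l ++ shiftBy (nb l) l' ∎

∅ : SetPartition
∅ = [] , tt

record Multiplicative (v : SetPartition → Series) : Set where
  field
    unit : v ∅ ≈ 1S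
    mult : ∀ π σ → v (π ∙ σ) ≈ v π *S v σ

-- `V` acts on reversed words, so in `y ++ u` the letters `y` belong to the right factor `b`.
multiplicative : ∀ {v} (V : List ℕ → Series) → (∀ π w → v π w ≡ V (rev π) (reverse w)) → V [] [] ≡ 1ℚ →
  (∀ a w → length a ≢ length w → V a w ≡ 0ℚ) →
  (∀ a b y u → length a ≡ length u → V (cat a b) (y ++ u) ≡ V a u *q V b y) → Multiplicative v
multiplicative {v} V vV one off mul = record { unit = unit ; mult = mult }
  where
  unit : v ∅ ≈ 1S
  unit []      = trans (vV ∅ []) one
  unit (x ∷ w) = trans (vV ∅ (x ∷ w)) (off [] (reverse (x ∷ w)) (λ e → case trans e (length-reverse (x ∷ w)) of λ ()))
  homogeneous : ∀ π → v π HomogeneousOf length (rev π)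
  homogeneous π w ne = trans (vV π w) (off (rev π) (reverse w) (λ e → ne (trans (sym (length-reverse w)) (sym e))))
  mult : ∀ π σ → v (π ∙ σ) ≈ v π *S v σ
  mult π σ w with length (rev π) ℕP.≤? length w
  ... | yes n≤ = begin
    v (π ∙ σ) w
      ≡⟨ trans (vV (π ∙ σ) w) (cong (λ a → V a (reverse w)) (rev-∙ π σ)) ⟩
    V (cat (rev π) (rev σ)) (reverse w)
      ≡⟨ cong (V (cat (rev π) (rev σ))) (trans (cong reverse (sym (take-++-drop n w))) (reverse-++ (take n w) (drop n w))) ⟩
    V (cat (rev π) (rev σ)) (reverse (drop n w) ++ reverse (take n w))
      ≡⟨ mul (rev π) (rev σ) (reverse (drop n w)) (reverse (take n w)) (sym (trans (length-reverse (take n w)) (length-take w n≤))) ⟩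
    V (rev π) (reverse (take n w)) *q V (rev σ) (reverse (drop n w))
      ≡⟨ sym (cong₂ _*q_ (vV π (take n w)) (vV σ (drop n w))) ⟩
    v π (take n w) *q v σ (drop n w)
      ≡⟨ sym (*S-homogeneous (v σ) w (homogeneous π) n≤) ⟩
    (v π *S v σ) w ∎
    where n = length (rev π)
  ... | no n≰ = trans (trans (vV (π ∙ σ) w) (trans (cong (λ a → V a (reverse w)) (rev-∙ π σ)) (off (cat (rev π) (rev σ)) (reverse w)
      (λ e → n≰ (subst (length (rev π) ≤_) (trans (sym (length-cat (rev π) (rev σ))) (trans e (length-reverse w))) (ℕP.m≤n+m (length (rev π)) (length (rev σ))))))))
    (sym (*S-short (v σ) w (homogeneous π) (ℕP.≰⇒> n≰)))

multiplicative-p : Multiplicative pS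
multiplicative-p = multiplicative P pS-rev refl P-length P-cat

Qseries : List ℕ → Series
Qseries a w = ∑ (expand a) (λ ρ → τ ρ noFlip *q P ρ w)

Qseries-cat : ∀ a b y u → length a ≡ length u → Qseries (cat a b) (y ++ u) ≡ Qseries a u *q Qseries b y
Qseries-cat a b y u l = begin
  ∑ (expand (cat a b)) (λ ρ → τ ρ noFlip *q P ρ (y ++ u))
    ≡⟨ ∑-expand-cat a b (λ ρ → τ ρ noFlip *q P ρ (y ++ u)) ⟩
  ∑ (expand a) (λ ρ → ∑ (expand b) (λ ρ' → τ (cat ρ ρ') noFlip *q P (cat ρ ρ') (y ++ u)))
    ≡⟨ ∑-cong-All (expand-length a) (λ ρ lρ → trans (∑-cong (expand b) (λ ρ' → trans
         (cong₂ _*q_ (τ-cat ρ ρ' noFlip) (P-cat ρ ρ' y u (trans lρ l)))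
         (solve 4 (λ s t x z → s :* t :* (x :* z) := s :* x :* (t :* z)) refl (τ ρ noFlip) (τ ρ' noFlip) (P ρ u) (P ρ' y))))
       (∑-*ˡ (expand b) (τ ρ noFlip *q P ρ u) (λ ρ' → τ ρ' noFlip *q P ρ' y))) ⟩
  ∑ (expand a) (λ ρ → τ ρ noFlip *q P ρ u *q Qseries b y)
    ≡⟨ ∑-*ʳ (expand a) (Qseries b y) (λ ρ → τ ρ noFlip *q P ρ u) ⟩
  Qseries a u *q Qseries b y ∎

Qseries-length : ∀ a w → length a ≢ length w → Qseries a w ≡ 0ℚ
Qseries-length a w ne = trans (∑-cong-All (expand-length a) (λ ρ l → trans (cong (τ ρ noFlip *q_) (P-length ρ w (λ e → ne (trans (sym l) e)))) (ℚP.*-zeroʳ (τ ρ noFlip))))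
  (∑-0 (expand a))

-- Connected factors

SplitsAt : List ℕ → ℕ → Set
SplitsAt l m = ∀ j k → 1 ≤ j → j ≤ m → m < k → k ≤ length l → at l j ≢ at l k

splitB : List ℕ → ℕ → Bool
splitB l m = all (λ j → all (λ k → not (at l j ≡ᵇ at l k)) (map (λ i → m + i) (range1 (length l ∸ m)))) (range1 m)

not-true : ∀ {b} → not b ≡ true → b ≡ false
not-true {false} _ = refl

splitB-sound : ∀ l m → splitB l m ≡ true → SplitsAt l m
splitB-sound l m e j k 1≤j j≤m m<k k≤n = ≡ᵇ-false (at l j) (at l k) (not-true
  (all-true {p = λ k → not (at l j ≡ᵇ at l k)} (all-true e (∈-range1 1≤j j≤m)) k∈))
  where
  k∈ : k ∈ map (λ i → m + i) (range1 (length l ∸ m))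
  k∈ = subst (_∈ map (λ i → m + i) (range1 (length l ∸ m))) (ℕP.m+[n∸m]≡n (ℕP.<⇒≤ m<k))
    (∈-map⁺ (λ i → m + i) (∈-range1 (ℕP.m<n⇒0<n∸m m<k) (ℕP.∸-monoˡ-≤ m k≤n)))

splitB-complete : ∀ l m → SplitsAt l m → splitB l m ≡ true
splitB-complete l m s = all-intro (range1 m) (λ {j} j∈ → all-intro (map (λ i → m + i) (range1 (length l ∸ m)))
  (λ {k} k∈ → cong not (≡ᵇ-no (at l j) (at l k) (differ (range1-∈ j∈) (∈-map⁻ (λ i → m + i) k∈)))))
  where
  differ : ∀ {j k} → InRange m j → (Σ ℕ λ i → (i ∈ range1 (length l ∸ m)) × (k ≡ m + i)) → at l j ≢ at l k
  differ {j} (1≤j , j≤m) (i , i∈ , refl) with range1-∈ {i} {length l ∸ m} i∈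
  ... | 1≤i , i≤ = s j (m + i) 1≤j j≤m (subst (_≤ m + i) (ℕP.+-comm m 1) (ℕP.+-monoʳ-≤ m 1≤i))
    (subst (m + i ≤_) (ℕP.m+[n∸m]≡n (ℕP.<⇒≤ (ℕP.m∸n≢0⇒n<m {length l} {m} (λ z → ℕP.<⇒≱ 1≤i (subst (i ≤_) z i≤))))) (ℕP.+-monoʳ-≤ m i≤))

Connected : SetPartition → Set
Connected π = (1 ≤ size π) × (∀ m → 1 ≤ m → m < size π → ¬ SplitsAt (proj₁ π) m)

connected-sound : ∀ π → T (connectedB π) → Connected π
connected-sound π@(l , _) t with ∧-split {1 ≤ᵇ length l} (T⇒≡ t)
... | p , q = ≤ᵇ-true 1 (length l) p , λ m 1≤m m<n s → true≢false (splitB-complete l m s)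
  (not-true (all-true {p = λ m → not (splitB l m)} q (∈-range1 1≤m (ℕP.∸-monoˡ-≤ 1 m<n))))

connected-complete : ∀ π → Connected π → T (connectedB π)
connected-complete π@(l , _) (1≤n , h) = ≡⇒T (cong₂ _∧_ (≤ᵇ-yes 1 (length l) 1≤n)
  (all-intro {p = λ m → not (splitB l m)} (range1 (length l ∸ 1)) (λ {m} i → cong not (unsplit m (range1-∈ i)))))
  where
  unsplit : ∀ m → InRange (length l ∸ 1) m → splitB l m ≡ false
  unsplit m (1≤m , m≤) with splitB l m in e
  ... | false = refl
  ... | true  = ⊥-elim (h m 1≤m (subst (suc m ≤_) (ℕP.m+[n∸m]≡n 1≤n) (s≤s m≤)) (splitB-sound l m e))

at-++ˡ : ∀ l r {j} → 1 ≤ j → j ≤ length l → at (l ++ r) j ≡ at l j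
at-++ˡ (x ∷ l) r {suc zero}    _ _       = refl
at-++ˡ (x ∷ l) r {suc (suc j)} _ (s≤s h) = at-++ˡ l r {suc j} (s≤s z≤n) h

at-++ʳ : ∀ l r i → at (l ++ r) (length l + suc i) ≡ at r (suc i)
at-++ʳ []          r i = refl
at-++ʳ (x ∷ [])    r i = refl
at-++ʳ (x ∷ y ∷ l) r i = at-++ʳ (y ∷ l) r i

at-∈ : ∀ l {j} → 1 ≤ j → j ≤ length l → at l j ∈ l
at-∈ (x ∷ l) {suc zero}    _ _       = here refl
at-∈ (x ∷ l) {suc (suc j)} _ (s≤s h) = there (at-∈ l {suc j} (s≤s z≤n) h)

∈-at : ∀ {y l} → y ∈ l → Σ ℕ λ i → (suc i ≤ length l) × (at l (suc i) ≡ y)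
∈-at (here refl) = 0 , s≤s z≤n , refl
∈-at (there h) with ∈-at h
... | i , i< , e = suc i , s≤s i< , e

∈-shiftBy : ∀ {y k l} → y ∈ shiftBy k l → k ≤ y
∈-shiftBy {k = k} h with ∈-map⁻ (λ x → k + x) h
... | x , _ , refl = ℕP.m≤m+n k x

-- All labels on the left are below `nb l`, and all those on the right are at least `nb l`.
splits-++ : ∀ l r → SplitsAt (l ++ shiftBy (nb l) r) (length l)
splits-++ l r j k 1≤j j≤ m<k k≤ e = ℕP.<⇒≱ (lookup-All (labels-< l) (at-∈ l 1≤j j≤))
  (subst (nb l ≤_) (trans (sym e') (trans (sym e) (at-++ˡ l (shiftBy (nb l) r) 1≤j j≤))) (∈-shiftBy (at-∈ (shiftBy (nb l) r) (s≤s z≤n) i<)))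
  where
  i = k ∸ suc (length l)
  k≡ : length l + suc i ≡ k
  k≡ = trans (ℕP.+-suc (length l) i) (ℕP.m+[n∸m]≡n m<k)
  e' : at (l ++ shiftBy (nb l) r) k ≡ at (shiftBy (nb l) r) (suc i)
  e' = trans (cong (at (l ++ shiftBy (nb l) r)) (sym k≡)) (at-++ʳ l (shiftBy (nb l) r) i)
  i< : suc i ≤ length (shiftBy (nb l) r)
  i< = ℕP.+-cancelˡ-≤ (length l) (suc i) _ (subst₂ _≤_ (sym k≡) (length-++ l) k≤)

splits-prefix : ∀ l r m → m < length l → SplitsAt (l ++ r) m → SplitsAt l m
splits-prefix l r m m<n s j k 1≤j j≤m m<k k≤ e = s j k 1≤j j≤m m<k
  (ℕP.≤-trans k≤ (subst (length l ≤_) (sym (length-++ l)) (ℕP.m≤m+n (length l) (length r))))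
  (trans (at-++ˡ l r 1≤j (ℕP.≤-trans j≤m (ℕP.<⇒≤ m<n))) (trans e (sym (at-++ˡ l r (ℕP.≤-trans (s≤s z≤n) m<k) k≤))))

++-cancel : ∀ (l l' : List ℕ) {r r'} → length l ≡ length l' → l ++ r ≡ l' ++ r' → (l ≡ l') × (r ≡ r')
++-cancel []      []        _ e = refl , e
++-cancel (x ∷ l) (x' ∷ l') n e with ∷-injective e
... | refl , e' with ++-cancel l l' (ℕP.suc-injective n) e'
...   | refl , e'' = refl , e''

shiftBy-injective : ∀ k r r' → shiftBy k r ≡ shiftBy k r' → r ≡ r'
shiftBy-injective k []      []        e = refl
shiftBy-injective k (x ∷ r) (x' ∷ r') e with ∷-injective e
... | e₁ , e₂ = cong₂ _∷_ (ℕP.+-cancelˡ-≡ k x x' e₁) (shiftBy-injective k r r' e₂)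

-- Otherwise the end of the shorter head would be a cut through the longer head, which is connected.
not-shorter : ∀ π ρ π' ρ' → Connected π → Connected π' → proj₁ (π ∙ ρ) ≡ proj₁ (π' ∙ ρ') → ¬ (size π < size π')
not-shorter π@(l , _) ρ@(r , _) π'@(l' , _) ρ'@(r' , _) (1≤n , _) (_ , h) e lt = h (length l) 1≤n lt
  (splits-prefix l' (shiftBy (nb l') r') (length l) lt
    (subst (λ L → SplitsAt L (length l)) (trans (sym (labels-∙ π ρ)) (trans e (labels-∙ π' ρ'))) (splits-++ l r)))

∙-cancel : ∀ π ρ π' ρ' → Connected π → Connected π' → π ∙ ρ ≡ π' ∙ ρ' → (π ≡ π') × (ρ ≡ ρ')
∙-cancel π@(l , _) ρ@(r , _) π'@(l' , _) ρ'@(r' , _) c c' e = SP-≡ (proj₁ parts) ,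
  SP-≡ (shiftBy-injective (nb l) r r' (trans (proj₂ parts) (cong (λ L → shiftBy (nb L) r') (sym (proj₁ parts)))))
  where
  e₁ : proj₁ (π ∙ ρ) ≡ proj₁ (π' ∙ ρ')
  e₁ = cong proj₁ e
  same-size : length l ≡ length l'
  same-size = ℕP.≤-antisym (ℕP.≮⇒≥ (not-shorter π' ρ' π ρ c' c (sym e₁))) (ℕP.≮⇒≥ (not-shorter π ρ π' ρ' c c' e₁))
  parts : (l ≡ l') × (shiftBy (nb l) r ≡ shiftBy (nb l') r')
  parts = ++-cancel l l' same-size (trans (sym (labels-∙ π ρ)) (trans e₁ (labels-∙ π' ρ')))

juxtapose : List SetPartition → SetPartition
juxtapose = foldr _∙_ ∅

∙-size : ∀ π ρ → size (π ∙ ρ) ≡ size π + size ρ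
∙-size π ρ = trans (cong length (labels-∙ π ρ)) (trans (length-++ (proj₁ π)) (cong (λ k → length (proj₁ π) + k) (length-map (λ x → nb (proj₁ π) + x) (proj₁ ρ))))

∅≢∙ : ∀ π ρ → Connected π → ∅ ≢ π ∙ ρ
∅≢∙ π ρ (1≤n , _) e = ℕP.<⇒≱ (ℕP.≤-trans 1≤n (ℕP.m≤m+n (size π) (size ρ))) (ℕP.≤-reflexive (trans (sym (∙-size π ρ)) (cong size (sym e))))

juxtapose-injective : ∀ {L L'} → All Connected L → All Connected L' → juxtapose L ≡ juxtapose L' → L ≡ L'
juxtapose-injective []                 []                   e = refl
juxtapose-injective {L' = π ∷ L'} []   (c ∷ cs)             e = ⊥-elim (∅≢∙ π (juxtapose L') c e)
juxtapose-injective {L = π ∷ L} (c ∷ cs) []                 e = ⊥-elim (∅≢∙ π (juxtapose L) c (sym e))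
juxtapose-injective {π ∷ L} {π' ∷ L'} (c ∷ cs) (c' ∷ cs') e = cong₂ _∷_ (proj₁ parts) (juxtapose-injective cs cs' (proj₂ parts))
  where
  parts : (π ≡ π') × (juxtapose L ≡ juxtapose L')
  parts = ∙-cancel π (juxtapose L) π' (juxtapose L') c c' e

rgsFrom-++ : ∀ m xs ys → rgsFrom m (xs ++ ys) ≡ rgsFrom m xs ∧ rgsFrom (m ⊔ nb xs) ys
rgsFrom-++ m []       ys = cong (λ k → rgsFrom k ys) (sym (ℕP.⊔-identityʳ m))
rgsFrom-++ m (x ∷ xs) ys = trans (cong ((x ≤ᵇ m) ∧_) (rgsFrom-++ (m ⊔ suc x) xs ys))
  (trans (sym (∧-assoc (x ≤ᵇ m) (rgsFrom (m ⊔ suc x) xs) (rgsFrom (m ⊔ suc x ⊔ nb xs) ys)))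
    (cong (λ k → ((x ≤ᵇ m) ∧ rgsFrom (m ⊔ suc x) xs) ∧ rgsFrom k ys) (ℕP.⊔-assoc m (suc x) (nb xs))))

rgsFrom-shiftBy : ∀ k m l → rgsFrom (k + m) (shiftBy k l) ≡ rgsFrom m l
rgsFrom-shiftBy k m []      = refl
rgsFrom-shiftBy k m (x ∷ l) = cong₂ _∧_
  (≡⇔ (λ e → ≤ᵇ-yes x m (ℕP.+-cancelˡ-≤ k x m (≤ᵇ-true (k + x) (k + m) e))) (λ e → ≤ᵇ-yes (k + x) (k + m) (ℕP.+-monoʳ-≤ k (≤ᵇ-true x m e))))
  (trans (cong (λ z → rgsFrom z (shiftBy k l)) (trans (cong ((k + m) ⊔_) (sym (ℕP.+-suc k x))) (sym (ℕP.+-distribˡ-⊔ k m (suc x)))))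
    (rgsFrom-shiftBy k (m ⊔ suc x) l))

least : ∀ (p : ℕ → Bool) d k → p (k + d) ≡ true → Σ ℕ λ m → (k ≤ m) × (m ≤ k + d) × (p m ≡ true) × (∀ i → k ≤ i → i < m → p i ≡ false)
least p zero    k e = k , ℕP.≤-refl , ℕP.≤-reflexive (sym (ℕP.+-identityʳ k)) , subst (λ n → p n ≡ true) (ℕP.+-identityʳ k) e ,
  λ i k≤i i<k → ⊥-elim (ℕP.<⇒≱ i<k k≤i)
least p (suc d) k e with p k in pk
... | true  = k , ℕP.≤-refl , ℕP.m≤m+n k (suc d) , pk , λ i k≤i i<k → ⊥-elim (ℕP.<⇒≱ i<k k≤i)
... | false with least p d (suc k) (subst (λ n → p n ≡ true) (ℕP.+-suc k d) e)
...   | m , k<m , m≤ , pm , before = m , ℕP.<⇒≤ k<m , subst (m ≤_) (sym (ℕP.+-suc k d)) m≤ , pm , below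
  where
  below : ∀ i → k ≤ i → i < m → p i ≡ false
  below i k≤i i<m with ℕP.m≤n⇒m<n∨m≡n k≤i
  ... | inj₁ k<i  = before i k<i i<m
  ... | inj₂ refl = pk

has-∈ : ∀ b a → has b a ≡ true → b ∈ a
has-∈ b (x ∷ a) h with x ≡ᵇ b in eq
... | true  = here (sym (≡ᵇ-true x b eq))
... | false = there (has-∈ b a h)

record FirstFactor (σ : SetPartition) : Set where
  field
    head    : SetPartition
    tail    : SetPartition
    split   : σ ≡ head ∙ tail
    connect : Connected head

-- Cut after the shortest nonempty prefix that is a union of blocks.
firstFactor : ∀ σ → 1 ≤ size σ → FirstFactor σ
firstFactor σ@(l , t) 1≤n = cut (least (splitB l) (length l ∸ 1) 1 (trans (cong (splitB l) (ℕP.m+[n∸m]≡n 1≤n)) (splitB-complete l (length l) (λ j k _ _ m<k k≤ → ⊥-elim (ℕP.<⇒≱ m<k k≤)))))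
  where
  cut : (Σ ℕ λ m → (1 ≤ m) × (m ≤ 1 + (length l ∸ 1)) × (splitB l m ≡ true) × (∀ i → 1 ≤ i → i < m → splitB l i ≡ false)) → FirstFactor σ
  cut (m , 1≤m , m≤′ , sm , before) = record
    { head    = l₁ , ≡⇒T (proj₁ rgs)
    ; tail    = l₂ , ≡⇒T rgs₂
    ; split   = SP-≡ (sym (trans (labels-∙ (l₁ , ≡⇒T (proj₁ rgs)) (l₂ , ≡⇒T rgs₂)) (trans (cong (l₁ ++_) (sym r≡)) l≡)))
    ; connect = subst (1 ≤_) (sym len₁) 1≤m , connected
    }
    where
    m≤ : m ≤ length l
    m≤ = subst (m ≤_) (ℕP.m+[n∸m]≡n 1≤n) m≤′
    l₁ = take m l
    r = drop m l
    k = nb l₁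
    l₂ = map (_∸ k) r
    l≡ : l₁ ++ r ≡ l
    l≡ = take-++-drop m l
    len₁ : length l₁ ≡ m
    len₁ = length-take l m≤
    splits : SplitsAt l m
    splits = splitB-sound l m sm
    rgs : (isRGS l₁ ≡ true) × (rgsFrom k r ≡ true)
    rgs = ∧-split {isRGS l₁} (trans (sym (rgsFrom-++ 0 l₁ r)) (trans (cong isRGS l≡) (T⇒≡ t)))
    -- By restricted growth every label below `k` occurs in `l₁`; if it occurred in `r` as well, its
    -- block would cross the cut at `m`.
    beyond : ∀ {y} → y ∈ r → k ≤ y
    beyond {y} y∈ with k ℕP.≤? y
    ... | yes h = h
    ... | no ≰ = ⊥-elim (collide (∈-at y∈) (∈-at (∈-resp-↭ (↭-reverse l₁) (has-∈ y (reverse l₁)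
            (RG-has (isRGS⇒RG (reverse l₁) (trans (cong isRGS (reverse-involutive l₁)) (proj₁ rgs))) (subst (y <_) (sym (nb-reverse l₁)) (ℕP.≰⇒> ≰)))))))
      where
      collide : (Σ ℕ λ i → (suc i ≤ length r) × (at r (suc i) ≡ y)) → (Σ ℕ λ j → (suc j ≤ length l₁) × (at l₁ (suc j) ≡ y)) → ⊥
      collide (i , i< , ei) (j , j< , ej) = splits (suc j) (m + suc i) (s≤s z≤n) (subst (suc j ≤_) len₁ j<)
        (subst (_≤ m + suc i) (ℕP.+-comm m 1) (ℕP.+-monoʳ-≤ m (s≤s z≤n)))
        (subst (m + suc i ≤_) (trans (cong (λ z → z + length r) (sym len₁)) (trans (sym (length-++ l₁)) (cong length l≡))) (ℕP.+-monoʳ-≤ m i<))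
        (trans (trans (cong (λ L → at L (suc j)) (sym l≡)) (trans (at-++ˡ l₁ r (s≤s z≤n) j<) ej))
          (sym (trans (cong₂ at (sym l≡) (cong (λ z → z + suc i) (sym len₁))) (trans (at-++ʳ l₁ r i) ei))))
    r≡ : r ≡ shiftBy k l₂
    r≡ = unshift r beyond
      where
      unshift : ∀ r → (∀ {y} → y ∈ r → k ≤ y) → r ≡ shiftBy k (map (_∸ k) r)
      unshift []      h = refl
      unshift (y ∷ r) h = cong₂ _∷_ (sym (ℕP.m+[n∸m]≡n (h (here refl)))) (unshift r (λ i → h (there i)))
    rgs₂ : isRGS l₂ ≡ true
    rgs₂ = trans (sym (rgsFrom-shiftBy k 0 l₂)) (trans (cong₂ rgsFrom (ℕP.+-identityʳ k) (sym r≡)) (proj₂ rgs))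
    connected : ∀ i → 1 ≤ i → i < length l₁ → ¬ SplitsAt l₁ i
    connected i 1≤i i< s = true≢false (splitB-complete l i extend-split) (before i 1≤i i<m)
      where
      i<m : i < m
      i<m = subst (i <_) len₁ i<
      -- A cut of the head is a cut of all of `l`, because positions beyond `m` share no block with
      -- the head. The minimality of `m` then rules it out.
      extend-split : SplitsAt l i
      extend-split j k′ 1≤j j≤i i<k k≤ e with k′ ℕP.≤? m
      ... | no ≰   = splits j k′ 1≤j (ℕP.≤-trans j≤i (ℕP.<⇒≤ i<m)) (ℕP.≰⇒> ≰) k≤ e
      ... | yes k≤m = s j k′ 1≤j j≤i i<k k≤₁ (trans (sym (at-++ˡ l₁ r 1≤j (ℕP.≤-trans j≤i (ℕP.<⇒≤ i<))))
          (trans (cong (λ L → at L j) l≡) (trans e (trans (cong (λ L → at L k′) (sym l≡)) (at-++ˡ l₁ r (ℕP.≤-trans (s≤s z≤n) i<k) k≤₁)))))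
        where
        k≤₁ : k′ ≤ length l₁
        k≤₁ = subst (k′ ≤_) (sym len₁) k≤m

factorization : ∀ n σ → size σ ≤ n → Σ (List SetPartition) λ L → All Connected L × (juxtapose L ≡ σ)
factorization n       ([]    , tt) h = [] , [] , refl
factorization (suc n) σ@(_ ∷ _ , _) h = prepend (factorization n tail smaller)
  where
  open FirstFactor (firstFactor σ (s≤s z≤n))
  smaller : size tail ≤ n
  smaller = ℕP.≤-pred (ℕP.≤-trans (ℕP.+-monoˡ-≤ (size tail) (proj₁ connect)) (subst (_≤ suc n) (trans (cong size split) (∙-size head tail)) h))
  prepend : (Σ (List SetPartition) λ L → All Connected L × (juxtapose L ≡ tail)) → Σ (List SetPartition) λ L → All Connected L × (juxtapose L ≡ σ)
  prepend (L , c , e) = head ∷ L , connect ∷ c , trans (cong (head ∙_) e) (sym split)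

factors : SetPartition → List SetPartition
factors σ = proj₁ (factorization (size σ) σ ℕP.≤-refl)

factors-connected : ∀ σ → All Connected (factors σ)
factors-connected σ = proj₁ (proj₂ (factorization (size σ) σ ℕP.≤-refl))

juxtapose-factors : ∀ σ → juxtapose (factors σ) ≡ σ
juxtapose-factors σ = proj₂ (proj₂ (factorization (size σ) σ ℕP.≤-refl))

factors-juxtapose : ∀ {L} → All Connected L → factors (juxtapose L) ≡ L
factors-juxtapose {L} c = juxtapose-injective (factors-connected (juxtapose L)) c (juxtapose-factors (juxtapose L))

-- Parity of blocks in concatenations

odd?-cat : ∀ a x b → odd? (nb a + x) (cat a b) ≡ odd? x b
odd?-cat a x []      = odd?-absent (nb a + x) a (has-beyond a x)
odd?-cat a x (z ∷ b) = cong₂ (λ p o → if p then not o else o) (+-≡ᵇ (nb a) z x) (odd?-cat a x b)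

shifted≢ : ∀ {y} a x → y < nb a → (nb a + x ≡ᵇ y) ≡ false
shifted≢ {y} a x lt = ≡ᵇ-no (nb a + x) y (λ e → ℕP.<⇒≱ lt (subst (nb a ≤_) e (ℕP.m≤m+n (nb a) x)))

has-cat-left : ∀ {y} a b → y < nb a → has y (cat a b) ≡ has y a
has-cat-left {y} a []      lt = refl
has-cat-left {y} a (x ∷ b) lt = trans (cong (_∨ has y (cat a b)) (shifted≢ a x lt)) (has-cat-left a b lt)

odd?-cat-left : ∀ {y} a b → y < nb a → odd? y (cat a b) ≡ odd? y a
odd?-cat-left {y} a []      lt = refl
odd?-cat-left {y} a (x ∷ b) lt = trans (cong (λ p → if p then not (odd? y (cat a b)) else odd? y (cat a b)) (shifted≢ a x lt)) (odd?-cat-left a b lt)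

oddBlocks-cat : ∀ a b → OddBlocks a → OddBlocks b → OddBlocks (cat a b)
oddBlocks-cat a b oa ob y h with y ℕP.<? nb a
... | yes lt = trans (odd?-cat-left a b lt) (oa y (trans (sym (has-cat-left a b lt)) h))
... | no nlt = subst (λ z → odd? z (cat a b) ≡ true) y≡ (trans (odd?-cat a x b)
    (ob x (trans (sym (has-cat a x b)) (subst (λ z → has z (cat a b) ≡ true) (sym y≡) h))))
  where
  x = y ∸ nb a
  y≡ : nb a + x ≡ y
  y≡ = ℕP.m+[n∸m]≡n (ℕP.≮⇒≥ nlt)

oddBlocks-catˡ : ∀ a b → OddBlocks (cat a b) → OddBlocks a
oddBlocks-catˡ a b o y h = trans (sym (odd?-cat-left a b (has-< y a h))) (o y (trans (has-cat-left a b (has-< y a h)) h))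

oddBlocks-catʳ : ∀ a b → OddBlocks (cat a b) → OddBlocks b
oddBlocks-catʳ a b o x h = trans (sym (odd?-cat a x b)) (o (nb a + x) (trans (has-cat a x b) h))

allOdd-∙ : ∀ π σ → AllOdd π → AllOdd σ → AllOdd (π ∙ σ)
allOdd-∙ π σ oπ oσ = OddBlocks⇒AllOdd (π ∙ σ) (subst OddBlocks (sym (rev-∙ π σ)) (oddBlocks-cat (rev π) (rev σ) (AllOdd⇒OddBlocks π oπ) (AllOdd⇒OddBlocks σ oσ)))

allOdd-∙⁻ : ∀ π σ → AllOdd (π ∙ σ) → AllOdd π × AllOdd σ
allOdd-∙⁻ π σ o = OddBlocks⇒AllOdd π (oddBlocks-catˡ (rev π) (rev σ) o′) , OddBlocks⇒AllOdd σ (oddBlocks-catʳ (rev π) (rev σ) o′)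
  where
  o′ : OddBlocks (cat (rev π) (rev σ))
  o′ = subst OddBlocks (rev-∙ π σ) (AllOdd⇒OddBlocks (π ∙ σ) o)

connectedOdd⇒ : ∀ π → ConnectedOdd π → Connected π × AllOdd π
connectedOdd⇒ π t with ∧-split {connectedB π} (T⇒≡ t)
... | c , o = connected-sound π (≡⇒T c) , ≡⇒T o

⇒connectedOdd : ∀ π → Connected π → AllOdd π → ConnectedOdd π
⇒connectedOdd π c o = ≡⇒T (cong₂ _∧_ (T⇒≡ (connected-complete π c)) (T⇒≡ o))

connectedOdd-connected : ∀ {L} → All ConnectedOdd L → All Connected L
connectedOdd-connected []               = []
connectedOdd-connected {π ∷ L} (p ∷ ps) = proj₁ (connectedOdd⇒ π p) ∷ connectedOdd-connected ps

juxtapose-odd : ∀ {L} → All ConnectedOdd L → AllOdd (juxtapose L)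
juxtapose-odd []                   = tt
juxtapose-odd {π ∷ L} (p ∷ ps) = allOdd-∙ π (juxtapose L) (proj₂ (connectedOdd⇒ π p)) (juxtapose-odd ps)

odd-connectedOdd : ∀ {L} → All Connected L → AllOdd (juxtapose L) → All ConnectedOdd L
odd-connectedOdd []                 o = []
odd-connectedOdd {π ∷ L} (c ∷ cs) o = ⇒connectedOdd π c (proj₁ os) ∷ odd-connectedOdd cs (proj₂ os)
  where os = allOdd-∙⁻ π (juxtapose L) o

-- Free generation

monomial-juxtapose : ∀ {v} → Multiplicative v → ∀ L → monomial v L ≈ v (juxtapose L)
monomial-juxtapose m []      w = sym (Multiplicative.unit m w)
monomial-juxtapose {v} m (π ∷ L) w = trans (*S-cong {v π} {v π} {monomial v L} {v (juxtapose L)} (λ _ → refl) (monomial-juxtapose m L) w)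
  (sym (Multiplicative.mult m π (juxtapose L) w))

freelyGenerates : ∀ {v} → Multiplicative v → IsBasisNCΩ AllOdd v → FreelyGeneratesNCΩ ConnectedOdd v
freelyGenerates {v} m (member , independent , spans) = (λ π t → member π (proj₂ (connectedOdd⇒ π t))) , free , generate
  where
  free : LinIndep (All ConnectedOdd) (monomial v)
  -- The coefficients, indexed by words in connected partitions, are transported along `factors`,
  -- which inverts `juxtapose` on such words.
  free K u ps c z = pull K ps (independent (map juxtapose K) (unique-map injective u) (odds K ps) (c ∘ factors)
      (λ w → trans (reindex K ps w) (z w)))
    where
    injective : ∀ {L L'} → L ∈ K → L' ∈ K → juxtapose L ≡ juxtapose L' → L ≡ L'
    injective i i' = juxtapose-injective (connectedOdd-connected (lookup-All ps i)) (connectedOdd-connected (lookup-All ps i'))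
    odds : ∀ K → All (All ConnectedOdd) K → All AllOdd (map juxtapose K)
    odds []      []       = []
    odds (L ∷ K) (p ∷ ps) = juxtapose-odd p ∷ odds K ps
    reindex : ∀ K → All (All ConnectedOdd) K → lincomb v (map (λ i → i , c (factors i)) (map juxtapose K)) ≈ lincomb (monomial v) (map (λ i → i , c i) K)
    reindex []      []       w = refl
    reindex (L ∷ K) (p ∷ ps) w = cong₂ _+q_
      (cong₂ _*q_ (cong c (factors-juxtapose (connectedOdd-connected p))) (sym (monomial-juxtapose m L w))) (reindex K ps w)
    pull : ∀ K → All (All ConnectedOdd) K → All (λ i → c (factors i) ≡ 0ℚ) (map juxtapose K) → All (λ i → c i ≡ 0ℚ) K
    pull []      []       []       = []
    pull (L ∷ K) (p ∷ ps) (e ∷ es) = trans (cong c (sym (factors-juxtapose (connectedOdd-connected p)))) e ∷ pull K ps es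
  generate : SpansNCΩ (All ConnectedOdd) (monomial v)
  generate g gΩ = regenerate (spans g gΩ)
    where
    regenerate : Span AllOdd v g → Span (All ConnectedOdd) (monomial v) g
    regenerate (L , os , e) = map (λ x → factors (proj₁ x) , proj₂ x) L , All-map (λ x o → odd x o) os , λ w → trans (e w) (reindex L w)
      where
      odd : ∀ (x : SetPartition × ℚ) → AllOdd (proj₁ x) → All ConnectedOdd (factors (proj₁ x))
      odd (σ , _) o = odd-connectedOdd (factors-connected σ) (subst AllOdd (sym (juxtapose-factors σ)) o)
      reindex : ∀ L → lincomb v L ≈ lincomb (monomial v) (map (λ x → factors (proj₁ x) , proj₂ x) L)
      reindex []            w = refl
      reindex ((σ , c) ∷ L) w = cong₂ (λ x y → c *q x +q y)
        (trans (cong (λ σ → v σ w) (sym (juxtapose-factors σ))) (sym (monomial-juxtapose m (factors σ) w))) (reindex L w)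

theorem10p7 : (q : SetPartition → Series) → (∀ π → ThetaRel (hS π) (q π)) →
    (∀ π → OmegaRel (q π) (q π))
    × IsBasisNCΩ AllOdd q
    × FreelyGeneratesNCΩ ConnectedOdd pS
    × FreelyGeneratesNCΩ ConnectedOdd q
theorem10p7 q θ = omega-q , basis-q , freelyGenerates multiplicative-p basis-p ,
  freelyGenerates (multiplicative {q} Qseries q-expand refl Qseries-length Qseries-cat) basis-q
  where open Image q θ
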